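{- Let $F=F[A,B]$ be a bipartite graph with parts $A,B$, $|A|\leq|B|$, and let $F^{good}$ be a good odd-ballooning of $F$. Set $q=q(\mathcal{M}(F^{good}))$. Then for sufficiently large $n$, every graph $G\in{\rm EX}(n,F^{good})$ has a partition $V(G)=W\cup S_1\cup S_2$ such that: (i) $|W|=q-1$ and $|S_i|\in\{\lfloor\frac{n-q+1}{2}\rfloor,\lceil\frac{n-q+1}{2}\rceil\}$ for $i=1,2$; (ii) there is a constant $M=M(|F^{good}|)$ such that for $i=1,2$ there exists $S'_i\subseteq S_i$ with $|S_i\setminus S'_i|\leq M$ and $N_G(v)=V(G)\setminus S_i$ for every $v\in S'_i$.
   Context: All graphs are finite and simple. ${\rm EX}(n,H)$ is the set of $H$-free $n$-vertex graphs with maximum number of edges. An odd-ballooning of a graph $F$ is obtained from $F$ by replacing each edge by an odd cycle through that edge, all new vertices of distinct cycles being distinct. For bipartite $F=F[A,B]$ with $|A|\leq|B|$, an odd-ballooning is good if a replacing cycle may be a triangle only when the corresponding edge is incident with a leaf (degree-1 vertex) in $B$. For a finite family $\mathcal{H}$ with $\min\chi=r+1\geq3$ (here $r=2$), the decomposition family $\mathcal{M}(\mathcal{H})$ is the family of minimal graphs $M$ without isolated vertices such that some $H\in\mathcal{H}$ satisfies $H\subseteq(M\cup\overline{K_t})\bigotimes T((r-1)t,r-1)$, $t=|H|$, where $\cup$ is disjoint union, $\bigotimes$ is the join and $T(\cdot,\cdot)$ the Turán graph. For bipartite $B'$, $q(B')$ is the minimum size of an independent set meeting every edge of $B'$; for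 a family $\mathcal{M}$ containing bipartite graphs, $q(\mathcal{M})$ is the minimum of $q(B')$ over bipartite $B'\in\mathcal{M}$. -}

module Defs where

open import Data.Nat using (ℕ; zero; suc; _+_; _*_; _≤_; _<ᵇ_)
open import Data.Bool using (Bool; true; false; if_then_else_; _∧_; not)
open import Data.Fin using (Fin; zero; suc; toℕ; splitAt; _<_)
open import Data.Sum using (_⊎_; inj₁; inj₂)
open import Data.Product using (Σ; ∃; _×_; _,_)
open import Relation.Binary.PropositionalEquality using (_≡_; _≢_; refl)
open import Relation.Nullary using (¬_)
open import Function.Bundles using (_⇔_)

record Graph (n : ℕ) : Set where
  field
    adj : Fin n → Fin n → Bool
    sym : ∀ x y → adj x y ≡ adj y x
    irr : ∀ x → adj x x ≡ false
open Graph public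

count : ∀ {n} → (Fin n → Bool) → ℕ
count {zero}  P = 0
count {suc n} P = (if P zero then 1 else 0) + count (λ i → P (suc i))

sumFin : ∀ {n} → (Fin n → ℕ) → ℕ
sumFin {zero}  f = 0
sumFin {suc n} f = f zero + sumFin (λ i → f (suc i))

edges : ∀ {n} → Graph n → ℕ
edges G = sumFin (λ i → count (λ j → (toℕ i <ᵇ toℕ j) ∧ adj G i j))

deg : ∀ {n} → Graph n → Fin n → ℕ
deg G v = count (adj G v)

_⊆_ : ∀ {h n} → Graph h → Graph n → Set
_⊆_ {h} {n} H G =
  Σ (Fin h → Fin n) λ f →
    (∀ x y → f x ≡ f y → x ≡ y) ×
    (∀ x y → adj H x y ≡ true → adj G (f x) (f y) ≡ true)

Free : ∀ {h n} → Graph h → Graph n → Set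
Free H G = ¬ (H ⊆ G)

IsEx : ∀ {h} (n : ℕ) → Graph h → Graph n → Set
IsEx n H G = Free H G × (∀ (G' : Graph n) → Free H G' → edges G' ≤ edges G)

NoIsolated : ∀ {m} → Graph m → Set
NoIsolated M = ∀ v → ∃ λ w → adj M v w ≡ true

Bipartite : ∀ {m} → Graph m → Set
Bipartite {m} M =
  Σ (Fin m → Bool) λ c → ∀ x y → adj M x y ≡ true → c x ≢ c y

IndCover : ∀ {m} → Graph m → (Fin m → Bool) → Set
IndCover M S =
  (∀ x y → adj M x y ≡ true → ¬ (S x ≡ true × S y ≡ true)) ×
  (∀ x y → adj M x y ≡ true → S x ≡ true ⊎ S y ≡ true)

qB : ∀ {m} → Graph m → ℕ → Set
qB {m} M q =
  (Σ (Fin m → Bool) λ S → IndCover M S × count S ≡ q) ×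
  (∀ (S : Fin m → Bool) → IndCover M S → q ≤ count S)

-- (M ∪ K̄_t) ⊗ T((r-1)t, r-1) for r = 2, i.e. (M ∪ K̄_t) ⊗ K̄_t,
-- on vertex set Fin ((m + t) + t):
--   first m vertices: M; next t: isolated K̄_t; last t: the other class.

adjS : ∀ {m t} → Graph m → (Fin m ⊎ Fin t) ⊎ Fin t → (Fin m ⊎ Fin t) ⊎ Fin t → Bool
adjS M (inj₁ (inj₁ a)) (inj₁ (inj₁ b)) = adj M a b
adjS M (inj₁ (inj₁ a)) (inj₁ (inj₂ b)) = false
adjS M (inj₁ (inj₂ a)) (inj₁ _)        = false
adjS M (inj₁ _)        (inj₂ _)        = true
adjS M (inj₂ _)        (inj₁ _)        = true
adjS M (inj₂ _)        (inj₂ _)        = false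

adjS-sym : ∀ {m t} (M : Graph m) (x y : (Fin m ⊎ Fin t) ⊎ Fin t) → adjS M x y ≡ adjS M y x
adjS-sym M (inj₁ (inj₁ a)) (inj₁ (inj₁ b)) = sym M a b
adjS-sym M (inj₁ (inj₁ a)) (inj₁ (inj₂ b)) = refl
adjS-sym M (inj₁ (inj₂ a)) (inj₁ (inj₁ b)) = refl
adjS-sym M (inj₁ (inj₂ a)) (inj₁ (inj₂ b)) = refl
adjS-sym M (inj₁ (inj₁ _)) (inj₂ _)        = refl
adjS-sym M (inj₁ (inj₂ _)) (inj₂ _)        = refl
adjS-sym M (inj₂ _)        (inj₁ (inj₁ _)) = refl
adjS-sym M (inj₂ _)        (inj₁ (inj₂ _)) = refl
adjS-sym M (inj₂ _)        (inj₂ _)        = refl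

adjS-irr : ∀ {m t} (M : Graph m) (x : (Fin m ⊎ Fin t) ⊎ Fin t) → adjS M x x ≡ false
adjS-irr M (inj₁ (inj₁ a)) = irr M a
adjS-irr M (inj₁ (inj₂ a)) = refl
adjS-irr M (inj₂ a)        = refl

classify : ∀ {m t} → Fin ((m + t) + t) → (Fin m ⊎ Fin t) ⊎ Fin t
classify {m} {t} x with splitAt (m + t) x
... | inj₁ a = inj₁ (splitAt m a)
... | inj₂ b = inj₂ b

DecompHost : ∀ {m} → Graph m → (t : ℕ) → Graph ((m + t) + t)
DecompHost M t = record
  { adj = λ x y → adjS M (classify x) (classify y)
  ; sym = λ x y → adjS-sym M (classify x) (classify y)
  ; irr = λ x → adjS-irr M (classify x)
  }

DecCond : ∀ {h m} → Graph h → Graph m → Set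
DecCond {h} H M = H ⊆ DecompHost M h

InDecomp : ∀ {h m} → Graph h → Graph m → Set
InDecomp H M =
  NoIsolated M × DecCond H M ×
  (∀ (m' : ℕ) (M' : Graph m') → NoIsolated M' → DecCond H M' → M' ⊆ M → M ⊆ M')

IsQ : ∀ {h} → Graph h → ℕ → Set
IsQ H q =
  (Σ ℕ λ m → Σ (Graph m) λ M → InDecomp H M × Bipartite M × qB M q) ×
  (∀ (m : ℕ) (M : Graph m) → InDecomp H M → Bipartite M → ∀ q' → qB M q' → q ≤ q')

IsOdd : ℕ → Set
IsOdd p = ∃ λ r → p ≡ suc (2 * r)

E : ∀ {k} → Graph k → Fin k → Fin k → Set
E F u v = (u < v) × adj F u v ≡ true

-- vertex i of the cycle a = c₀, c₁ = f 0, …, c_p = f (p-1), c_{p+1} = b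
cv : ∀ {h} (a b : Fin h) (p : ℕ) → (Fin p → Fin h) → ℕ → Fin h
cv a b p       f zero          = a
cv a b zero    f (suc i)       = b
cv a b (suc p) f (suc zero)    = f zero
cv a b (suc p) f (suc (suc i)) = cv (f zero) b p (λ j → f (suc j)) (suc i)

CycEdge : ∀ {h} (a b : Fin h) (p : ℕ) → (Fin p → Fin h) → Fin h → Fin h → Set
CycEdge a b p f x y =
  (x ≡ a × y ≡ b) ⊎ (x ≡ b × y ≡ a) ⊎
  (∃ λ i → i ≤ p ×
     ((x ≡ cv a b p f i × y ≡ cv a b p f (suc i)) ⊎
      (y ≡ cv a b p f i × x ≡ cv a b p f (suc i))))

-- H is an odd-ballooning of F: F embedded via φ; each edge uv of F
-- (u < v) gets p u v ≥ 1 (odd) new internal vertices forming the odd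
-- cycle φu – int 0 – … – int (p-1) – φv – φu of length p + 2; all new
-- vertices are distinct and fresh; H has exactly these vertices and edges.
record OddBallooning {k h} (F : Graph k) (H : Graph h) : Set where
  field
    φ        : Fin k → Fin h
    φ-inj    : ∀ x y → φ x ≡ φ y → x ≡ y
    p        : Fin k → Fin k → ℕ
    int      : (u v : Fin k) → Fin (p u v) → Fin h
    p-odd    : ∀ u v → E F u v → IsOdd (p u v)
    int-inj  : ∀ u v u' v' (j : Fin (p u v)) (j' : Fin (p u' v')) →
               E F u v → E F u' v' → int u v j ≡ int u' v' j' →
               u ≡ u' × v ≡ v' × toℕ j ≡ toℕ j'
    int-fresh : ∀ u v (j : Fin (p u v)) w → E F u v → int u v j ≢ φ w
    cover    : ∀ x → (∃ λ w → φ w ≡ x) ⊎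
               (∃ λ u → ∃ λ v → E F u v × ∃ λ (j : Fin (p u v)) → int u v j ≡ x)
    adj-iff  : ∀ x y → (adj H x y ≡ true) ⇔
               (∃ λ u → ∃ λ v → E F u v × CycEdge (φ u) (φ v) (p u v) (int u v) x y)

-- F = F[A,B] with B = {v | side v ≡ true}, A = complement, |A| ≤ |B|
BipartiteAB : ∀ {k} → Graph k → (Fin k → Bool) → Set
BipartiteAB F side =
  (∀ x y → adj F x y ≡ true → side x ≢ side y) ×
  count (λ v → not (side v)) ≤ count side

-- good: a replacing cycle is a triangle (p = 1) only if the edge is
-- incident with a leaf of F lying in B
Good : ∀ {k h} (F : Graph k) (side : Fin k → Bool) {H : Graph h} → OddBallooning F H → Set
Good F side ob = ∀ u v → E F u v → OddBallooning.p ob u v ≡ 1 →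
  (side u ≡ true × deg F u ≡ 1) ⊎ (side v ≡ true × deg F v ≡ 1)

{-# OPTIONS --safe #-}
-- Let q be minimal such that F^good has a proper 3-colouring with q vertices of colour S.  An S-class
-- meets every replacing cycle, and after moving its interior vertices along their cycles one finds a
-- colouring in which some s ∈ S shares none of its X-neighbours with another vertex of S.  Splitting all
-- vertices of F except the leaves in B gives another colouring whose S-X edges form a matching; this is
-- where goodness enters.
-- An extremal G is close to complete bipartite: by Σ d² ≥ (Σ d)²/n, the average over x of the number of
-- edges inside N(x) or inside its complement is small once most N(x) contain few edges, and they do since
-- a dense common link of many vertices would contain a complete tripartite graph.  Let W be the vertices with linearly
-- many neighbours on both sides.  Counting non-edges against the complete tripartite graph with parts
-- q-1, ⌊⌋, ⌈⌉ forces |W| = q-1: otherwise two dense types of vertices see q-1 common members of W and a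
-- further one, which takes the role of s.  A vertex outside W with h neighbours in its own part could also
-- take the role of s, and a matching of size h inside a part would give H as well; hence each part
-- spans O(h²) edges, the graph differs from the complete tripartite one in O(h²) pairs, and moving
-- one vertex across shows that the two large parts are balanced.
module Submission where

open import Defs
open import Data.Nat hiding (_≟_)
open import Data.Nat.Properties hiding (_≟_)
open import Data.Nat.DivMod using (m*n/n≡m; m*n%n≡0; +-distrib-/; /-monoˡ-≤; m/n*n≤m)
open import Data.Bool using (Bool; true; false; _∧_; _∨_; _xor_; not; if_then_else_)
open import Data.Bool.Properties using (T-≡; ∧-zeroʳ; ∧-identityʳ; xor-identityʳ; not-involutive)
open import Data.Fin using (Fin; zero; suc; toℕ; fromℕ<; _≟_; _↑ˡ_; _↑ʳ_)
open import Data.Fin.Properties using (splitAt-↑ˡ; splitAt-↑ʳ; toℕ-injective; toℕ<n; toℕ-fromℕ<)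
open import Data.Product using (Σ; ∃; _×_; _,_; proj₁; proj₂)
open import Data.Sum using (_⊎_; inj₁; inj₂)
open import Data.Empty using (⊥; ⊥-elim)
open import Data.Nat.Tactic.RingSolver using (solve-∀)
open import Relation.Nullary using (¬_; yes; no)
open import Function.Bundles using (Equivalence; _⇔_; mk⇔)
open import Relation.Nullary.Decidable using (⌊_⌋; decidable-stable)
open import Relation.Binary.PropositionalEquality using (_≡_; _≢_; refl; cong; cong₂; trans; subst) renaming (sym to ≡-sym)
open import Relation.Binary using (tri<; tri≈; tri>)
open import Function using (case_of_)

-- Counting

-- Why `q` is a minimum over colourings: in a copy of `H` inside the host of the decomposition
-- family, the far class takes Y, an independent cover of `M` takes S and the rest takes X;
-- conversely a proper colouring yields such an `M`. Most embeddings therefore place S first, then X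
-- greedily, then Y. The obstacle is that a vertex of W is only known to have linearly many
-- neighbours on each side, and several such vertices may have no common neighbour. So more than
-- `q - 1` vertices in W do not give a copy of `H` at once. A vertex known only through one large
-- neighbourhood can carry an S-vertex only if that vertex shares its X-neighbours with no other
-- S-vertex, and the rest of S needs members of W that large sets on both sides see in full.
-- Counting non-edges supplies these. Two scales are kept apart: `δ = n / L` bounds the defects of
-- the cut, `θ = n / m` is the degree threshold for W, and `L` is chosen after all densities lost to
-- pigeonholing. Ordered pairs and sums on both sides of an equation replace edges and subtraction.

⟦_⟧ : Bool → ℕ
⟦ b ⟧ = if b then 1 else 0

∧-intro : ∀ {a b} → a ≡ true → b ≡ true → a ∧ b ≡ true
∧-intro refl refl = refl

∧-elim : ∀ a {b} → a ∧ b ≡ true → a ≡ true × b ≡ true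
∧-elim true e = refl , e

not-elim : ∀ {a} → not a ≡ true → a ≡ false
not-elim {false} _ = refl

false≢true : ∀ {a : Set} {b} → b ≡ false → b ≡ true → a
false≢true refl ()

bool-cases : ∀ b → (b ≡ true) ⊎ (b ≡ false)
bool-cases true  = inj₁ refl
bool-cases false = inj₂ refl

≢true : ∀ {b} → b ≢ true → b ≡ false
≢true {true}  p = ⊥-elim (p refl)
≢true {false} p = refl

⟦⟧≤1 : ∀ b → ⟦ b ⟧ ≤ 1
⟦⟧≤1 true  = s≤s z≤n
⟦⟧≤1 false = z≤n

⟦⟧-mono : ∀ {a b} → (a ≡ true → b ≡ true) → ⟦ a ⟧ ≤ ⟦ b ⟧
⟦⟧-mono {true}  {true}  _ = ≤-refl
⟦⟧-mono {true}  {false} f = false≢true refl (f refl)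
⟦⟧-mono {false} _ = z≤n

⟦⟧-split : ∀ a b → ⟦ a ⟧ ≡ ⟦ a ∧ b ⟧ + ⟦ a ∧ not b ⟧
⟦⟧-split true  true  = refl
⟦⟧-split true  false = refl
⟦⟧-split false _     = refl

⟦⟧-∨∧ : ∀ a b → ⟦ a ∨ b ⟧ + ⟦ a ∧ b ⟧ ≡ ⟦ a ⟧ + ⟦ b ⟧
⟦⟧-∨∧ true  true  = refl
⟦⟧-∨∧ true  false = refl
⟦⟧-∨∧ false b     = +-identityʳ _

≤ᵇ-sound : ∀ {a b} → (a ≤ᵇ b) ≡ true → a ≤ b
≤ᵇ-sound {a} {b} e = ≤ᵇ⇒≤ a b (Equivalence.from T-≡ e)

≤ᵇ-complete : ∀ {a b} → a ≤ b → (a ≤ᵇ b) ≡ true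
≤ᵇ-complete le = Equivalence.to T-≡ (≤⇒≤ᵇ le)

≤ᵇ-false : ∀ {a b} → (a ≤ᵇ b) ≡ false → b < a
≤ᵇ-false e = ≰⇒> (λ le → false≢true e (≤ᵇ-complete le))

<ᵇ-sound : ∀ {a b} → (a <ᵇ b) ≡ true → a < b
<ᵇ-sound {a} {b} e = <ᵇ⇒< a b (Equivalence.from T-≡ e)

<ᵇ-complete : ∀ {a b} → a < b → (a <ᵇ b) ≡ true
<ᵇ-complete lt = Equivalence.to T-≡ (<⇒<ᵇ lt)

interchange : ∀ a b c d → (a + b) + (c + d) ≡ (a + c) + (b + d)
interchange = solve-∀

sum-cong : ∀ {n} {f g : Fin n → ℕ} → (∀ i → f i ≡ g i) → sumFin f ≡ sumFin g
sum-cong {zero}  e = refl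
sum-cong {suc n} e = cong₂ _+_ (e zero) (sum-cong (λ i → e (suc i)))

sum-mono : ∀ {n} {f g : Fin n → ℕ} → (∀ i → f i ≤ g i) → sumFin f ≤ sumFin g
sum-mono {zero}  e = z≤n
sum-mono {suc n} e = +-mono-≤ (e zero) (sum-mono (λ i → e (suc i)))

sum-+ : ∀ {n} (f g : Fin n → ℕ) → sumFin (λ i → f i + g i) ≡ sumFin f + sumFin g
sum-+ {zero}  f g = refl
sum-+ {suc n} f g = trans (cong (f zero + g zero +_) (sum-+ (λ i → f (suc i)) (λ i → g (suc i))))
                          (interchange (f zero) (g zero) _ _)

sum-*ˡ : ∀ {n} c (f : Fin n → ℕ) → sumFin (λ i → c * f i) ≡ c * sumFin f
sum-*ˡ {zero}  c f = ≡-sym (*-zeroʳ c)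
sum-*ˡ {suc n} c f = trans (cong (c * f zero +_) (sum-*ˡ c (λ i → f (suc i))))
                           (≡-sym (*-distribˡ-+ c (f zero) _))

sum-*ʳ : ∀ {n} c (f : Fin n → ℕ) → sumFin (λ i → f i * c) ≡ sumFin f * c
sum-*ʳ c f = trans (sum-cong (λ i → *-comm (f i) c)) (trans (sum-*ˡ c f) (*-comm c _))

sum-const : ∀ n c → sumFin {n} (λ _ → c) ≡ n * c
sum-const zero    c = refl
sum-const (suc n) c = cong (c +_) (sum-const n c)

sum-zero : ∀ n → sumFin {n} (λ _ → 0) ≡ 0
sum-zero n = trans (sum-const n 0) (*-zeroʳ n)

sum-swap : ∀ {n m} (f : Fin n → Fin m → ℕ) →
           sumFin (λ i → sumFin (f i)) ≡ sumFin (λ j → sumFin (λ i → f i j))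
sum-swap {zero}  {m} f = ≡-sym (sum-zero m)
sum-swap {suc n} {m} f =
  trans (cong (sumFin (f zero) +_) (sum-swap (λ i → f (suc i))))
        (≡-sym (sum-+ (f zero) (λ j → sumFin (λ i → f (suc i) j))))

term≤sum : ∀ {n} (f : Fin n → ℕ) i → f i ≤ sumFin f
term≤sum f zero    = m≤m+n _ _
term≤sum f (suc i) = ≤-trans (term≤sum (λ i → f (suc i)) i) (m≤n+m _ (f zero))

sum-tight : ∀ {n} {f g : Fin n → ℕ} → (∀ i → f i ≤ g i) → sumFin g ≤ sumFin f → ∀ i → f i ≡ g i
sum-tight {suc n} {f} {g} le tot zero =
  ≤-antisym (le zero) (+-cancelʳ-≤ _ _ _ (≤-trans (+-monoʳ-≤ (g zero) (sum-mono (λ i → le (suc i)))) tot))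
sum-tight {suc n} {f} {g} le tot (suc i) =
  sum-tight (λ i → le (suc i)) (+-cancelˡ-≤ _ _ _ (≤-trans (+-monoˡ-≤ _ (le zero)) tot)) i

sum<⇒∃ : ∀ {n} (f g : Fin n → ℕ) → sumFin f < sumFin g → ∃ λ i → f i < g i
sum<⇒∃ {zero}  f g ()
sum<⇒∃ {suc n} f g lt with f zero <? g zero
... | yes p = zero , p
... | no ¬p with sum<⇒∃ (λ i → f (suc i)) (λ i → g (suc i))
                   (+-cancelˡ-< (g zero) _ _ (<-≤-trans (s≤s (+-monoˡ-≤ _ (≮⇒≥ ¬p))) lt))
...   | i , q = suc i , q

count-sum : ∀ {n} (P : Fin n → Bool) → count P ≡ sumFin (λ i → ⟦ P i ⟧)
count-sum {zero}  P = refl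
count-sum {suc n} P = cong (⟦ P zero ⟧ +_) (count-sum (λ i → P (suc i)))

count-cong : ∀ {n} (P Q : Fin n → Bool) → (∀ i → P i ≡ Q i) → count P ≡ count Q
count-cong {zero}  P Q e = refl
count-cong {suc n} P Q e = cong₂ (λ b c → ⟦ b ⟧ + c) (e zero) (count-cong (λ i → P (suc i)) (λ i → Q (suc i)) (λ i → e (suc i)))

count-mono : ∀ {n} (P Q : Fin n → Bool) → (∀ i → P i ≡ true → Q i ≡ true) → count P ≤ count Q
count-mono {zero}  P Q e = z≤n
count-mono {suc n} P Q e = +-mono-≤ (⟦⟧-mono (e zero)) (count-mono (λ i → P (suc i)) (λ i → Q (suc i)) (λ i → e (suc i)))

count-split : ∀ {n} (P Q : Fin n → Bool) → count P ≡ count (λ i → P i ∧ Q i) + count (λ i → P i ∧ not (Q i))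
count-split {zero}  P Q = refl
count-split {suc n} P Q =
  trans (cong₂ _+_ (⟦⟧-split (P zero) (Q zero)) (count-split (λ i → P (suc i)) (λ i → Q (suc i))))
        (interchange ⟦ P zero ∧ Q zero ⟧ _ _ _)

count-∨∧ : ∀ {n} (P Q : Fin n → Bool) → count (λ i → P i ∨ Q i) + count (λ i → P i ∧ Q i) ≡ count P + count Q
count-∨∧ {zero}  P Q = refl
count-∨∧ {suc n} P Q =
  trans (interchange ⟦ P zero ∨ Q zero ⟧ _ ⟦ P zero ∧ Q zero ⟧ _)
  (trans (cong₂ _+_ (⟦⟧-∨∧ (P zero) (Q zero)) (count-∨∧ (λ i → P (suc i)) (λ i → Q (suc i))))
         (interchange ⟦ P zero ⟧ ⟦ Q zero ⟧ _ _))

count-∨ : ∀ {n} (P Q : Fin n → Bool) → count (λ i → P i ∨ Q i) ≤ count P + count Q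
count-∨ P Q = ≤-trans (m≤m+n _ _) (≤-reflexive (count-∨∧ P Q))

count-true : ∀ n → count {n} (λ _ → true) ≡ n
count-true zero    = refl
count-true (suc n) = cong suc (count-true n)

count-false : ∀ n → count {n} (λ _ → false) ≡ 0
count-false zero    = refl
count-false (suc n) = count-false n

count≤n : ∀ {n} (P : Fin n → Bool) → count P ≤ n
count≤n {n} P = ≤-trans (count-mono P (λ _ → true) (λ _ _ → refl)) (≤-reflexive (count-true n))

count-not : ∀ {n} (P : Fin n → Bool) → count P + count (λ i → not (P i)) ≡ n
count-not {n} P = trans (≡-sym (count-split (λ _ → true) P)) (count-true n)

count>0⇒∃ : ∀ {n} (P : Fin n → Bool) → 0 < count P → ∃ λ i → P i ≡ true
count>0⇒∃ {suc n} P lt with P zero in e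
... | true  = zero , e
... | false with count>0⇒∃ (λ i → P (suc i)) lt
...   | i , p = suc i , p

∃⇒count>0 : ∀ {n} (P : Fin n → Bool) {i} → P i ≡ true → 0 < count P
∃⇒count>0 P {zero}  e rewrite e = s≤s z≤n
∃⇒count>0 P {suc i} e = ≤-trans (∃⇒count>0 (λ i → P (suc i)) e) (m≤n+m _ ⟦ P zero ⟧)

find : ∀ {n} (P : Fin n → Bool) → (∃ λ i → P i ≡ true) ⊎ (∀ i → P i ≡ false)
find P with 0 <? count P
... | yes p = inj₁ (count>0⇒∃ P p)
... | no ¬p = inj₂ λ i → ≢true λ e → ¬p (∃⇒count>0 P e)

_==_ : ∀ {n} → Fin n → Fin n → Bool
i == j = ⌊ i ≟ j ⌋

==-sound : ∀ {n} {i j : Fin n} → (i == j) ≡ true → i ≡ j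
==-sound {i = i} {j} e with i ≟ j
... | yes p = p

==-refl : ∀ {n} (i : Fin n) → (i == i) ≡ true
==-refl i with i ≟ i
... | yes _ = refl
... | no ¬p = ⊥-elim (¬p refl)

==-complete : ∀ {n} {i j : Fin n} → i ≡ j → (i == j) ≡ true
==-complete refl = ==-refl _

≢⇒==-false : ∀ {n} {i j : Fin n} → i ≢ j → (i == j) ≡ false
≢⇒==-false {i = i} {j} ne with i ≟ j
... | yes p = ⊥-elim (ne p)
... | no _  = refl

==-false : ∀ {n} {i j : Fin n} → (i == j) ≡ false → i ≢ j
==-false e p = false≢true e (==-complete p)

suc-== : ∀ {n} (i j : Fin n) → (suc i == suc j) ≡ (i == j)
suc-== i j with i ≟ j
... | yes _ = refl
... | no _  = refl

count-== : ∀ {n} (v : Fin n) → count (λ i → i == v) ≡ 1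
count-== {suc n} zero = cong suc (trans (count-cong {n} (λ i → suc i == zero) (λ _ → false) (λ i → refl)) (count-false n))
count-== {suc n} (suc v) = trans (count-cong (λ i → suc i == suc v) (λ i → i == v) (λ i → suc-== i v)) (count-== v)

count-remove : ∀ {n} (P : Fin n → Bool) v → count P ≤ suc (count (λ i → P i ∧ not (i == v)))
count-remove P v = begin
  count P ≡⟨ count-split P (λ i → i == v) ⟩
  count (λ i → P i ∧ (i == v)) + count (λ i → P i ∧ not (i == v))
    ≤⟨ +-monoˡ-≤ _ (≤-trans (count-mono (λ i → P i ∧ (i == v)) (λ i → i == v) (λ i e → proj₂ (∧-elim (P i) e))) (≤-reflexive (count-== v))) ⟩
  suc (count (λ i → P i ∧ not (i == v))) ∎
  where open ≤-Reasoning

-- Greedy choice: each chosen vertex removes at most one element from every later pool, so pools of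
-- size `k` never run dry.
distinct-reps : ∀ {k n} (D : Fin k → Fin n → Bool) → (∀ i → k ≤ count (D i)) →
  Σ (Fin k → Fin n) λ f → (∀ i → D i (f i) ≡ true) × (∀ i j → f i ≡ f j → i ≡ j)
distinct-reps {zero} D big = (λ ()) , (λ ()) , (λ ())
distinct-reps {suc k} {n} D big
  with count>0⇒∃ (D zero) (≤-trans (s≤s z≤n) (big zero))
... | v , Dv
  with distinct-reps (λ i x → D (suc i) x ∧ not (x == v))
         (λ i → s≤s⁻¹ (≤-trans (big (suc i)) (count-remove (D (suc i)) v)))
... | f , Df , inj = F , DF , Finj
  where
  F : Fin (suc k) → Fin n
  F zero    = v
  F (suc i) = f i
  DF : ∀ i → D i (F i) ≡ true
  DF zero    = Dv
  DF (suc i) = proj₁ (∧-elim (D (suc i) (f i)) (Df i))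
  fresh : ∀ i → f i ≢ v
  fresh i = ==-false (not-elim (proj₂ (∧-elim (D (suc i) (f i)) (Df i))))
  Finj : ∀ i j → F i ≡ F j → i ≡ j
  Finj zero    zero    _ = refl
  Finj zero    (suc j) e = ⊥-elim (fresh j (≡-sym e))
  Finj (suc i) zero    e = ⊥-elim (fresh i e)
  Finj (suc i) (suc j) e = cong suc (inj i j e)

enumerate : ∀ {k n} (Q : Fin n → Bool) → k ≤ count Q →
  Σ (Fin k → Fin n) λ f → (∀ i → Q (f i) ≡ true) × (∀ i j → f i ≡ f j → i ≡ j)
enumerate Q le = distinct-reps (λ _ → Q) (λ _ → le)

-- Only the points of `P` have to be placed injectively. The others receive the default `d`, which
-- keeps the map total while sizes are compared on `P` alone.
partial-injection : ∀ {a b} (P : Fin a → Bool) (Q : Fin b → Bool) → Fin b → count P ≤ count Q →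
  Σ (Fin a → Fin b) λ f → (∀ x → P x ≡ true → Q (f x) ≡ true) ×
    (∀ x y → P x ≡ true → P y ≡ true → f x ≡ f y → x ≡ y)
partial-injection {zero} P Q d le = (λ ()) , (λ ()) , (λ ())
partial-injection {suc a} {b} P Q d le with P zero in Pz
... | false with partial-injection (λ i → P (suc i)) Q d le
...   | f , Qf , inj = F , QF , Finj
  where
  F : Fin (suc a) → Fin b
  F zero    = d
  F (suc i) = f i
  QF : ∀ x → P x ≡ true → Q (F x) ≡ true
  QF zero    e = false≢true Pz e
  QF (suc x) e = Qf x e
  Finj : ∀ x y → P x ≡ true → P y ≡ true → F x ≡ F y → x ≡ y
  Finj zero    y       e _ _ = false≢true Pz e
  Finj (suc x) zero    _ e _ = false≢true Pz e
  Finj (suc x) (suc y) e e' q = cong suc (inj x y e e' q)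
partial-injection {suc a} {b} P Q d le | true
  with count>0⇒∃ Q (≤-trans (s≤s z≤n) le)
... | v , Qv
  with partial-injection (λ i → P (suc i)) (λ x → Q x ∧ not (x == v)) d
         (s≤s⁻¹ (≤-trans le (count-remove Q v)))
... | f , Qf , inj = F , QF , Finj
  where
  F : Fin (suc a) → Fin b
  F zero    = v
  F (suc i) = f i
  QF : ∀ x → P x ≡ true → Q (F x) ≡ true
  QF zero    e = Qv
  QF (suc x) e = proj₁ (∧-elim (Q (f x)) (Qf x e))
  fresh : ∀ x → P (suc x) ≡ true → f x ≢ v
  fresh x e = ==-false (not-elim (proj₂ (∧-elim (Q (f x)) (Qf x e))))
  Finj : ∀ x y → P x ≡ true → P y ≡ true → F x ≡ F y → x ≡ y
  Finj zero    zero    _ _ _ = refl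
  Finj zero    (suc y) _ e q = ⊥-elim (fresh y e (≡-sym q))
  Finj (suc x) zero    e _ q = ⊥-elim (fresh x e q)
  Finj (suc x) (suc y) e e' q = cong suc (inj x y e e' q)

count-injection : ∀ {a b} (P : Fin a → Bool) (Q : Fin b → Bool) (f : Fin a → Fin b) →
  (∀ x → P x ≡ true → Q (f x) ≡ true) →
  (∀ x y → P x ≡ true → P y ≡ true → f x ≡ f y → x ≡ y) → count P ≤ count Q
count-injection {zero} P Q f Qf inj = z≤n
count-injection {suc a} P Q f Qf inj with P zero in Pz
... | false = count-injection (λ i → P (suc i)) Q (λ i → f (suc i)) (λ x → Qf (suc x))
                (λ x y p p' e → suc-inj (inj (suc x) (suc y) p p' e))
  where suc-inj : ∀ {n} {x y : Fin n} → Fin.suc x ≡ suc y → x ≡ y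
        suc-inj refl = refl
... | true = ≤-trans (s≤s (count-injection (λ i → P (suc i)) (λ x → Q x ∧ not (x == f zero)) (λ i → f (suc i))
                (λ x p → ∧-intro (Qf (suc x) p) (cong not (≢⇒==-false λ e → z≢s (inj zero (suc x) Pz p (≡-sym e)))))
                (λ x y p p' e → suc-inj (inj (suc x) (suc y) p p' e))))
              sub
  where
  suc-inj : ∀ {n} {x y : Fin n} → Fin.suc x ≡ suc y → x ≡ y
  suc-inj refl = refl
  z≢s : ∀ {n} {x : Fin n} → Fin.zero ≡ suc x → ⊥
  z≢s ()
  sub : suc (count (λ x → Q x ∧ not (x == f zero))) ≤ count Q
  sub = begin
    1 + count (λ x → Q x ∧ not (x == f zero)) ≡⟨ cong (_+ count (λ x → Q x ∧ not (x == f zero))) (≡-sym (count-== (f zero))) ⟩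
    count (λ x → x == f zero) + count (λ x → Q x ∧ not (x == f zero))
      ≤⟨ +-monoˡ-≤ _ (count-mono (λ x → x == f zero) (λ x → Q x ∧ (x == f zero)) (λ x e → ∧-intro (subst (λ z → Q z ≡ true) (≡-sym (==-sound e)) (Qf zero Pz)) e)) ⟩
    count (λ x → Q x ∧ (x == f zero)) + count (λ x → Q x ∧ not (x == f zero)) ≡⟨ ≡-sym (count-split Q (λ x → x == f zero)) ⟩
    count Q ∎
    where open ≤-Reasoning

subset-of-size : ∀ {n} (Q : Fin n → Bool) k → k ≤ count Q →
  Σ (Fin n → Bool) λ R → (∀ i → R i ≡ true → Q i ≡ true) × count R ≡ k
subset-of-size {n} Q zero le = (λ _ → false) , (λ _ ()) , count-false n
subset-of-size {suc n} Q (suc k) le with Q zero in Qz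
... | true with subset-of-size (λ i → Q (suc i)) k (s≤s⁻¹ le)
...   | R , sub , c = (λ { zero → true ; (suc i) → R i }) , (λ { zero _ → Qz ; (suc i) e → sub i e }) , cong suc c
subset-of-size {suc n} Q (suc k) le | false with subset-of-size (λ i → Q (suc i)) (suc k) le
...   | R , sub , c = (λ { zero → false ; (suc i) → R i }) , (λ { zero () ; (suc i) e → sub i e }) , c

all : ∀ {n} → (Fin n → Bool) → Bool
all {zero}  P = true
all {suc n} P = P zero ∧ all (λ i → P (suc i))

all-elim : ∀ {n} (P : Fin n → Bool) → all P ≡ true → ∀ i → P i ≡ true
all-elim P e zero    = proj₁ (∧-elim (P zero) e)
all-elim P e (suc i) = all-elim (λ i → P (suc i)) (proj₂ (∧-elim (P zero) e)) i

all-intro : ∀ {n} (P : Fin n → Bool) → (∀ i → P i ≡ true) → all P ≡ true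
all-intro {zero}  P e = refl
all-intro {suc n} P e = ∧-intro (e zero) (all-intro (λ i → P (suc i)) (λ i → e (suc i)))

_⇒ᵇ_ : Bool → Bool → Bool
a ⇒ᵇ b = not a ∨ b

⇒ᵇ-elim : ∀ {a b} → (a ⇒ᵇ b) ≡ true → a ≡ true → b ≡ true
⇒ᵇ-elim {true} e _ = e

⇒ᵇ-intro : ∀ a {b} → (a ≡ true → b ≡ true) → (a ⇒ᵇ b) ≡ true
⇒ᵇ-intro true  f = f refl
⇒ᵇ-intro false f = refl

-- Union bound: each active requirement removes at most `μ` points of `P`. The flags `J` switch
-- requirements off, so that all vertices of `H` can serve as the index set whatever their roles.
count-all : ∀ {k n} (P : Fin n → Bool) (J : Fin k → Bool) (R : Fin k → Fin n → Bool) μ →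
  (∀ j → J j ≡ true → count (λ z → P z ∧ not (R j z)) ≤ μ) →
  count P ≤ count (λ z → P z ∧ all (λ j → J j ⇒ᵇ R j z)) + k * μ
count-all {zero} P J R μ le = ≤-trans (count-mono P (λ z → P z ∧ true) (λ i e → ∧-intro e refl)) (m≤m+n _ _)
count-all {suc k} {n} P J R μ le = begin
  count P ≤⟨ count-all P (λ j → J (suc j)) (λ j → R (suc j)) μ (λ j → le (suc j)) ⟩
  count P' + k * μ ≡⟨ cong (_+ k * μ) (count-split P' (λ z → J zero ⇒ᵇ R zero z)) ⟩
  count (λ z → P' z ∧ (J zero ⇒ᵇ R zero z)) + count (λ z → P' z ∧ not (J zero ⇒ᵇ R zero z)) + k * μ
    ≤⟨ +-monoˡ-≤ (k * μ) (+-mono-≤ (count-mono (λ z → P' z ∧ (J zero ⇒ᵇ R zero z)) (λ z → P z ∧ all (λ j → J j ⇒ᵇ R j z)) one) two) ⟩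
  count (λ z → P z ∧ all (λ j → J j ⇒ᵇ R j z)) + μ + k * μ ≡⟨ +-assoc (count (λ z → P z ∧ all (λ j → J j ⇒ᵇ R j z))) μ (k * μ) ⟩
  count (λ z → P z ∧ all (λ j → J j ⇒ᵇ R j z)) + (μ + k * μ) ∎
  where
  open ≤-Reasoning
  P' : _ → Bool
  P' z = P z ∧ all (λ j → J (suc j) ⇒ᵇ R (suc j) z)
  one : ∀ z → P' z ∧ (J zero ⇒ᵇ R zero z) ≡ true → P z ∧ all (λ j → J j ⇒ᵇ R j z) ≡ true
  one z e with ∧-elim (P' z) e
  ... | e₁ , e₂ with ∧-elim (P z) e₁
  ...   | e₃ , e₄ = ∧-intro e₃ (∧-intro e₂ e₄)
  two : count (λ z → P' z ∧ not (J zero ⇒ᵇ R zero z)) ≤ μ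
  two with J zero in Jz
  ... | true  = ≤-trans (count-mono (λ z → P' z ∧ not (R zero z)) (λ z → P z ∧ not (R zero z)) (λ z e → ∧-intro (proj₁ (∧-elim (P z) (proj₁ (∧-elim (P' z) e)))) (proj₂ (∧-elim (P' z) e)))) (le zero Jz)
  ... | false = ≤-trans (≤-reflexive (trans (count-cong (λ z → P' z ∧ false) (λ _ → false) (λ z → ∧-zeroʳ (P' z))) (count-false n))) z≤n

-- Averaging arguments and dense common members.

markov : ∀ {n} (P : Fin n → Bool) (f : Fin n → ℕ) c → (∀ i → P i ≡ true → c ≤ f i) → count P * c ≤ sumFin f
markov P f c le = begin
  count P * c ≡⟨ cong (_* c) (count-sum P) ⟩
  sumFin (λ i → ⟦ P i ⟧) * c ≡⟨ ≡-sym (sum-*ʳ c (λ i → ⟦ P i ⟧)) ⟩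
  sumFin (λ i → ⟦ P i ⟧ * c) ≤⟨ sum-mono (λ i → pt (P i) (f i) (le i)) ⟩
  sumFin f ∎
  where
  open ≤-Reasoning
  pt : ∀ b x → (b ≡ true → c ≤ x) → ⟦ b ⟧ * c ≤ x
  pt true  x h = ≤-trans (≤-reflexive (+-identityʳ c)) (h refl)
  pt false x h = z≤n

-- Monotonicity and additivity are all that the averaging uses, so links (sets of pairs) and
-- neighbourhoods (sets of vertices) are handled by one lemma. Zero and natural multiples follow
-- from additivity by cancellation.
record Integral (X : Set) : Set where
  field
    ∫      : (X → ℕ) → ℕ
    ∫-mono : ∀ {f g} → (∀ x → f x ≤ g x) → ∫ f ≤ ∫ g
    ∫-+    : ∀ f g → ∫ (λ x → f x + g x) ≡ ∫ f + ∫ g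

  ∫-cong : ∀ {f g} → (∀ x → f x ≡ g x) → ∫ f ≡ ∫ g
  ∫-cong e = ≤-antisym (∫-mono (λ x → ≤-reflexive (e x))) (∫-mono (λ x → ≤-reflexive (≡-sym (e x))))

  ∫-zero : ∫ (λ _ → 0) ≡ 0
  ∫-zero = +-cancelˡ-≡ (∫ (λ _ → 0)) _ _ (trans (≡-sym (∫-+ (λ _ → 0) (λ _ → 0))) (≡-sym (+-identityʳ _)))

  ∫-* : ∀ c f → ∫ (λ x → c * f x) ≡ c * ∫ f
  ∫-* zero    f = ∫-zero
  ∫-* (suc c) f = trans (∫-+ f (λ x → c * f x)) (cong (∫ f +_) (∫-* c f))

  ∫-sum : ∀ {n} (f : Fin n → X → ℕ) → ∫ (λ x → sumFin (λ i → f i x)) ≡ sumFin (λ i → ∫ (f i))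
  ∫-sum {zero}  f = ∫-zero
  ∫-sum {suc n} f = trans (∫-+ (f zero) (λ x → sumFin (λ i → f (suc i) x))) (cong (∫ (f zero) +_) (∫-sum (λ i → f (suc i))))

  measure : (X → Bool) → ℕ
  measure P = ∫ (λ x → ⟦ P x ⟧)

  total : ℕ
  total = ∫ (λ _ → 1)

  measure-mono : ∀ {P Q : X → Bool} → (∀ x → P x ≡ true → Q x ≡ true) → measure P ≤ measure Q
  measure-mono f = ∫-mono (λ x → ⟦⟧-mono (f x))

vertices : ∀ n → Integral (Fin n)
vertices n = record { ∫ = sumFin ; ∫-mono = sum-mono ; ∫-+ = sum-+ }

pairs : ∀ n → Integral (Fin n × Fin n)
pairs n = record
  { ∫      = λ f → sumFin (λ y → sumFin (λ z → f (y , z)))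
  ; ∫-mono = λ le → sum-mono (λ y → sum-mono (λ z → le (y , z)))
  ; ∫-+    = λ f g → trans (sum-cong (λ y → sum-+ (λ z → f (y , z)) (λ z → g (y , z))))
                           (sum-+ (λ y → sumFin (λ z → f (y , z))) (λ y → sumFin (λ z → g (y , z))))
  }

total-vertices : ∀ n → Integral.total (vertices n) ≡ n
total-vertices n = trans (sum-const n 1) (*-identityʳ n)

total-pairs : ∀ n → Integral.total (pairs n) ≡ n * n
total-pairs n = trans (sum-cong {n} (λ y → trans (sum-const n 1) (*-identityʳ n))) (sum-const n n)

module _ {X : Set} (I : Integral X) where
  open Integral

  common : ∀ {K} → (Fin K → Bool) → (Fin K → X → Bool) → X → Bool
  common σ A y = all (λ i → σ i ⇒ᵇ A i y)

  multiplicity : ∀ {K} → (Fin K → Bool) → (Fin K → X → Bool) → X → ℕ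
  multiplicity W A y = count (λ i → W i ∧ A i y)

  -- Pigeonhole over the `j`-subsets of `W`, one member at a time: a point that sees `j` members
  -- either does so without the first, or sees the first and `j - 1` others. Keeping the heavier
  -- alternative costs a factor two per member of `W`, and `B` absorbs the members already chosen.
  -- Positive measure excludes running out of members.
  common-members : ∀ {K} (W : Fin K → Bool) (A : Fin K → X → Bool) j (B : X → Bool) →
    0 < measure I (λ y → B y ∧ (j ≤ᵇ multiplicity W A y)) →
    Σ (Fin K → Bool) λ σ → (∀ i → σ i ≡ true → W i ≡ true) × count σ ≡ j ×
      measure I (λ y → B y ∧ (j ≤ᵇ multiplicity W A y)) ≤ 2 ^ count W * measure I (λ y → B y ∧ common σ A y)
  common-members {K} W A zero B pos =
    (λ _ → false) , (λ _ ()) , count-false K ,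
    ≤-trans (measure-mono I (λ y e → ∧-intro (proj₁ (∧-elim (B y) e)) (all-intro {K} (λ i → false ⇒ᵇ A i y) (λ _ → refl))))
            (m≤m*n' _ (2 ^ count W) (m^n>0 2 (count W)))
    where
    m≤m*n' : ∀ m n → 0 < n → m ≤ n * m
    m≤m*n' m (suc n) _ = m≤m+n m (n * m)
  common-members {zero} W A (suc j) B pos = ⊥-elim (<-irrefl (≡-sym (trans (∫-cong I (λ y → cong ⟦_⟧ (∧-zeroʳ (B y)))) (∫-zero I))) pos)
  common-members {suc K} W A (suc j) B pos with W zero in W0
  ... | false with common-members (λ i → W (suc i)) (λ i → A (suc i)) (suc j) B pos
  ...   | σ , sub , c , le = (λ { zero → false ; (suc i) → σ i }) , (λ { zero () ; (suc i) e → sub i e }) , c , le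
  common-members {suc K} W A (suc j) B pos | true = goal
    where
    W' : Fin K → Bool
    W' i = W (suc i)
    A' : Fin K → X → Bool
    A' i = A (suc i)
    without with0 whole : ℕ
    without = measure I (λ y → B y ∧ (suc j ≤ᵇ multiplicity W' A' y))
    with0   = measure I (λ y → (B y ∧ A zero y) ∧ (j ≤ᵇ multiplicity W' A' y))
    whole   = measure I (λ y → B y ∧ (suc j ≤ᵇ ⟦ A zero y ⟧ + multiplicity W' A' y))
    pt : ∀ b a d → ⟦ b ∧ (suc j ≤ᵇ ⟦ a ⟧ + d) ⟧ ≤ ⟦ b ∧ (suc j ≤ᵇ d) ⟧ + ⟦ (b ∧ a) ∧ (j ≤ᵇ d) ⟧
    pt false a     d = z≤n
    pt true  false d = m≤m+n _ _
    pt true  true  d = ≤-trans (≤-reflexive (shift j d)) (m≤n+m _ _)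
      where shift : ∀ j d → ⟦ suc j ≤ᵇ suc d ⟧ ≡ ⟦ j ≤ᵇ d ⟧
            shift zero    d = refl
            shift (suc j) d = refl
    split : whole ≤ without + with0
    split = ≤-trans (∫-mono I (λ y → pt (B y) (A zero y) (multiplicity W' A' y))) (≤-reflexive (∫-+ I _ _))
    double : ∀ {a b w} c x → w ≤ a + b → b ≤ a → a ≤ c * x → w ≤ 2 * c * x
    double {a} {b} {w} c x l₁ l₂ l₃ = begin
      w ≤⟨ l₁ ⟩
      a + b ≤⟨ +-monoʳ-≤ a l₂ ⟩
      a + a ≤⟨ +-mono-≤ l₃ l₃ ⟩
      c * x + c * x ≡⟨ ring c x ⟩
      2 * c * x ∎
      where
      open ≤-Reasoning
      ring : ∀ c x → c * x + c * x ≡ 2 * c * x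
      ring = solve-∀
    pos-of : ∀ {a b} → whole ≤ a + b → b ≤ a → 0 < a
    pos-of {zero}  {zero} l _ = ≤-trans pos l
    pos-of {suc a} _ _ = s≤s z≤n
    goal : Σ (Fin (suc K) → Bool) λ σ → (∀ i → σ i ≡ true → W i ≡ true) × count σ ≡ suc j ×
      whole ≤ 2 * 2 ^ count W' * measure I (λ y → B y ∧ common σ A y)
    goal with ≤-total with0 without
    ... | inj₁ le with common-members W' A' (suc j) B (pos-of split le)
    ...   | σ , sub , c , bound =
      (λ { zero → false ; (suc i) → σ i }) , (λ { zero () ; (suc i) e → sub i e }) , c , double (2 ^ count W') (measure I (λ y → B y ∧ common σ A' y)) split le bound
    goal | inj₂ le with common-members W' A' j (λ y → B y ∧ A zero y)
                         (pos-of (≤-trans split (≤-reflexive (+-comm without with0))) le)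
    ...   | σ , sub , c , bound = (λ { zero → true ; (suc i) → σ i }) , (λ { zero _ → W0 ; (suc i) e → sub i e }) , cong suc c ,
      double (2 ^ count W') (measure I (λ y → B y ∧ (A zero y ∧ common σ A' y))) (≤-trans split (≤-reflexive (+-comm without with0))) le
        (≤-trans bound (*-monoʳ-≤ (2 ^ count W') (measure-mono I (λ y e →
          let e₁ , e₂ = ∧-elim (B y ∧ A zero y) e
              e₃ , e₄ = ∧-elim (B y) e₁ in ∧-intro e₃ (∧-intro e₄ e₂)))))

  -- Double counting: `N` sets of density at least `1/m` have average multiplicity at least `N/m`,
  -- hence at least `2h`, so the points of multiplicity at least `h` still have density `1/(2m)`.
  -- Passing to a single `h`-subset seen by many of them costs the factor `2 ^ N`.
  dense-common : ∀ {K} (W : Fin K → Bool) (A : Fin K → X → Bool) m h N →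
    2 * m * h ≤ N → 0 < N → count W ≡ N → 0 < total I →
    (∀ i → W i ≡ true → total I ≤ m * measure I (A i)) →
    Σ (Fin K → Bool) λ σ → (∀ i → σ i ≡ true → W i ≡ true) × count σ ≡ h ×
      total I ≤ 2 * m * 2 ^ N * measure I (common σ A)
  dense-common {K} W A m h N big N>0 cW b>0 dense = finish
    where
    b S Y : ℕ
    b = total I
    S = ∫ I (multiplicity W A)
    Y = measure I (λ y → true ∧ (h ≤ᵇ multiplicity W A y))
    lower : N * b ≤ m * S
    lower = begin
      N * b ≡⟨ cong (_* b) (≡-sym cW) ⟩
      count W * b ≤⟨ markov W (λ i → m * ∫ I (λ y → ⟦ W i ∧ A i y ⟧)) b pt ⟩
      sumFin (λ i → m * ∫ I (λ y → ⟦ W i ∧ A i y ⟧)) ≡⟨ sum-*ˡ m (λ i → ∫ I (λ y → ⟦ W i ∧ A i y ⟧)) ⟩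
      m * sumFin (λ i → ∫ I (λ y → ⟦ W i ∧ A i y ⟧)) ≡⟨ cong (m *_) (≡-sym (∫-sum I (λ i y → ⟦ W i ∧ A i y ⟧))) ⟩
      m * ∫ I (λ y → sumFin (λ i → ⟦ W i ∧ A i y ⟧)) ≡⟨ cong (m *_) (∫-cong I (λ y → ≡-sym (count-sum (λ i → W i ∧ A i y)))) ⟩
      m * S ∎
      where
      open ≤-Reasoning
      pt : ∀ i → W i ≡ true → b ≤ m * ∫ I (λ y → ⟦ W i ∧ A i y ⟧)
      pt i e rewrite e = dense i e
    upper : S ≤ h * b + N * Y
    upper = begin
      S ≤⟨ ∫-mono I (λ y → pt (multiplicity W A y) (≤-trans (count-mono (λ i → W i ∧ A i y) W (λ i e → proj₁ (∧-elim (W i) e))) (≤-reflexive cW))) ⟩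
      ∫ I (λ y → h * 1 + N * ⟦ h ≤ᵇ multiplicity W A y ⟧) ≡⟨ ∫-+ I _ _ ⟩
      ∫ I (λ y → h * 1) + ∫ I (λ y → N * ⟦ h ≤ᵇ multiplicity W A y ⟧) ≡⟨ cong₂ _+_ (∫-* I h _) (∫-* I N _) ⟩
      h * b + N * Y ∎
      where
      open ≤-Reasoning
      pt : ∀ d → d ≤ N → d ≤ h * 1 + N * ⟦ h ≤ᵇ d ⟧
      pt d d≤N with h ≤ᵇ d in e
      ... | true  = ≤-trans d≤N (≤-trans (≤-reflexive (≡-sym (*-identityʳ N))) (m≤n+m _ (h * 1)))
      ... | false = ≤-trans (<⇒≤ (≤ᵇ-false e)) (≤-trans (≤-reflexive (≡-sym (*-identityʳ h))) (m≤m+n _ _))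
    main : b ≤ 2 * m * Y
    main = *-cancelˡ-≤ N ⦃ >-nonZero N>0 ⦄ (+-cancelˡ-≤ (N * b) _ _ (begin
      N * b + N * b ≤⟨ +-mono-≤ lower lower ⟩
      m * S + m * S ≤⟨ +-mono-≤ (*-monoʳ-≤ m upper) (*-monoʳ-≤ m upper) ⟩
      m * (h * b + N * Y) + m * (h * b + N * Y) ≡⟨ ring m h b N Y ⟩
      2 * m * h * b + N * (2 * m * Y) ≤⟨ +-monoˡ-≤ _ (*-monoˡ-≤ b big) ⟩
      N * b + N * (2 * m * Y) ∎))
      where
      open ≤-Reasoning
      ring : ∀ m h b N Y → m * (h * b + N * Y) + m * (h * b + N * Y) ≡ 2 * m * h * b + N * (2 * m * Y)
      ring = solve-∀
    Y>0 : 0 < Y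
    Y>0 with Y | main
    ... | zero  | le = ⊥-elim (<⇒≱ b>0 (≤-trans le (≤-reflexive (*-zeroʳ (2 * m)))))
    ... | suc _ | _  = s≤s z≤n
    finish : Σ (Fin K → Bool) λ σ → (∀ i → σ i ≡ true → W i ≡ true) × count σ ≡ h ×
      b ≤ 2 * m * 2 ^ N * measure I (common σ A)
    finish with common-members W A h (λ _ → true) Y>0
    ... | σ , sub , c , le = σ , sub , c , (begin
      b ≤⟨ main ⟩
      2 * m * Y ≤⟨ *-monoʳ-≤ (2 * m) le ⟩
      2 * m * (2 ^ count W * measure I (common σ A)) ≡⟨ cong (λ t → 2 * m * (2 ^ t * measure I (common σ A))) cW ⟩
      2 * m * (2 ^ N * measure I (common σ A)) ≡⟨ ≡-sym (*-assoc (2 * m) (2 ^ N) _) ⟩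
      2 * m * 2 ^ N * measure I (common σ A) ∎)
      where open ≤-Reasoning

-- Degree sums, greedy embedding and vertex replacement

pairCount : ∀ {n} → (Fin n → Fin n → Bool) → ℕ
pairCount R = sumFin (λ u → count (R u))

pairCount-sum : ∀ {n} (R : Fin n → Fin n → Bool) → pairCount R ≡ sumFin (λ u → sumFin (λ v → ⟦ R u v ⟧))
pairCount-sum R = sum-cong (λ u → count-sum (R u))

pairCount-swap : ∀ {n} (R : Fin n → Fin n → Bool) → pairCount R ≡ pairCount (λ u v → R v u)
pairCount-swap R = trans (pairCount-sum R) (trans (sum-swap (λ u v → ⟦ R u v ⟧)) (≡-sym (pairCount-sum (λ u v → R v u))))

pairCount-+ : ∀ {n} (R S : Fin n → Fin n → Bool) → pairCount R + pairCount S ≡ sumFin (λ u → sumFin (λ v → ⟦ R u v ⟧ + ⟦ S u v ⟧))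
pairCount-+ R S =
  trans (cong₂ _+_ (pairCount-sum R) (pairCount-sum S))
  (trans (≡-sym (sum-+ (λ u → sumFin (λ v → ⟦ R u v ⟧)) (λ u → sumFin (λ v → ⟦ S u v ⟧))))
         (sum-cong (λ u → ≡-sym (sum-+ (λ v → ⟦ R u v ⟧) (λ v → ⟦ S u v ⟧)))))

-- Reduces an identity between numbers of pairs to a check of truth values at a single pair.
pairCount-exchange : ∀ {n} (R S T U : Fin n → Fin n → Bool) →
  (∀ u v → ⟦ R u v ⟧ + ⟦ S u v ⟧ ≡ ⟦ T u v ⟧ + ⟦ U u v ⟧) → pairCount R + pairCount S ≡ pairCount T + pairCount U
pairCount-exchange R S T U e =
  trans (pairCount-+ R S) (trans (sum-cong (λ u → sum-cong (λ v → e u v))) (≡-sym (pairCount-+ T U)))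

pairCount-row : ∀ {n} (v : Fin n) (Q : Fin n → Bool) → pairCount (λ x y → (x == v) ∧ Q y) ≡ count Q
pairCount-row {n} v Q = begin
  sumFin (λ x → count (λ y → (x == v) ∧ Q y)) ≡⟨ sum-cong (λ x → pt (x == v)) ⟩
  sumFin (λ x → ⟦ x == v ⟧ * count Q)         ≡⟨ sum-*ʳ (count Q) (λ x → ⟦ x == v ⟧) ⟩
  sumFin (λ x → ⟦ x == v ⟧) * count Q         ≡⟨ cong (_* count Q) (trans (≡-sym (count-sum (λ x → x == v))) (count-== v)) ⟩
  1 * count Q                                 ≡⟨ *-identityˡ _ ⟩
  count Q ∎
  where
  open Relation.Binary.PropositionalEquality.≡-Reasoning
  pt : ∀ b → count (λ y → b ∧ Q y) ≡ ⟦ b ⟧ * count Q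
  pt true  = ≡-sym (+-identityʳ _)
  pt false = count-false n

pairCount-column : ∀ {n} (v : Fin n) (Q : Fin n → Bool) → pairCount (λ x y → (y == v) ∧ Q x) ≡ count Q
pairCount-column v Q = trans (pairCount-swap (λ x y → (y == v) ∧ Q x)) (pairCount-row v Q)

-- Twice the number of edges. Counting ordered pairs removes the order of the vertices from all
-- later sums.
degreeSum : ∀ {n} → Graph n → ℕ
degreeSum G = pairCount (adj G)

degreeSum-edges : ∀ {n} (G : Graph n) → degreeSum G ≡ edges G + edges G
degreeSum-edges {n} G = begin
  degreeSum G ≡⟨ pairCount-sum (adj G) ⟩
  sumFin (λ u → sumFin (λ v → ⟦ adj G u v ⟧)) ≡⟨ sum-cong (λ u → sum-cong (λ v → pt u v)) ⟩
  sumFin (λ u → sumFin (λ v → ⟦ up u v ⟧ + ⟦ up v u ⟧)) ≡⟨ ≡-sym (pairCount-+ up (λ u v → up v u)) ⟩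
  pairCount up + pairCount (λ u v → up v u) ≡⟨ cong (pairCount up +_) (≡-sym (pairCount-swap up)) ⟩
  edges G + edges G ∎
  where
  open Relation.Binary.PropositionalEquality.≡-Reasoning
  up : Fin n → Fin n → Bool
  up u v = (toℕ u <ᵇ toℕ v) ∧ adj G u v
  tri : ∀ a b → (a ≡ b) ⊎ (⟦ a <ᵇ b ⟧ + ⟦ b <ᵇ a ⟧ ≡ 1)
  tri zero    zero    = inj₁ refl
  tri zero    (suc b) = inj₂ refl
  tri (suc a) zero    = inj₂ refl
  tri (suc a) (suc b) with tri a b
  ... | inj₁ e = inj₁ (cong suc e)
  ... | inj₂ e = inj₂ e
  zeros : ∀ a b → 0 ≡ ⟦ a ∧ false ⟧ + ⟦ b ∧ false ⟧
  zeros true  true  = refl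
  zeros true  false = refl
  zeros false true  = refl
  zeros false false = refl
  pt : ∀ u v → ⟦ adj G u v ⟧ ≡ ⟦ up u v ⟧ + ⟦ up v u ⟧
  pt u v rewrite sym G v u with adj G u v in e
  ... | false = zeros (toℕ u <ᵇ toℕ v) (toℕ v <ᵇ toℕ u)
  ... | true with tri (toℕ u) (toℕ v)
  ...   | inj₁ q = false≢true (trans (cong (adj G u) (≡-sym (toℕ-injective q))) (irr G u)) e
  ...   | inj₂ q = trans (≡-sym q) (cong₂ (λ a b → ⟦ a ⟧ + ⟦ b ⟧) (≡-sym (∧-identityʳ (toℕ u <ᵇ toℕ v))) (≡-sym (∧-identityʳ (toℕ v <ᵇ toℕ u))))

extremal-degreeSum : ∀ {h n} {H : Graph h} {G : Graph n} → IsEx n H G → ∀ G' → Free H G' → degreeSum G' ≤ degreeSum G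
extremal-degreeSum {G = G} (_ , best) G' free = begin
  degreeSum G' ≡⟨ degreeSum-edges G' ⟩
  edges G' + edges G' ≤⟨ +-mono-≤ (best G' free) (best G' free) ⟩
  edges G + edges G ≡⟨ ≡-sym (degreeSum-edges G) ⟩
  degreeSum G ∎
  where open ≤-Reasoning

adj⇒≢ : ∀ {n} (G : Graph n) {x y} → adj G x y ≡ true → x ≢ y
adj⇒≢ G {x} e refl = false≢true (irr G x) e

adj-sym : ∀ {n} (G : Graph n) {x y} → adj G x y ≡ true → adj G y x ≡ true
adj-sym G {x} {y} e = trans (sym G y x) e

data Role : Set where
  fixed middle last : Role

-- The vertices of role `fixed` are placed by σ; those of role `middle` are then
-- chosen greedily from their pools D, and those of role `last` from the part of P
-- that survives the adjacency requirements of the middle vertices.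
embed : ∀ {h n} (H : Graph h) (G : Graph n) (role : Fin h → Role) (σ : Fin h → Fin n)
  (D : Fin h → Fin n → Bool) (P : Fin n → Bool) (μ : ℕ) →
  (∀ x y → adj H x y ≡ true → role x ≡ middle → role y ≢ middle) →
  (∀ x y → adj H x y ≡ true → role x ≡ last → role y ≢ last) →
  (∀ x y → role x ≡ fixed → role y ≡ fixed → σ x ≡ σ y → x ≡ y) →
  (∀ x y → role x ≡ fixed → role y ≡ fixed → adj H x y ≡ true → adj G (σ x) (σ y) ≡ true) →
  (∀ x → role x ≡ middle → h ≤ count (D x)) →
  (∀ x s z → role x ≡ middle → role s ≡ fixed → D x z ≡ true → z ≢ σ s) →
  (∀ x s z → role x ≡ middle → role s ≡ fixed → adj H s x ≡ true → D x z ≡ true → adj G (σ s) z ≡ true) →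
  (∀ x z → role x ≡ middle → D x z ≡ true → count (λ y → P y ∧ not (adj G z y)) ≤ μ) →
  (∀ s z → role s ≡ fixed → P z ≡ true → adj G (σ s) z ≡ true) →
  h + h * μ ≤ count P → H ⊆ G
embed {h} {n} H G role σ D P μ mid-indep last-indep σ-inj σ-edge D-big D-fresh D-edge D-miss P-edge P-big =
  f , f-inj , f-edge
  where
  isMiddle : Role → Bool
  isMiddle middle = true
  isMiddle _      = false
  isMiddle-sound : ∀ r → isMiddle r ≡ true → r ≡ middle
  isMiddle-sound middle _ = refl
  h≤n : h ≤ n
  h≤n = ≤-trans (m≤m+n h (h * μ)) (≤-trans P-big (count≤n P))
  -- Vertices of the other roles get the whole vertex set as pool, so that one system of distinct
  -- representatives indexed by all of `H` suffices.
  D' : Fin h → Fin n → Bool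
  D' x z = isMiddle (role x) ⇒ᵇ D x z
  D'-big : ∀ x → h ≤ count (D' x)
  D'-big x with role x in e
  ... | fixed  = ≤-trans h≤n (≤-reflexive (≡-sym (count-true n)))
  ... | middle = D-big x e
  ... | last   = ≤-trans h≤n (≤-reflexive (≡-sym (count-true n)))
  g-rep : Σ (Fin h → Fin n) λ g → (∀ i → D' i (g i) ≡ true) × (∀ i j → g i ≡ g j → i ≡ j)
  g-rep = distinct-reps D' D'-big
  g : Fin h → Fin n
  g = proj₁ g-rep
  g-inj : ∀ x y → g x ≡ g y → x ≡ y
  g-inj = proj₂ (proj₂ g-rep)
  Dg : ∀ x → role x ≡ middle → D x (g x) ≡ true
  Dg x e = ⇒ᵇ-elim {isMiddle (role x)} (proj₁ (proj₂ g-rep) x) (cong isMiddle e)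
  P' : Fin n → Bool
  P' z = P z ∧ all (λ x → isMiddle (role x) ⇒ᵇ adj G (g x) z)
  P'-big : h ≤ count P'
  P'-big = +-cancelʳ-≤ (h * μ) h (count P') (≤-trans P-big
    (count-all P (λ x → isMiddle (role x)) (λ x z → adj G (g x) z) μ
      (λ x e → D-miss x (g x) (isMiddle-sound _ e) (Dg x (isMiddle-sound _ e)))))
  k-rep : Σ (Fin h → Fin n) λ k → (∀ i → P' (k i) ≡ true) × (∀ i j → k i ≡ k j → i ≡ j)
  k-rep = enumerate P' P'-big
  k : Fin h → Fin n
  k = proj₁ k-rep
  Pk : ∀ x → P (k x) ≡ true
  Pk x = proj₁ (∧-elim (P (k x)) (proj₁ (proj₂ k-rep) x))
  gk-edge : ∀ x y → role x ≡ middle → adj G (g x) (k y) ≡ true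
  gk-edge x y e = ⇒ᵇ-elim {isMiddle (role x)}
    (all-elim _ (proj₂ (∧-elim (P (k y)) (proj₁ (proj₂ k-rep) y))) x) (cong isMiddle e)
  place : Role → Fin h → Fin n
  place fixed  = σ
  place middle = g
  place last   = k
  f : Fin h → Fin n
  f x = place (role x) x
  f-inj : ∀ x y → f x ≡ f y → x ≡ y
  f-inj x y q with role x in ex | role y in ey
  ... | fixed  | fixed  = σ-inj x y ex ey q
  ... | fixed  | middle = ⊥-elim (D-fresh y x (g y) ey ex (Dg y ey) (≡-sym q))
  -- The image of a last vertex is adjacent in `G` to the images of all fixed and middle vertices,
  -- and therefore differs from them.
  ... | fixed  | last   = ⊥-elim (adj⇒≢ G (P-edge x (k y) ex (Pk y)) q)
  ... | middle | fixed  = ⊥-elim (D-fresh x y (g x) ex ey (Dg x ex) q)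
  ... | middle | middle = g-inj x y q
  ... | middle | last   = ⊥-elim (adj⇒≢ G (gk-edge x y ex) q)
  ... | last   | fixed  = ⊥-elim (adj⇒≢ G (P-edge y (k x) ey (Pk x)) (≡-sym q))
  ... | last   | middle = ⊥-elim (adj⇒≢ G (gk-edge y x ey) (≡-sym q))
  ... | last   | last   = proj₂ (proj₂ k-rep) x y q
  f-edge : ∀ x y → adj H x y ≡ true → adj G (f x) (f y) ≡ true
  f-edge x y a with role x in ex | role y in ey
  ... | fixed  | fixed  = σ-edge x y ex ey a
  ... | fixed  | middle = D-edge y x (g y) ey ex a (Dg y ey)
  ... | fixed  | last   = P-edge x (k y) ex (Pk y)
  ... | middle | fixed  = adj-sym G (D-edge x y (g x) ex ey (adj-sym H a) (Dg x ex))
  ... | middle | middle = ⊥-elim (mid-indep x y a ex ey)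
  ... | middle | last   = gk-edge x y ex
  ... | last   | fixed  = adj-sym G (P-edge y (k x) ey (Pk x))
  ... | last   | middle = adj-sym G (gk-edge y x ey)
  ... | last   | last   = ⊥-elim (last-indep x y a ex ey)

-- Replacing v by a new vertex with neighbourhood N keeps G H-free when every h vertices of N
-- have many common neighbours: a copy of H through the new vertex is rerouted through one of them.
neighbourhood≤degree : ∀ {h n} {H : Graph h} {G : Graph n} → IsEx n H G → (v : Fin n) (N P : Fin n → Bool) (μ : ℕ) →
  (∀ u → N u ≡ true → count (λ z → P z ∧ not (adj G u z)) ≤ μ) → 2 + h + h * μ ≤ count P →
  count (λ u → N u ∧ not (u == v)) ≤ deg G v
neighbourhood≤degree {h} {n} {H} {G} ex v N P μ miss big =
  *-cancelˡ-≤ 2 (begin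
    2 * count Nv ≡⟨ twice (count Nv) ⟩
    count Nv + count Nv ≤⟨ +-cancelˡ-≤ (degreeSum G) _ _ (≤-trans (≤-reflexive (≡-sym balance)) (+-monoˡ-≤ (deg G v + deg G v) (extremal-degreeSum {H = H} {G = G} ex G' free))) ⟩
    deg G v + deg G v ≡⟨ ≡-sym (twice (deg G v)) ⟩
    2 * deg G v ∎)
  where
  open ≤-Reasoning
  twice : ∀ x → 2 * x ≡ x + x
  twice = solve-∀
  Nv : Fin n → Bool
  Nv u = N u ∧ not (u == v)
  adj' : Fin n → Fin n → Bool
  adj' x y = if x == v then Nv y else if y == v then Nv x else adj G x y
  sym' : ∀ x y → adj' x y ≡ adj' y x
  sym' x y with x == v in ex | y == v in ey
  ... | true  | true  = trans (∧-zeroʳ (N y)) (≡-sym (∧-zeroʳ (N x)))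
  ... | true  | false = refl
  ... | false | true  = refl
  ... | false | false = sym G x y
  irr' : ∀ x → adj' x x ≡ false
  irr' x with x == v in ex
  ... | true  = ∧-zeroʳ (N x)
  ... | false = irr G x
  G' : Graph n
  G' = record { adj = adj' ; sym = sym' ; irr = irr' }
  pt : ∀ x y → ⟦ adj' x y ⟧ + (⟦ (x == v) ∧ adj G v y ⟧ + ⟦ (y == v) ∧ adj G v x ⟧)
             ≡ ⟦ adj G x y ⟧ + (⟦ (x == v) ∧ Nv y ⟧ + ⟦ (y == v) ∧ Nv x ⟧)
  pt x y with x == v in ex | y == v in ey
  ... | true  | true  rewrite ==-sound {i = x} ex | ==-sound {i = y} ey | irr G v | ∧-zeroʳ (N v) = refl
  ... | true  | false rewrite ==-sound {i = x} ex = ring ⟦ N y ∧ true ⟧ ⟦ adj G v y ⟧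
    where ring : ∀ a b → a + (b + 0) ≡ b + (a + 0)
          ring = solve-∀
  ... | false | true  rewrite ==-sound {i = y} ey | sym G x v = +-comm ⟦ N x ∧ true ⟧ _
  ... | false | false = refl
  spread : ∀ R (Q : Fin n → Bool) → pairCount R + (count Q + count Q) ≡
    sumFin (λ x → sumFin (λ y → ⟦ R x y ⟧ + (⟦ (x == v) ∧ Q y ⟧ + ⟦ (y == v) ∧ Q x ⟧)))
  spread R Q = trans
    (cong₂ _+_ (pairCount-sum R) (trans (cong₂ _+_ (≡-sym (pairCount-row v Q)) (≡-sym (pairCount-column v Q)))
      (pairCount-+ (λ x y → (x == v) ∧ Q y) (λ x y → (y == v) ∧ Q x))))
    (trans (≡-sym (sum-+ (λ x → sumFin (λ y → ⟦ R x y ⟧)) (λ x → sumFin (λ y → ⟦ (x == v) ∧ Q y ⟧ + ⟦ (y == v) ∧ Q x ⟧))))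
      (sum-cong (λ x → ≡-sym (sum-+ (λ y → ⟦ R x y ⟧) (λ y → ⟦ (x == v) ∧ Q y ⟧ + ⟦ (y == v) ∧ Q x ⟧)))))
  balance : degreeSum G' + (deg G v + deg G v) ≡ degreeSum G + (count Nv + count Nv)
  balance = trans (spread adj' (adj G v)) (trans (sum-cong (λ x → sum-cong (λ y → pt x y))) (≡-sym (spread (adj G) Nv)))
  free : Free H G'
  free (f , f-inj , f-edge) = proj₁ ex (f' , f'-inj , f'-edge)
    where
    -- The allowance `2 + h + h * μ` pays `h * μ` for adjacency to the images lying in the new
    -- neighbourhood, `h` for avoiding the copy, one for avoiding `v`, and leaves one vertex.
    P₁ P₂ P₃ : Fin n → Bool
    P₁ z = P z ∧ all (λ x → Nv (f x) ⇒ᵇ adj G (f x) z)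
    P₂ z = P₁ z ∧ all (λ x → true ⇒ᵇ not (z == f x))
    P₃ z = P₂ z ∧ not (z == v)
    ¬¬-single : ∀ (R : Fin n → Bool) w → count (λ z → R z ∧ not (not (z == w))) ≤ 1
    ¬¬-single R w = ≤-trans (count-mono (λ z → R z ∧ not (not (z == w))) (λ z → z == w) (λ z e → notnot _ (proj₂ (∧-elim (R z) e))))
                            (≤-reflexive (count-== w))
      where notnot : ∀ b → not (not b) ≡ true → b ≡ true
            notnot true _ = refl
    P₁-big : 2 + h ≤ count P₁
    P₁-big = +-cancelʳ-≤ (h * μ) (2 + h) _ (≤-trans big (count-all P (λ x → Nv (f x)) (λ x z → adj G (f x) z) μ
      (λ x e → miss (f x) (proj₁ (∧-elim (N (f x)) e)))))
    P₂-big : 2 ≤ count P₂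
    P₂-big = +-cancelʳ-≤ h 2 _ (≤-trans P₁-big (≤-trans (count-all P₁ (λ (x : Fin h) → true) (λ x z → not (z == f x)) 1
      (λ x _ → ¬¬-single P₁ (f x))) (≤-reflexive (cong (count P₂ +_) (*-identityʳ h)))))
    picked : ∃ λ z → P₃ z ≡ true
    picked = count>0⇒∃ P₃ (s≤s⁻¹ (≤-trans P₂-big (count-remove P₂ v)))
    z : Fin n
    z = proj₁ picked
    z₂ : P₂ z ≡ true
    z₂ = proj₁ (∧-elim (P₂ z) (proj₂ picked))
    z₁ : P₁ z ≡ true
    z₁ = proj₁ (∧-elim (P₁ z) z₂)
    z-fresh : ∀ x → f x ≢ z
    z-fresh x e = ==-false (not-elim (all-elim (λ x → true ⇒ᵇ not (z == f x)) (proj₂ (∧-elim (P₁ z) z₂)) x)) (≡-sym e)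
    z-adj : ∀ x → Nv (f x) ≡ true → adj G (f x) z ≡ true
    z-adj x = ⇒ᵇ-elim {Nv (f x)} (all-elim (λ x → Nv (f x) ⇒ᵇ adj G (f x) z) (proj₂ (∧-elim (P z) z₁)) x)
    f' : Fin h → Fin n
    f' x = if f x == v then z else f x
    f'-inj : ∀ x y → f' x ≡ f' y → x ≡ y
    f'-inj x y q with f x == v in ex | f y == v in ey
    ... | true  | true  = f-inj x y (trans (==-sound ex) (≡-sym (==-sound ey)))
    ... | true  | false = ⊥-elim (z-fresh y (≡-sym q))
    ... | false | true  = ⊥-elim (z-fresh x q)
    ... | false | false = f-inj x y q
    f'-edge : ∀ x y → adj H x y ≡ true → adj G (f' x) (f' y) ≡ true
    f'-edge x y a with f-edge x y a
    ... | b with f x == v in ex | f y == v in ey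
    ...   | true  | true  = false≢true (∧-zeroʳ (N (f y))) b
    ...   | true  | false = adj-sym G (z-adj y (∧-intro (proj₁ (∧-elim (N (f y)) b)) (cong not ey)))
    ...   | false | true  = z-adj x (∧-intro (proj₁ (∧-elim (N (f x)) b)) (cong not ex))
    ...   | false | false = b

-- Complete tripartite graphs and their degree sums.

across : ∀ {n} → (Fin n → Fin 3) → Fin n → Fin n → Bool
across cl u v = not (cl u == cl v)

==-sym : ∀ {n} (i j : Fin n) → (i == j) ≡ (j == i)
==-sym i j with i ≟ j
... | yes refl = ≡-sym (==-refl i)
... | no ne    = ≡-sym (≢⇒==-false (λ e → ne (≡-sym e)))

tripartite : ∀ {n} → (Fin n → Fin 3) → Graph n
tripartite cl = record
  { adj = across cl
  ; sym = λ x y → cong not (==-sym (cl x) (cl y))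
  ; irr = λ x → cong not (==-refl (cl x))
  }

size : ∀ {n} → (Fin n → Fin 3) → Fin 3 → ℕ
size cl i = count (λ v → cl v == i)

sum-by-class : ∀ {n} (cl : Fin n → Fin 3) (g : Fin 3 → ℕ) → sumFin (λ u → g (cl u)) ≡ sumFin (λ i → size cl i * g i)
sum-by-class cl g = begin
  sumFin (λ u → g (cl u)) ≡⟨ sum-cong (λ u → ≡-sym (pick (cl u))) ⟩
  sumFin (λ u → sumFin (λ i → ⟦ cl u == i ⟧ * g i)) ≡⟨ sum-swap (λ u i → ⟦ cl u == i ⟧ * g i) ⟩
  sumFin (λ i → sumFin (λ u → ⟦ cl u == i ⟧ * g i)) ≡⟨ sum-cong (λ i → trans (sum-*ʳ (g i) (λ u → ⟦ cl u == i ⟧)) (cong (_* g i) (≡-sym (count-sum (λ u → cl u == i))))) ⟩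
  sumFin (λ i → size cl i * g i) ∎
  where
  open Relation.Binary.PropositionalEquality.≡-Reasoning
  pick : ∀ j → sumFin (λ i → ⟦ j == i ⟧ * g i) ≡ g j
  pick zero             = trans (+-identityʳ _) (+-identityʳ _)
  pick (suc zero)       = trans (+-identityʳ _) (+-identityʳ _)
  pick (suc (suc zero)) = trans (+-identityʳ _) (+-identityʳ _)

size-total : ∀ {n} (cl : Fin n → Fin 3) → size cl zero + (size cl (suc zero) + size cl (suc (suc zero))) ≡ n
size-total {n} cl = trans (ring (size cl zero) (size cl (suc zero)) (size cl (suc (suc zero)))) (trans (≡-sym (sum-by-class cl (λ _ → 1))) (trans (sum-const n 1) (*-identityʳ n)))
  where ring : ∀ a b c → a + (b + c) ≡ a * 1 + (b * 1 + (c * 1 + 0))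
        ring = solve-∀

-- Pairs within the classes contribute the squares of the class sizes, the diagonal included. In
-- this additive form two tripartite graphs are compared through their squares alone.
across-count : ∀ {n} (cl : Fin n → Fin 3) → pairCount (across cl) +
  (size cl zero * size cl zero + size cl (suc zero) * size cl (suc zero) + size cl (suc (suc zero)) * size cl (suc (suc zero))) ≡ n * n
across-count {n} cl = begin
  pairCount (across cl) + _ ≡⟨ cong (pairCount (across cl) +_) (trans (ring (size cl zero) (size cl (suc zero)) (size cl (suc (suc zero)))) (≡-sym (sum-by-class cl (size cl)))) ⟩
  pairCount (across cl) + sumFin (λ u → size cl (cl u)) ≡⟨ ≡-sym (sum-+ (λ u → count (across cl u)) (λ u → size cl (cl u))) ⟩
  sumFin (λ u → count (across cl u) + size cl (cl u)) ≡⟨ sum-cong row ⟩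
  sumFin {n} (λ u → n) ≡⟨ sum-const n n ⟩
  n * n ∎
  where
  open Relation.Binary.PropositionalEquality.≡-Reasoning
  ring : ∀ a b c → a * a + b * b + c * c ≡ a * a + (b * b + (c * c + 0))
  ring = solve-∀
  row : ∀ u → count (across cl u) + size cl (cl u) ≡ n
  row u = trans (+-comm (count (across cl u)) _)
    (trans (cong (_+ count (across cl u)) (count-cong (λ v → cl v == cl u) (λ v → cl u == cl v) (λ v → ==-sym (cl v) (cl u))))
           (count-not (λ v → cl u == cl v)))

classes : ∀ n a b c → a + b + c ≡ n →
  Σ (Fin n → Fin 3) λ cl → size cl zero ≡ a × size cl (suc zero) ≡ b × size cl (suc (suc zero)) ≡ c
classes zero zero zero zero e = (λ ()) , refl , refl , refl
classes (suc n) (suc a) b c e with classes n a b c (suc-injective e)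
... | cl , p , q , r = (λ { zero → zero ; (suc i) → cl i }) , cong suc p , q , r
classes (suc n) zero (suc b) c e with classes n zero b c (suc-injective e)
... | cl , p , q , r = (λ { zero → suc zero ; (suc i) → cl i }) , p , cong suc q , r
classes (suc n) zero zero (suc c) e with classes n zero zero c (suc-injective e)
... | cl , p , q , r = (λ { zero → suc (suc zero) ; (suc i) → cl i }) , p , q , cong suc r

-- Stability

Proper : ∀ {h} → Graph h → (Fin h → Fin 3) → Set
Proper H col = ∀ x y → adj H x y ≡ true → col x ≢ col y

triangle : ∀ {n} → Graph n → Fin n → Fin n × Fin n → Bool
triangle G x (y , z) = adj G x y ∧ (adj G x z ∧ adj G y z)

-- Twice the number of edges inside the neighbourhood of `x`, since both orders of an edge are
-- counted.
linkSize : ∀ {n} → Graph n → Fin n → ℕ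
linkSize G x = Integral.measure (pairs _) (triangle G x)

-- Rows below `n / (2C)` contribute at most half of the required total `n * n / C`, and a rich row
-- contributes at most `n`, so the other half needs at least `n / (2C)` rich rows.
many-rich : ∀ {n} (r : Fin n → ℕ) C → 0 < n → (∀ y → r y ≤ n) → n * n ≤ C * sumFin r →
  n ≤ 2 * C * count (λ y → n ≤ᵇ 2 * C * r y)
many-rich {n} r C n>0 r≤n big = *-cancelˡ-≤ n ⦃ >-nonZero n>0 ⦄ (+-cancelʳ-≤ (n * n) (n * n) (n * (2 * C * R)) (begin
  n * n + n * n ≤⟨ +-mono-≤ big big ⟩
  C * sumFin r + C * sumFin r ≡⟨ e₁ C (sumFin r) ⟩
  2 * C * sumFin r ≡⟨ ≡-sym (sum-*ˡ (2 * C) r) ⟩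
  sumFin (λ y → 2 * C * r y) ≤⟨ sum-mono pt ⟩
  sumFin (λ y → ⟦ n ≤ᵇ 2 * C * r y ⟧ * (2 * C * n) + n) ≡⟨ sum-+ (λ y → ⟦ n ≤ᵇ 2 * C * r y ⟧ * (2 * C * n)) (λ _ → n) ⟩
  sumFin (λ y → ⟦ n ≤ᵇ 2 * C * r y ⟧ * (2 * C * n)) + sumFin {n} (λ _ → n) ≡⟨ cong₂ _+_ (trans (sum-*ʳ (2 * C * n) (λ y → ⟦ n ≤ᵇ 2 * C * r y ⟧)) (cong (_* (2 * C * n)) (≡-sym (count-sum (λ y → n ≤ᵇ 2 * C * r y))))) (sum-const n n) ⟩
  R * (2 * C * n) + n * n ≡⟨ cong (_+ n * n) (e₂ R C n) ⟩
  n * (2 * C * R) + n * n ∎))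
  where
  open ≤-Reasoning
  R : ℕ
  R = count (λ y → n ≤ᵇ 2 * C * r y)
  e₁ : ∀ C s → C * s + C * s ≡ 2 * C * s
  e₁ = solve-∀
  e₂ : ∀ R C n → R * (2 * C * n) ≡ n * (2 * C * R)
  e₂ = solve-∀
  pt : ∀ y → 2 * C * r y ≤ ⟦ n ≤ᵇ 2 * C * r y ⟧ * (2 * C * n) + n
  pt y with n ≤ᵇ 2 * C * r y in e
  ... | true  = ≤-trans (*-monoʳ-≤ (2 * C) (r≤n y)) (≤-trans (≤-reflexive (≡-sym (+-identityʳ _))) (m≤m+n _ n))
  ... | false = <⇒≤ (≤ᵇ-false e)

-- The first two colour classes are fixed on `A` and `B`, the third is placed last in `P`. No vertex
-- has role `middle`, so nothing of `P` is lost and `μ` is zero.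
tripartite-embed : ∀ {h n} (H : Graph h) (col : Fin h → Fin 3) → Proper H col → (G : Graph n) (A B P : Fin n → Bool) →
  0 < n → h ≤ count A → h ≤ count B → h ≤ count P →
  (∀ x y → A x ≡ true → B y ≡ true → adj G x y ≡ true) →
  (∀ x z → A x ≡ true → P z ≡ true → adj G x z ≡ true) →
  (∀ y z → B y ≡ true → P z ≡ true → adj G y z ≡ true) → H ⊆ G
tripartite-embed {h} {n} H col proper G A B P n>0 bigA bigB bigP AB AP BP =
  embed H G (λ x → roleBy (col x)) (λ x → placeBy (col x) x) (λ _ _ → true) P 0
    (λ x y a e _ → no-middle (col x) e) last-indep (λ x y → inj x y _ _ refl refl) (λ x y → edge x y _ _ refl refl)
    (λ x e → ⊥-elim (no-middle (col x) e)) (λ x _ _ e → ⊥-elim (no-middle (col x) e)) (λ x _ _ e → ⊥-elim (no-middle (col x) e))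
    (λ x _ e → ⊥-elim (no-middle (col x) e)) (λ s z → P-edge s z _ refl)
    (≤-trans (≤-reflexive (trans (cong (h +_) (*-zeroʳ h)) (+-identityʳ h))) bigP)
  where
  d : Fin n
  d = proj₁ (count>0⇒∃ {n} (λ _ → true) (≤-trans n>0 (≤-reflexive (≡-sym (count-true n)))))
  A-rep : Σ (Fin h → Fin n) λ f → (∀ i → A (f i) ≡ true) × (∀ i j → f i ≡ f j → i ≡ j)
  A-rep = enumerate A bigA
  B-rep : Σ (Fin h → Fin n) λ f → (∀ i → B (f i) ≡ true) × (∀ i j → f i ≡ f j → i ≡ j)
  B-rep = enumerate B bigB
  placeBy : Fin 3 → Fin h → Fin n
  placeBy zero       x = proj₁ A-rep x
  placeBy (suc zero) x = proj₁ B-rep x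
  placeBy _          x = d
  roleBy : Fin 3 → Role
  roleBy zero       = fixed
  roleBy (suc zero) = fixed
  roleBy _          = last
  no-middle : ∀ c → roleBy c ≢ middle
  no-middle zero ()
  no-middle (suc zero) ()
  no-middle (suc (suc zero)) ()
  is-last : ∀ c → roleBy c ≡ last → c ≡ suc (suc zero)
  is-last (suc (suc zero)) _ = refl
  last-indep : ∀ x y → adj H x y ≡ true → roleBy (col x) ≡ last → roleBy (col y) ≢ last
  last-indep x y a ex ey = proper x y a (trans (is-last _ ex) (≡-sym (is-last _ ey)))
  A-in : ∀ x → A (proj₁ A-rep x) ≡ true
  A-in = proj₁ (proj₂ A-rep)
  B-in : ∀ x → B (proj₁ B-rep x) ≡ true
  B-in = proj₁ (proj₂ B-rep)
  inj : ∀ x y c c' → col x ≡ c → col y ≡ c' → roleBy c ≡ fixed → roleBy c' ≡ fixed → placeBy c x ≡ placeBy c' y → x ≡ y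
  inj x y zero       zero       ex ey _ _ q = proj₂ (proj₂ A-rep) x y q
  inj x y zero       (suc zero) ex ey _ _ q = ⊥-elim (adj⇒≢ G (AB _ _ (A-in x) (B-in y)) q)
  inj x y (suc zero) zero       ex ey _ _ q = ⊥-elim (adj⇒≢ G (AB _ _ (A-in y) (B-in x)) (≡-sym q))
  inj x y (suc zero) (suc zero) ex ey _ _ q = proj₂ (proj₂ B-rep) x y q
  inj x y (suc (suc zero)) _ ex ey () _ q
  inj x y zero (suc (suc zero)) ex ey _ () q
  inj x y (suc zero) (suc (suc zero)) ex ey _ () q
  edge : ∀ x y c c' → col x ≡ c → col y ≡ c' → roleBy c ≡ fixed → roleBy c' ≡ fixed → adj H x y ≡ true →
    adj G (placeBy c x) (placeBy c' y) ≡ true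
  edge x y zero       zero       ex ey _ _ a = ⊥-elim (proper x y a (trans ex (≡-sym ey)))
  edge x y zero       (suc zero) ex ey _ _ a = AB _ _ (A-in x) (B-in y)
  edge x y (suc zero) zero       ex ey _ _ a = adj-sym G (AB _ _ (A-in y) (B-in x))
  edge x y (suc zero) (suc zero) ex ey _ _ a = ⊥-elim (proper x y a (trans ex (≡-sym ey)))
  edge x y (suc (suc zero)) _ ex ey () _ a
  edge x y zero (suc (suc zero)) ex ey _ () a
  edge x y (suc zero) (suc (suc zero)) ex ey _ () a
  P-edge : ∀ s z c → col s ≡ c → roleBy c ≡ fixed → P z ≡ true → adj G (placeBy c s) z ≡ true
  P-edge s z zero       _ _ Pz = AP _ z (A-in s) Pz
  P-edge s z (suc zero) _ _ Pz = BP _ z (B-in s) Pz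
  P-edge s z (suc (suc zero)) _ () Pz

c*k≤c*x⇒k≤x : ∀ {c k x n} → 0 < n → c * k ≤ n → n ≤ c * x → k ≤ x
c*k≤c*x⇒k≤x {zero}  n>0 _ le = ⊥-elim (<⇒≱ n>0 le)
c*k≤c*x⇒k≤x {suc c} n>0 l₁ l₂ = *-cancelˡ-≤ (suc c) (≤-trans l₁ l₂)

-- Two rounds of `dense-common` build a complete tripartite graph. Of `K` large links, `h` share a
-- positive fraction of all pairs; many rows of this common link are rich, and `h` rich rows share
-- linearly many vertices. Any choice from the members `σ`, the rows `τ` and these vertices `P` is a
-- triangle, which gives all edges between the three sets.
link-system⇒embed : ∀ {h n} M K C₁ K₂ C₂ → K ≡ suc (2 * M * h) → C₁ ≡ 2 * M * 2 ^ K →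
  K₂ ≡ suc (2 * (2 * C₁) * h) → C₂ ≡ 2 * (2 * C₁) * 2 ^ K₂ → suc (2 * C₁ * K₂ + C₂ * suc h) ≤ n →
  (H : Graph h) (col : Fin h → Fin 3) → Proper H col → (G : Graph n) →
  K ≤ count (λ x → n * n ≤ᵇ M * linkSize G x) → 0 < h → H ⊆ G
link-system⇒embed {h} {n} M K C₁ K₂ C₂ eK eC₁ eK₂ eC₂ n≥ H col proper G many h>0 =
  tripartite-embed H col proper G σ τ P n>0 (≤-reflexive (≡-sym σ-count)) (≤-reflexive (≡-sym τ-count)) (<⇒≤ P-big)
    (λ x y s t → proj₁ (∧-elim (adj G x y) (tri s t p-in)))
    (λ x z s Pz → proj₁ (∧-elim (adj G x z) (proj₂ (∧-elim (adj G x y₀) (tri s y₀-in Pz)))))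
    (λ y z t Pz → proj₂ (∧-elim (adj G x₀ z) (proj₂ (∧-elim (adj G x₀ y) (tri x₀-in t Pz)))))
  where
  n>0 : 0 < n
  n>0 = ≤-trans (s≤s z≤n) n≥
  chosen : Σ (Fin n → Bool) λ W → (∀ i → W i ≡ true → (n * n ≤ᵇ M * linkSize G i) ≡ true) × count W ≡ K
  chosen = subset-of-size _ K many
  first : Σ (Fin n → Bool) λ σ → (∀ i → σ i ≡ true → proj₁ chosen i ≡ true) × count σ ≡ h ×
    Integral.total (pairs n) ≤ 2 * M * 2 ^ K * Integral.measure (pairs n) (common (pairs n) σ (triangle G))
  first = dense-common (pairs n) (proj₁ chosen) (triangle G) M h K (≤-trans (n≤1+n _) (≤-reflexive (≡-sym eK)))
    (≤-trans (s≤s z≤n) (≤-reflexive (≡-sym eK))) (proj₂ (proj₂ chosen))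
    (≤-trans (*-mono-≤ n>0 n>0) (≤-reflexive (≡-sym (total-pairs n))))
    (λ i e → ≤-trans (≤-reflexive (total-pairs n)) (≤ᵇ-sound (proj₁ (proj₂ chosen) i e)))
  σ : Fin n → Bool
  σ = proj₁ first
  σ-count : count σ ≡ h
  σ-count = proj₁ (proj₂ (proj₂ first))
  link : Fin n → Fin n → Bool
  link y z = common (pairs n) σ (triangle G) (y , z)
  rich : Fin n → Bool
  rich y = n ≤ᵇ 2 * C₁ * count (link y)
  links-dense : n * n ≤ C₁ * sumFin (λ y → count (link y))
  links-dense = ≤-trans (≤-reflexive (≡-sym (total-pairs n))) (≤-trans (proj₂ (proj₂ (proj₂ first)))
    (≤-reflexive (cong₂ _*_ (≡-sym eC₁) (sum-cong (λ y → ≡-sym (count-sum (link y)))))))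
  rich-many : K₂ ≤ count rich
  rich-many = c*k≤c*x⇒k≤x {2 * C₁} n>0 (≤-trans (≤-trans (m≤m+n _ (C₂ * suc h)) (n≤1+n _)) n≥)
    (many-rich (λ y → count (link y)) C₁ n>0 (λ y → count≤n (link y)) links-dense)
  chosen₂ : Σ (Fin n → Bool) λ W₂ → (∀ i → W₂ i ≡ true → rich i ≡ true) × count W₂ ≡ K₂
  chosen₂ = subset-of-size rich K₂ rich-many
  second : Σ (Fin n → Bool) λ τ → (∀ i → τ i ≡ true → proj₁ chosen₂ i ≡ true) × count τ ≡ h ×
    Integral.total (vertices n) ≤ 2 * (2 * C₁) * 2 ^ K₂ * Integral.measure (vertices n) (common (vertices n) τ link)
  second = dense-common (vertices n) (proj₁ chosen₂) link (2 * C₁) h K₂ (≤-trans (n≤1+n _) (≤-reflexive (≡-sym eK₂)))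
    (≤-trans (s≤s z≤n) (≤-reflexive (≡-sym eK₂))) (proj₂ (proj₂ chosen₂))
    (≤-trans n>0 (≤-reflexive (≡-sym (total-vertices n))))
    (λ i e → ≤-trans (≤-reflexive (total-vertices n)) (≤-trans (≤ᵇ-sound (proj₁ (proj₂ chosen₂) i e))
      (≤-reflexive (cong (2 * C₁ *_) (count-sum (link i))))))
  τ : Fin n → Bool
  τ = proj₁ second
  τ-count : count τ ≡ h
  τ-count = proj₁ (proj₂ (proj₂ second))
  P : Fin n → Bool
  P = common (vertices n) τ link
  P-big : suc h ≤ count P
  P-big = c*k≤c*x⇒k≤x {C₂} n>0 (≤-trans (≤-trans (m≤n+m _ (2 * C₁ * K₂)) (n≤1+n _)) n≥)
    (≤-trans (≤-reflexive (≡-sym (total-vertices n))) (≤-trans (proj₂ (proj₂ (proj₂ second)))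
      (≤-reflexive (cong₂ _*_ (≡-sym eC₂) (≡-sym (count-sum P))))))
  tri : ∀ {x y z} → σ x ≡ true → τ y ≡ true → P z ≡ true → triangle G x (y , z) ≡ true
  tri {x} {y} {z} s t e = ⇒ᵇ-elim {σ x} (all-elim (λ i → σ i ⇒ᵇ triangle G i (y , z))
    (⇒ᵇ-elim {τ y} (all-elim (λ i → τ i ⇒ᵇ link i z) e y) t) x) s
  some : (ρ : Fin n → Bool) → count ρ ≡ h → ∃ λ i → ρ i ≡ true
  some ρ c = count>0⇒∃ ρ (≤-trans h>0 (≤-reflexive (≡-sym c)))
  -- Adjacency between two of the sets is read off a triangle with a vertex of the third, so a
  -- member of each is fixed.
  x₀ y₀ p : Fin n
  x₀ = proj₁ (some σ σ-count)
  y₀ = proj₁ (some τ τ-count)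
  p  = proj₁ (count>0⇒∃ P (≤-trans (s≤s z≤n) P-big))
  x₀-in : σ x₀ ≡ true
  x₀-in = proj₂ (some σ σ-count)
  y₀-in : τ y₀ ≡ true
  y₀-in = proj₂ (some τ τ-count)
  p-in : P p ≡ true
  p-in = proj₂ (count>0⇒∃ P (≤-trans (s≤s z≤n) P-big))

few-large-links : ∀ h M → 0 < h → Σ ℕ λ K → Σ ℕ λ n₀ → ∀ n → n₀ ≤ n → (H : Graph h) (col : Fin h → Fin 3) → Proper H col →
  (G : Graph n) → Free H G → count (λ x → n * n ≤ᵇ M * linkSize G x) ≤ K
few-large-links h M h>0 = from _ _ _ _ refl refl refl refl
  where
  from : ∀ K C₁ K₂ C₂ → K ≡ suc (2 * M * h) → C₁ ≡ 2 * M * 2 ^ K → K₂ ≡ suc (2 * (2 * C₁) * h) → C₂ ≡ 2 * (2 * C₁) * 2 ^ K₂ →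
    Σ ℕ λ K → Σ ℕ λ n₀ → ∀ n → n₀ ≤ n → (H : Graph h) (col : Fin h → Fin 3) → Proper H col →
      (G : Graph n) → Free H G → count (λ x → n * n ≤ᵇ M * linkSize G x) ≤ K
  from K C₁ K₂ C₂ eK eC₁ eK₂ eC₂ = K , suc (2 * C₁ * K₂ + C₂ * suc h) , λ n n≥ H col proper G free →
    ≮⇒≥ λ many → free (link-system⇒embed M K C₁ K₂ C₂ eK eC₁ eK₂ eC₂ n≥ H col proper G (<⇒≤ many) h>0)

-- Cuts given by neighbourhoods.

cauchy : ∀ {n} (f : Fin n → ℕ) → sumFin f * sumFin f ≤ n * sumFin (λ u → f u * f u)
cauchy {n} f = *-cancelˡ-≤ 2 (begin
  2 * (S * S) ≡⟨ cong (2 *_) (≡-sym (trans (sum-cong (λ u → sum-*ˡ (f u) f)) (sum-*ʳ S f))) ⟩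
  2 * sumFin (λ u → sumFin (λ v → f u * f v)) ≡⟨ ≡-sym (trans (sum-cong (λ u → sum-*ˡ 2 (λ v → f u * f v))) (sum-*ˡ 2 (λ u → sumFin (λ v → f u * f v)))) ⟩
  sumFin (λ u → sumFin (λ v → 2 * (f u * f v))) ≤⟨ sum-mono (λ u → sum-mono (λ v → amgm (f u) (f v))) ⟩
  sumFin (λ u → sumFin (λ v → f u * f u + f v * f v)) ≡⟨ sum-cong (λ u → trans (sum-+ (λ v → f u * f u) (λ v → f v * f v)) (cong (_+ Q) (sum-const n (f u * f u)))) ⟩
  sumFin (λ u → n * (f u * f u) + Q) ≡⟨ trans (sum-+ (λ u → n * (f u * f u)) (λ _ → Q)) (cong₂ _+_ (sum-*ˡ n (λ u → f u * f u)) (sum-const n Q)) ⟩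
  n * Q + n * Q ≡⟨ ring n Q ⟩
  2 * (n * Q) ∎)
  where
  open ≤-Reasoning
  S Q : ℕ
  S = sumFin f
  Q = sumFin (λ u → f u * f u)
  ring : ∀ n Q → n * Q + n * Q ≡ 2 * (n * Q)
  ring = solve-∀
  square : ∀ a d → 2 * (a * (a + d)) + d * d ≡ a * a + (a + d) * (a + d)
  square = solve-∀
  amgm : ∀ a b → 2 * (a * b) ≤ a * a + b * b
  amgm a b with ≤-total a b
  ... | inj₁ le with m≤n⇒∃[o]m+o≡n le
  ...   | d , refl = ≤-trans (m≤m+n _ (d * d)) (≤-reflexive (square a d))
  amgm a b | inj₂ le with m≤n⇒∃[o]m+o≡n le
  ...   | d , refl = ≤-trans (m≤m+n _ (d * d)) (≤-reflexive (trans (trans (cong (λ t → 2 * t + d * d) (*-comm (b + d) b)) (square b d)) (+-comm (b * b) _)))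

below-average : ∀ {n} (f : Fin n → ℕ) → 0 < n → ∃ λ i → n * f i ≤ sumFin f
below-average {n} f n>0 with sum<⇒∃ (λ i → n * f i) (λ _ → suc (sumFin f))
  (≤-trans (≤-reflexive (cong suc (sum-*ˡ n f))) (≤-trans (≤-trans (+-monoˡ-≤ _ n>0) (≤-reflexive (≡-sym (*-suc n _)))) (≤-reflexive (≡-sym (sum-const n (suc (sumFin f)))))))
... | i , lt = i , s≤s⁻¹ lt

cross : ∀ {n} → (Fin n → Bool) → Fin n → Fin n → Bool
cross c u v = c u xor c v

inside : ∀ {n} → Graph n → (Fin n → Bool) → Fin n → Fin n → Bool
inside G c u v = adj G u v ∧ not (cross c u v)

mismatch : ∀ {n} → Graph n → (Fin n → Bool) → Fin n → Fin n → Bool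
mismatch G c u v = adj G u v xor cross c u v

module _ {n} (G : Graph n) where

  -- An edge lies inside the cut given by `N(x)` when none or both of its ends are in `N(x)`. For
  -- each edge, this indicator plus the number of ends in `N(x)` equals one plus twice the indicator
  -- that both ends are there, and the latter sums to `linkSize`.
  neighbourhood-cut : ∀ x → pairCount (inside G (adj G x)) + 2 * sumFin (λ u → ⟦ adj G x u ⟧ * deg G u)
                          ≡ degreeSum G + 2 * linkSize G x
  neighbourhood-cut x = begin
    pairCount (inside G c) + 2 * sumFin (λ u → ⟦ c u ⟧ * deg G u) ≡⟨ cong (pairCount (inside G c) +_) (trans (double (sumFin (λ u → ⟦ c u ⟧ * deg G u))) (cong₂ _+_ rows cols)) ⟩
    pairCount (inside G c) + (pairCount (λ u v → c u ∧ adj G u v) + pairCount (λ u v → c v ∧ adj G u v))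
      ≡⟨ cong₂ _+_ (pairCount-sum (inside G c)) (pairCount-+ (λ u v → c u ∧ adj G u v) (λ u v → c v ∧ adj G u v)) ⟩
    sumFin (λ u → sumFin (λ v → ⟦ inside G c u v ⟧)) + sumFin (λ u → sumFin (λ v → ⟦ c u ∧ adj G u v ⟧ + ⟦ c v ∧ adj G u v ⟧))
      ≡⟨ join (λ u v → ⟦ inside G c u v ⟧) (λ u v → ⟦ c u ∧ adj G u v ⟧ + ⟦ c v ∧ adj G u v ⟧) ⟩
    sumFin (λ u → sumFin (λ v → ⟦ inside G c u v ⟧ + (⟦ c u ∧ adj G u v ⟧ + ⟦ c v ∧ adj G u v ⟧)))
      ≡⟨ sum-cong (λ u → sum-cong (λ v → pt (adj G u v) (c u) (c v))) ⟩
    sumFin (λ u → sumFin (λ v → ⟦ adj G u v ⟧ + 2 * ⟦ c u ∧ (c v ∧ adj G u v) ⟧))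
      ≡⟨ ≡-sym (join (λ u v → ⟦ adj G u v ⟧) (λ u v → 2 * ⟦ c u ∧ (c v ∧ adj G u v) ⟧)) ⟩
    sumFin (λ u → sumFin (λ v → ⟦ adj G u v ⟧)) + sumFin (λ u → sumFin (λ v → 2 * ⟦ c u ∧ (c v ∧ adj G u v) ⟧))
      ≡⟨ cong₂ _+_ (≡-sym (pairCount-sum (adj G)))
           (trans (sum-cong (λ u → sum-*ˡ 2 (λ v → ⟦ c u ∧ (c v ∧ adj G u v) ⟧))) (sum-*ˡ 2 (λ u → sumFin (λ v → ⟦ c u ∧ (c v ∧ adj G u v) ⟧)))) ⟩
    degreeSum G + 2 * linkSize G x ∎
    where
    open Relation.Binary.PropositionalEquality.≡-Reasoning
    c : Fin n → Bool
    c = adj G x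
    double : ∀ a → 2 * a ≡ a + a
    double = solve-∀
    join : ∀ (f g : Fin n → Fin n → ℕ) → sumFin (λ u → sumFin (f u)) + sumFin (λ u → sumFin (g u)) ≡ sumFin (λ u → sumFin (λ v → f u v + g u v))
    join f g = trans (≡-sym (sum-+ (λ u → sumFin (f u)) (λ u → sumFin (g u)))) (sum-cong (λ u → ≡-sym (sum-+ (f u) (g u))))
    row : ∀ u → ⟦ c u ⟧ * deg G u ≡ count (λ v → c u ∧ adj G u v)
    row u with c u
    ... | true  = +-identityʳ _
    ... | false = ≡-sym (count-false n)
    rows : sumFin (λ u → ⟦ c u ⟧ * deg G u) ≡ pairCount (λ u v → c u ∧ adj G u v)
    rows = sum-cong row
    cols : sumFin (λ u → ⟦ c u ⟧ * deg G u) ≡ pairCount (λ u v → c v ∧ adj G u v)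
    cols = trans rows (trans (pairCount-swap (λ u v → c u ∧ adj G u v))
      (sum-cong (λ u → count-cong (λ v → c v ∧ adj G v u) (λ v → c v ∧ adj G u v) (λ v → cong (c v ∧_) (sym G v u)))))
    pt : ∀ a p q → ⟦ a ∧ not (p xor q) ⟧ + (⟦ p ∧ a ⟧ + ⟦ q ∧ a ⟧) ≡ ⟦ a ⟧ + 2 * ⟦ p ∧ (q ∧ a) ⟧
    pt true  true  true  = refl
    pt true  true  false = refl
    pt true  false true  = refl
    pt true  false false = refl
    pt false true  true  = refl
    pt false true  false = refl
    pt false false true  = refl
    pt false false false = refl

  -- Exchange of summation: `u` is met once from each of its neighbours `x`, so its degree is added
  -- `deg G u` times.
  degree-squares : sumFin (λ x → sumFin (λ u → ⟦ adj G x u ⟧ * deg G u)) ≡ sumFin (λ u → deg G u * deg G u)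
  degree-squares = trans (sum-swap (λ x u → ⟦ adj G x u ⟧ * deg G u)) (sum-cong (λ u →
    trans (sum-*ʳ (deg G u) (λ x → ⟦ adj G x u ⟧)) (cong (_* deg G u)
      (trans (sum-cong (λ x → cong ⟦_⟧ (sym G x u))) (≡-sym (count-sum (adj G u)))))))

  degreeSum≤n² : degreeSum G ≤ n * n
  degreeSum≤n² = ≤-trans (sum-mono (λ u → count≤n (adj G u))) (≤-reflexive (sum-const n n))

  linkSize≤n² : ∀ x → linkSize G x ≤ n * n
  linkSize≤n² x = ≤-trans (Integral.∫-mono (pairs n) (λ yz → ⟦⟧≤1 (triangle G x yz))) (≤-reflexive (total-pairs n))

  -- The at most `K` vertices with large links are charged the trivial `n * n` each, all others at
  -- most `n * n / M`. A bounded number of exceptions is thus of lower order than `n * (n * n)`.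
  linkSum-bound : ∀ M K → count (λ x → n * n ≤ᵇ M * linkSize G x) ≤ K →
    M * sumFin (linkSize G) ≤ K * (M * (n * n)) + n * (n * n)
  linkSum-bound M K few = begin
    M * sumFin (linkSize G) ≡⟨ ≡-sym (sum-*ˡ M (linkSize G)) ⟩
    sumFin (λ x → M * linkSize G x) ≤⟨ sum-mono pt ⟩
    sumFin (λ x → ⟦ n * n ≤ᵇ M * linkSize G x ⟧ * (M * (n * n)) + n * n)
      ≡⟨ trans (sum-+ (λ x → ⟦ n * n ≤ᵇ M * linkSize G x ⟧ * (M * (n * n))) (λ _ → n * n))
          (cong₂ _+_ (trans (sum-*ʳ (M * (n * n)) (λ x → ⟦ n * n ≤ᵇ M * linkSize G x ⟧))
             (cong (_* (M * (n * n))) (≡-sym (count-sum (λ x → n * n ≤ᵇ M * linkSize G x))))) (sum-const n (n * n))) ⟩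
    count (λ x → n * n ≤ᵇ M * linkSize G x) * (M * (n * n)) + n * (n * n) ≤⟨ +-monoˡ-≤ _ (*-monoˡ-≤ (M * (n * n)) few) ⟩
    K * (M * (n * n)) + n * (n * n) ∎
    where
    open ≤-Reasoning
    pt : ∀ x → M * linkSize G x ≤ ⟦ n * n ≤ᵇ M * linkSize G x ⟧ * (M * (n * n)) + n * n
    pt x with n * n ≤ᵇ M * linkSize G x in e
    ... | true  = ≤-trans (*-monoʳ-≤ M (linkSize≤n² x)) (≤-trans (≤-reflexive (≡-sym (+-identityʳ _))) (m≤m+n _ (n * n)))
    ... | false = <⇒≤ (≤ᵇ-false e)

  -- Averaging the number of edges inside N(x) and inside its complement over all x.
  sparse-cut : ∀ M K → 0 < n → M + 2 * K * M ≤ n → n * n ≤ 2 * degreeSum G + 1 →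
    count (λ x → n * n ≤ᵇ M * linkSize G x) ≤ K → ∃ λ x → M * pairCount (inside G (adj G x)) ≤ 3 * (n * n)
  sparse-cut M K n>0 n-big dense few with below-average (λ x → pairCount (inside G (adj G x))) n>0
  ... | x , avg = x , *-cancelˡ-≤ (n * n) ⦃ >-nonZero (*-mono-≤ n>0 n>0) ⦄
    (arith n M K (pairCount (inside G (adj G x))) _ _ (degreeSum G) _ avg total-cut (cauchy (deg G)) dense (linkSum-bound M K few) degreeSum≤n² n-big)
    where
    total-cut : sumFin (λ x → pairCount (inside G (adj G x))) + 2 * sumFin (λ u → deg G u * deg G u)
              ≡ n * degreeSum G + 2 * sumFin (linkSize G)
    total-cut = trans (cong (λ t → sumFin (λ x → pairCount (inside G (adj G x))) + 2 * t) (≡-sym degree-squares))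
      (trans (cong (sumFin (λ x → pairCount (inside G (adj G x))) +_) (≡-sym (sum-*ˡ 2 (λ x → sumFin (λ u → ⟦ adj G x u ⟧ * deg G u)))))
      (trans (≡-sym (sum-+ (λ x → pairCount (inside G (adj G x))) (λ x → 2 * sumFin (λ u → ⟦ adj G x u ⟧ * deg G u))))
      (trans (sum-cong neighbourhood-cut) (trans (sum-+ (λ _ → degreeSum G) (λ x → 2 * linkSize G x))
        (cong₂ _+_ (sum-const n (degreeSum G)) (sum-*ˡ 2 (linkSize G)))))))
    arith : ∀ n M K B S Q D T → n * B ≤ S → S + 2 * Q ≡ n * D + 2 * T → D * D ≤ n * Q → n * n ≤ 2 * D + 1 →
      M * T ≤ K * (M * (n * n)) + n * (n * n) → D ≤ n * n → M + 2 * K * M ≤ n → n * n * (M * B) ≤ n * n * (3 * (n * n))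
    arith n M K B S Q D T h₁ h₂ h₃ h₄ h₅ h₆ h₇ = begin
      n * n * (M * B) ≡⟨ r₁ n M B ⟩
      M * (n * (n * B)) ≤⟨ *-monoʳ-≤ M step ⟩
      M * (D + 2 * n * T) ≤⟨ *-monoʳ-≤ M (+-monoˡ-≤ (2 * n * T) h₆) ⟩
      M * (n * n + 2 * n * T) ≡⟨ r₂ M n T ⟩
      M * (n * n) + 2 * n * (M * T) ≤⟨ +-monoʳ-≤ (M * (n * n)) (*-monoʳ-≤ (2 * n) h₅) ⟩
      M * (n * n) + 2 * n * (K * (M * (n * n)) + n * (n * n)) ≡⟨ r₃ M n K ⟩
      n * n * (M + (2 * K * M) * n + 2 * (n * n)) ≤⟨ *-monoʳ-≤ (n * n) (+-monoˡ-≤ (2 * (n * n)) fin) ⟩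
      n * n * (n * n + 2 * (n * n)) ≡⟨ r₄ n ⟩
      n * n * (3 * (n * n)) ∎
      where
      open ≤-Reasoning
      r₁ : ∀ n M B → n * n * (M * B) ≡ M * (n * (n * B))
      r₁ = solve-∀
      r₂ : ∀ M n T → M * (n * n + 2 * n * T) ≡ M * (n * n) + 2 * n * (M * T)
      r₂ = solve-∀
      r₃ : ∀ M n K → M * (n * n) + 2 * n * (K * (M * (n * n)) + n * (n * n)) ≡ n * n * (M + (2 * K * M) * n + 2 * (n * n))
      r₃ = solve-∀
      r₄ : ∀ n → n * n * (n * n + 2 * (n * n)) ≡ n * n * (3 * (n * n))
      r₄ = solve-∀
      r₅ : ∀ n S Q → n * (S + 2 * Q) ≡ n * S + (n * Q + n * Q)
      r₅ = solve-∀
      r₆ : ∀ n D T → n * (n * D + 2 * T) ≡ n * n * D + 2 * n * T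
      r₆ = solve-∀
      r₇ : ∀ D n T → (2 * D + 1) * D + 2 * n * T ≡ D + 2 * n * T + (D * D + D * D)
      r₇ = solve-∀
      r₈ : ∀ n M K → (M + 2 * K * M) * n ≡ M * n + 2 * K * M * n
      r₈ = solve-∀
      -- Multiplied by `n`, the summed identity has `n * n * D` on the right and, by Cauchy's
      -- inequality, at least `2 * D * D` on the left. As `n * n` is at most `2 * D + 1`, the main
      -- terms cancel; only `D` and the links remain.
      step : n * (n * B) ≤ D + 2 * n * T
      step = ≤-trans (*-monoʳ-≤ n h₁) (+-cancelʳ-≤ (D * D + D * D) _ _ (begin
        n * S + (D * D + D * D) ≤⟨ +-monoʳ-≤ (n * S) (+-mono-≤ h₃ h₃) ⟩
        n * S + (n * Q + n * Q) ≡⟨ ≡-sym (r₅ n S Q) ⟩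
        n * (S + 2 * Q) ≡⟨ trans (cong (n *_) h₂) (r₆ n D T) ⟩
        n * n * D + 2 * n * T ≤⟨ +-monoˡ-≤ (2 * n * T) (*-monoˡ-≤ D h₄) ⟩
        (2 * D + 1) * D + 2 * n * T ≡⟨ r₇ D n T ⟩
        D + 2 * n * T + (D * D + D * D) ∎))
      absorb : ∀ n → M + 2 * K * M ≤ n → M + 2 * K * M * n ≤ n * n
      absorb zero    le = ≤-trans (≤-reflexive (cong (M +_) (*-zeroʳ (2 * K * M)))) (≤-trans (+-monoʳ-≤ M z≤n) le)
      absorb (suc k) le = ≤-trans (+-monoˡ-≤ (2 * K * M * suc k) (m≤m*n M (suc k))) (≤-trans (≤-reflexive (≡-sym (r₈ (suc k) M K))) (*-monoˡ-≤ (suc k) le))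
      fin : M + 2 * K * M * n ≤ n * n
      fin = absorb n h₇

  mismatch-total : ∀ c → degreeSum G + pairCount (mismatch G c) ≡ pairCount (cross c) + 2 * pairCount (inside G c)
  mismatch-total c = trans (pairCount-+ (adj G) (mismatch G c)) (trans (sum-cong (λ u → sum-cong (λ v → pt (adj G u v) (cross c u v))))
    (trans (sum-cong (λ u → trans (sum-+ (λ v → ⟦ cross c u v ⟧) (λ v → 2 * ⟦ inside G c u v ⟧))
              (cong₂ _+_ (≡-sym (count-sum (cross c u))) (trans (sum-*ˡ 2 (λ v → ⟦ inside G c u v ⟧)) (cong (2 *_) (≡-sym (count-sum (inside G c u))))))))
      (trans (sum-+ (λ u → count (cross c u)) (λ u → 2 * count (inside G c u))) (cong (pairCount (cross c) +_) (sum-*ˡ 2 (λ u → count (inside G c u)))))))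
    where
    pt : ∀ a b → ⟦ a ⟧ + ⟦ a xor b ⟧ ≡ ⟦ b ⟧ + 2 * ⟦ a ∧ not b ⟧
    pt true  true  = refl
    pt true  false = refl
    pt false true  = refl
    pt false false = refl

cross-count : ∀ {n} (c : Fin n → Bool) → pairCount (cross c) ≡ 2 * (count c * count (λ v → not (c v)))
cross-count {n} c = trans (sum-cong pt) (trans (sum-+ (λ u → ⟦ c u ⟧ * f) (λ u → ⟦ not (c u) ⟧ * t))
  (trans (cong₂ _+_ (trans (sum-*ʳ f (λ u → ⟦ c u ⟧)) (cong (_* f) (≡-sym (count-sum c))))
                    (trans (sum-*ʳ t (λ u → ⟦ not (c u) ⟧)) (cong (_* t) (≡-sym (count-sum (λ u → not (c u)))))))
         (ring t f)))
  where
  t f : ℕ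
  t = count c
  f = count (λ v → not (c v))
  ring : ∀ t f → t * f + f * t ≡ 2 * (t * f)
  ring = solve-∀
  pt : ∀ u → count (cross c u) ≡ ⟦ c u ⟧ * f + ⟦ not (c u) ⟧ * t
  pt u with c u
  ... | true  = ≡-sym (trans (+-identityʳ _) (+-identityʳ f))
  ... | false = ≡-sym (+-identityʳ t)

side-size : ∀ {n} → (Fin n → Bool) → Bool → ℕ
side-size c b = count (λ v → not (c v xor b))

record Stable {n} (G : Graph n) (L : ℕ) : Set where
  field
    c : Fin n → Bool
  core : Fin n → Bool
  core v = L * count (mismatch G c v) ≤ᵇ n
  field
    exceptional-few : L * count (λ v → not (core v)) ≤ n
    balanced : ∀ b → L * side-size c b ≤ L * side-size c (not b) + n

square-≤⇒≤ : ∀ {a b} → a * a ≤ b * b → a ≤ b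
square-≤⇒≤ le = ≮⇒≥ (λ lt → <⇒≱ (*-mono-< lt lt) le)

-- If `s = s' + d`, then `n * n = 4 * s * s' + d * d` while `D` is at most `2 * s * s' + B`, so
-- density forces `d * d` to be at most `2 * B + 1`. The factor 7 is `2 * 3 + 1`: twice the
-- allowance for `B`, and one `n * n` that absorbs the unit.
balance-arith : ∀ L s s' n B D → 0 < n → n ≡ s + s' → n * n ≤ 2 * D + 1 → D ≤ 2 * (s * s') + B →
  7 * (L * L) * B ≤ 3 * (n * n) → 7 * (L * L) ≤ n → L * s ≤ L * s' + n
balance-arith L s s' n B D n>0 n≡ dense D≤ B≤ big with ≤-total s s'
... | inj₁ le = ≤-trans (*-monoʳ-≤ L le) (m≤m+n _ n)
... | inj₂ le with m≤n⇒∃[o]m+o≡n le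
...   | d , refl = ≤-trans (≤-reflexive (*-distribˡ-+ L s' d)) (+-monoʳ-≤ (L * s') (square-≤⇒≤ (*-cancelˡ-≤ 7 main)))
  where
  open ≤-Reasoning
  r₁ : ∀ s' d → (s' + d + s') * (s' + d + s') ≡ 4 * ((s' + d) * s') + d * d
  r₁ = solve-∀
  r₂ : ∀ x B → 2 * (2 * x + B) + 1 ≡ 4 * x + (2 * B + 1)
  r₂ = solve-∀
  r₃ : ∀ L d → 7 * (L * d * (L * d)) ≡ 7 * (L * L) * (d * d)
  r₃ = solve-∀
  r₄ : ∀ K B → K * (2 * B + 1) ≡ 2 * (K * B) + K
  r₄ = solve-∀
  r₅ : ∀ m → 2 * (3 * m) + m ≡ 7 * m
  r₅ = solve-∀
  d² : d * d ≤ 2 * B + 1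
  d² = +-cancelˡ-≤ (4 * ((s' + d) * s')) _ _ (begin
    4 * ((s' + d) * s') + d * d ≡⟨ ≡-sym (r₁ s' d) ⟩
    (s' + d + s') * (s' + d + s') ≡⟨ cong (λ t → t * t) (≡-sym n≡) ⟩
    n * n ≤⟨ dense ⟩
    2 * D + 1 ≤⟨ +-monoˡ-≤ 1 (*-monoʳ-≤ 2 D≤) ⟩
    2 * (2 * ((s' + d) * s') + B) + 1 ≡⟨ r₂ ((s' + d) * s') B ⟩
    4 * ((s' + d) * s') + (2 * B + 1) ∎)
  main : 7 * (L * d * (L * d)) ≤ 7 * (n * n)
  main = begin
    7 * (L * d * (L * d)) ≡⟨ r₃ L d ⟩
    7 * (L * L) * (d * d) ≤⟨ *-monoʳ-≤ (7 * (L * L)) d² ⟩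
    7 * (L * L) * (2 * B + 1) ≡⟨ r₄ (7 * (L * L)) B ⟩
    2 * (7 * (L * L) * B) + 7 * (L * L) ≤⟨ +-mono-≤ (*-monoʳ-≤ 2 B≤) (≤-trans big (m≤m*n n n ⦃ >-nonZero n>0 ⦄)) ⟩
    2 * (3 * (n * n)) + n * n ≡⟨ r₅ (n * n) ⟩
    7 * (n * n) ∎

-- Few edges inside the cut leave few gaps across it: `4 * t * f` is at most `n * n` and the degree
-- sum is nearly half of `n * n`, so the total mismatch is at most `2 * B + 1`. Markov's inequality
-- then bounds the vertices outside the core.
sparse-cut⇒stable : ∀ {n} (G : Graph n) L c → 0 < n → 0 < L → n * n ≤ 2 * degreeSum G + 1 →
  7 * (L * L) * pairCount (inside G c) ≤ 3 * (n * n) → 7 * (L * L) ≤ n → Stable G L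
sparse-cut⇒stable {n} G L c n>0 L>0 dense sparse big = record { c = c ; exceptional-few = few ; balanced = bal }
  where
  open ≤-Reasoning
  t f B D μ Z : ℕ
  t = count c
  f = count (λ v → not (c v))
  B = pairCount (inside G c)
  D = degreeSum G
  μ = pairCount (mismatch G c)
  t+f : n ≡ t + f
  t+f = ≡-sym (count-not c)
  size-t : side-size c true ≡ t
  size-t = count-cong (λ v → not (c v xor true)) c (λ v → nn (c v))
    where nn : ∀ b → not (b xor true) ≡ b
          nn true = refl
          nn false = refl
  size-f : side-size c false ≡ f
  size-f = count-cong (λ v → not (c v xor false)) (λ v → not (c v)) (λ v → nn (c v))
    where nn : ∀ b → not (b xor false) ≡ not b
          nn true = refl
          nn false = refl
  total : D + μ ≡ 2 * (t * f) + 2 * B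
  total = trans (mismatch-total G c) (cong (_+ 2 * B) (cross-count c))
  D≤X+B : D ≤ 2 * (t * f) + B
  D≤X+B = ≤-trans (sum-mono (λ u → sum-le u)) (≤-reflexive (trans (sum-+ (λ u → count (cross c u)) (λ u → count (inside G c u))) (cong (_+ B) (cross-count c))))
    where
    sum-le : ∀ u → count (adj G u) ≤ count (cross c u) + count (inside G c u)
    sum-le u = ≤-trans (≤-reflexive (count-split (adj G u) (cross c u)))
      (+-monoˡ-≤ _ (count-mono (λ v → adj G u v ∧ cross c u v) (cross c u) (λ v e → proj₂ (∧-elim (adj G u v) e))))
  four : ∀ a b → 4 * (a * b) ≤ (a + b) * (a + b)
  four a b with ≤-total a b
  ... | inj₁ le with m≤n⇒∃[o]m+o≡n le
  ...   | d , refl = ≤-trans (m≤m+n _ (d * d)) (≤-reflexive (r a d))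
    where r : ∀ a d → 4 * (a * (a + d)) + d * d ≡ (a + (a + d)) * (a + (a + d))
          r = solve-∀
  four a b | inj₂ le with m≤n⇒∃[o]m+o≡n le
  ...   | d , refl = ≤-trans (m≤m+n _ (d * d)) (≤-reflexive (r b d))
    where r : ∀ a d → 4 * ((a + d) * a) + d * d ≡ (a + d + a) * (a + d + a)
          r = solve-∀
  μ≤ : μ ≤ 2 * B + 1
  μ≤ = *-cancelˡ-≤ 2 (+-cancelˡ-≤ (2 * D) _ _ (begin
    2 * D + 2 * μ ≡⟨ ≡-sym (*-distribˡ-+ 2 D μ) ⟩
    2 * (D + μ) ≡⟨ cong (2 *_) total ⟩
    2 * (2 * (t * f) + 2 * B) ≡⟨ r₁ (t * f) B ⟩
    4 * (t * f) + 4 * B ≤⟨ +-monoˡ-≤ (4 * B) (four t f) ⟩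
    (t + f) * (t + f) + 4 * B ≡⟨ cong (λ x → x * x + 4 * B) (≡-sym t+f) ⟩
    n * n + 4 * B ≤⟨ +-monoˡ-≤ (4 * B) dense ⟩
    2 * D + 1 + 4 * B ≤⟨ m≤m+n _ 1 ⟩
    2 * D + 1 + 4 * B + 1 ≡⟨ r₂ D B ⟩
    2 * D + 2 * (2 * B + 1) ∎))
    where
    r₁ : ∀ x B → 2 * (2 * x + 2 * B) ≡ 4 * x + 4 * B
    r₁ = solve-∀
    r₂ : ∀ D B → 2 * D + 1 + 4 * B + 1 ≡ 2 * D + 2 * (2 * B + 1)
    r₂ = solve-∀
  Z = count (λ v → not (L * count (mismatch G c v) ≤ᵇ n))
  Zn : Z * n ≤ L * μ
  Zn = ≤-trans (markov (λ v → not (L * count (mismatch G c v) ≤ᵇ n)) (λ v → L * count (mismatch G c v)) n (λ v e → <⇒≤ (≤ᵇ-false (not-elim e))))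
    (≤-reflexive (sum-*ˡ L (λ v → count (mismatch G c v))))
  few : L * Z ≤ n
  few = *-cancelˡ-≤ (7 * (L * n)) ⦃ >-nonZero (*-mono-≤ {1} {7} (s≤s z≤n) (*-mono-≤ L>0 n>0)) ⦄ (begin
    7 * (L * n) * (L * Z) ≡⟨ r₁ L n Z ⟩
    7 * (L * L) * (Z * n) ≤⟨ *-monoʳ-≤ (7 * (L * L)) (≤-trans Zn (*-monoʳ-≤ L μ≤)) ⟩
    7 * (L * L) * (L * (2 * B + 1)) ≡⟨ r₂ (7 * (L * L)) L B ⟩
    L * (2 * (7 * (L * L) * B) + 7 * (L * L)) ≤⟨ *-monoʳ-≤ L (+-mono-≤ (*-monoʳ-≤ 2 sparse) (≤-trans big (m≤m*n n n ⦃ >-nonZero n>0 ⦄))) ⟩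
    L * (2 * (3 * (n * n)) + n * n) ≡⟨ r₃ L n ⟩
    7 * (L * n) * n ∎)
    where
    r₁ : ∀ L n Z → 7 * (L * n) * (L * Z) ≡ 7 * (L * L) * (Z * n)
    r₁ = solve-∀
    r₂ : ∀ K L B → K * (L * (2 * B + 1)) ≡ L * (2 * (K * B) + K)
    r₂ = solve-∀
    r₃ : ∀ L n → L * (2 * (3 * (n * n)) + n * n) ≡ 7 * (L * n) * n
    r₃ = solve-∀
  bal : ∀ b → L * side-size c b ≤ L * side-size c (not b) + n
  bal true  rewrite size-t | size-f = balance-arith L t f n B D n>0 t+f dense D≤X+B sparse big
  bal false rewrite size-t | size-f = balance-arith L f t n B D n>0 (trans t+f (+-comm t f)) dense
    (≤-trans D≤X+B (≤-reflexive (cong (λ x → 2 * x + B) (*-comm t f)))) sparse big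

stability : ∀ h L → 0 < h → 0 < L → Σ ℕ λ n₀ → ∀ n → n₀ ≤ n → (H : Graph h) (col : Fin h → Fin 3) → Proper H col →
  (G : Graph n) → Free H G → n * n ≤ 2 * degreeSum G + 1 → Stable G L
stability h L h>0 L>0 = from (7 * (L * L)) refl (few-large-links h (7 * (L * L)) h>0)
  where
  from : ∀ M → M ≡ 7 * (L * L) → (Σ ℕ λ K → Σ ℕ λ n₀ → ∀ n → n₀ ≤ n → (H : Graph h) (col : Fin h → Fin 3) → Proper H col →
    (G : Graph n) → Free H G → count (λ x → n * n ≤ᵇ M * linkSize G x) ≤ K) →
    Σ ℕ λ n₀ → ∀ n → n₀ ≤ n → (H : Graph h) (col : Fin h → Fin 3) → Proper H col →
      (G : Graph n) → Free H G → n * n ≤ 2 * degreeSum G + 1 → Stable G L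
  from M refl (K , n₀ , links) = suc (n₀ + (M + 2 * K * M)) , λ n n≥ H col proper G free dense →
    let n>0 = ≤-trans (s≤s z≤n) n≥
        n≥' = ≤-trans (n≤1+n _) n≥
        x , sparse = sparse-cut G M K n>0 (≤-trans (m≤n+m _ n₀) n≥') dense (links n (≤-trans (m≤m+n n₀ _) n≥') H col proper G free)
    in sparse-cut⇒stable G L (adj G x) n>0 L>0 dense sparse (≤-trans (≤-trans (m≤m+n M (2 * K * M)) (m≤n+m _ n₀)) n≥')

-- Decomposition family and 3-colourings

injective-onto : ∀ {a b} (P : Fin a → Bool) (Q : Fin b → Bool) (f : Fin a → Fin b) →
  (∀ x → P x ≡ true → Q (f x) ≡ true) → (∀ x y → P x ≡ true → P y ≡ true → f x ≡ f y → x ≡ y) →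
  count Q ≤ count P → ∀ y → Q y ≡ true → ∃ λ x → P x ≡ true × f x ≡ y
injective-onto P Q f Qf inj le y Qy with find (λ x → P x ∧ (f x == y))
... | inj₁ (x , e) = x , proj₁ (∧-elim (P x) e) , ==-sound (proj₂ (∧-elim (P x) e))
... | inj₂ none = ⊥-elim (<-irrefl refl (≤-trans strict le))
  where
  miss : ∀ x → P x ≡ true → (f x == y) ≡ false
  miss x e = ≢true λ q → false≢true (none x) (∧-intro e q)
  strict : count P < count Q
  strict = begin-strict
    count P ≤⟨ count-injection P (λ z → Q z ∧ not (z == y)) f (λ x e → ∧-intro (Qf x e) (cong not (miss x e))) inj ⟩
    count (λ z → Q z ∧ not (z == y)) <⟨ +-monoˡ-≤ _ (∃⇒count>0 (λ z → Q z ∧ (z == y)) (∧-intro Qy (==-refl y))) ⟩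
    count (λ z → Q z ∧ (z == y)) + count (λ z → Q z ∧ not (z == y)) ≡⟨ ≡-sym (count-split Q (λ z → z == y)) ⟩
    count Q ∎
    where open ≤-Reasoning

sum-injection : ∀ {a b} (g : Fin b → ℕ) (f : Fin a → Fin b) → (∀ x y → f x ≡ f y → x ≡ y) → sumFin (λ x → g (f x)) ≤ sumFin g
sum-injection {a} {b} g f inj = begin
  sumFin (λ x → g (f x)) ≤⟨ sum-mono (λ x → ≤-trans (≤-trans (≤-reflexive (≡-sym (trans (cong (λ t → ⟦ t ⟧ * g (f x)) (==-refl (f x))) (+-identityʳ _)))) (term≤sum (λ y → ⟦ f x == y ⟧ * g y) (f x))) ≤-refl) ⟩
  sumFin (λ x → sumFin (λ y → ⟦ f x == y ⟧ * g y)) ≡⟨ sum-swap (λ x y → ⟦ f x == y ⟧ * g y) ⟩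
  sumFin (λ y → sumFin (λ x → ⟦ f x == y ⟧ * g y)) ≡⟨ sum-cong (λ y → trans (sum-*ʳ (g y) (λ x → ⟦ f x == y ⟧)) (cong (_* g y) (≡-sym (count-sum (λ x → f x == y))))) ⟩
  sumFin (λ y → count (λ x → f x == y) * g y) ≤⟨ sum-mono (λ y → ≤-trans (*-monoˡ-≤ (g y) (fibre y)) (≤-reflexive (*-identityˡ (g y)))) ⟩
  sumFin g ∎
  where
  open ≤-Reasoning
  fibre : ∀ y → count (λ x → f x == y) ≤ 1
  fibre y = ≤-trans (count-injection (λ x → f x == y) (λ z → z == y) f (λ x e → e) (λ x x' _ _ → inj x x')) (≤-reflexive (count-== y))

-- For an arbitrary predicate a least witness exists only up to double negation, which suffices for
-- a stable goal. `fuel` bounds the descent.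
least-element : (P : ℕ → Set) → ∀ n → P n → ¬ ¬ (Σ ℕ λ m → P m × m ≤ n × (∀ k → P k → m ≤ k))
least-element P n Pn = go n n ≤-refl Pn
  where
  go : ∀ fuel n → n ≤ fuel → P n → ¬ ¬ (Σ ℕ λ m → P m × m ≤ n × (∀ k → P k → m ≤ k))
  go fuel n n≤ Pn none = none (n , Pn , ≤-refl , λ k Pk → ≮⇒≥ (smaller fuel n≤ k Pk))
    where
    smaller : ∀ fuel → n ≤ fuel → ∀ k → P k → ¬ (k < n)
    smaller zero       n≤ k Pk lt = <⇒≱ lt (≤-trans n≤ z≤n)
    smaller (suc fuel) n≤ k Pk lt = go fuel k (s≤s⁻¹ (≤-trans lt n≤)) Pk
      (λ { (m , Pm , m≤k , least) → none (m , Pm , ≤-trans m≤k (<⇒≤ lt) , least) })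

⊆-trans : ∀ {a b c} {A : Graph a} {B : Graph b} {C : Graph c} → A ⊆ B → B ⊆ C → A ⊆ C
⊆-trans (f , fi , fe) (g , gi , ge) =
  (λ x → g (f x)) , (λ x y q → fi x y (gi _ _ q)) , (λ x y a → ge _ _ (fe x y a))

⊆-degreeSum : ∀ {a b} {A : Graph a} {B : Graph b} → A ⊆ B → degreeSum A ≤ degreeSum B
⊆-degreeSum {A = A} {B} (f , fi , fe) =
  ≤-trans (sum-mono (λ x → count-injection (adj A x) (adj B (f x)) f (fe x) (λ y z _ _ → fi y z)))
          (sum-injection (deg B) f fi)

⊆-vertices : ∀ {a b} {A : Graph a} {B : Graph b} → A ⊆ B → a ≤ b
⊆-vertices {a} {b} (f , fi , fe) = ≤-trans (≤-reflexive (≡-sym (count-true a)))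
  (≤-trans (count-injection (λ _ → true) (λ _ → true) f (λ _ _ → refl) (λ x y _ _ → fi x y)) (≤-reflexive (count-true b)))

-- The sizes make the embedding bijective. The degree sums make all degrees agree by `sum-tight`, so
-- neighbourhoods are mapped onto neighbourhoods and the inverse preserves edges.
⊆-antisym : ∀ {a b} {A : Graph a} {B : Graph b} → A ⊆ B → b ≤ a → degreeSum B ≤ degreeSum A → B ⊆ A
⊆-antisym {a} {b} {A} {B} (f , fi , fe) b≤a dB≤dA = g , g-inj , g-edge
  where
  onto : ∀ y → ∃ λ x → true ≡ true × f x ≡ y
  onto y = injective-onto (λ _ → true) (λ _ → true) f (λ _ _ → refl) (λ x y _ _ → fi x y)
    (≤-trans (≤-reflexive (count-true b)) (≤-trans b≤a (≤-reflexive (≡-sym (count-true a))))) y refl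
  g : Fin b → Fin a
  g y = proj₁ (onto y)
  fg : ∀ y → f (g y) ≡ y
  fg y = proj₂ (proj₂ (onto y))
  g-inj : ∀ x y → g x ≡ g y → x ≡ y
  g-inj x y q = trans (≡-sym (fg x)) (trans (cong f q) (fg y))
  same-degree : ∀ x → deg A x ≡ deg B (f x)
  same-degree = sum-tight (λ x → count-injection (adj A x) (adj B (f x)) f (fe x) (λ y z _ _ → fi y z))
    (≤-trans (sum-injection (deg B) f fi) dB≤dA)
  g-edge : ∀ x y → adj B x y ≡ true → adj A (g x) (g y) ≡ true
  g-edge x y e with injective-onto (adj A (g x)) (adj B (f (g x))) f (fe (g x)) (λ y z _ _ → fi y z)
      (≤-reflexive (≡-sym (same-degree (g x)))) y (trans (cong (λ z → adj B z y) (fg x)) e)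
  ... | z , a , q = trans (cong (adj A (g x)) (fi (g y) z (trans (fg y) (≡-sym q)))) a

InducedIndCover : ∀ {a b} {A : Graph a} {B : Graph b} ((f , _) : A ⊆ B) {S} → IndCover B S → IndCover A (λ x → S (f x))
InducedIndCover (f , _ , fe) (ind , cov) = (λ x y a → ind _ _ (fe x y a)) , (λ x y a → cov _ _ (fe x y a))

count-++ : ∀ a {b} (P : Fin (a + b) → Bool) → count P ≡ count (λ i → P (i ↑ˡ b)) + count (λ j → P (a ↑ʳ j))
count-++ zero    P = refl
count-++ (suc a) P = trans (cong (⟦ P zero ⟧ +_) (count-++ a (λ i → P (suc i)))) (≡-sym (+-assoc ⟦ P zero ⟧ _ _))

Code : ℕ → ℕ → Set
Code m t = (Fin m ⊎ Fin t) ⊎ Fin t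

encode : ∀ {m t} → Code m t → Fin ((m + t) + t)
encode {m} {t} (inj₁ (inj₁ a)) = (a ↑ˡ t) ↑ˡ t
encode {m} {t} (inj₁ (inj₂ a)) = (m ↑ʳ a) ↑ˡ t
encode {m} {t} (inj₂ a)        = (m + t) ↑ʳ a

classify-encode : ∀ {m t} (c : Code m t) → classify {m} {t} (encode c) ≡ c
classify-encode {m} {t} (inj₁ (inj₁ a)) rewrite splitAt-↑ˡ (m + t) (a ↑ˡ t) t | splitAt-↑ˡ m a t = refl
classify-encode {m} {t} (inj₁ (inj₂ a)) rewrite splitAt-↑ˡ (m + t) (m ↑ʳ a) t | splitAt-↑ʳ m t a = refl
classify-encode {m} {t} (inj₂ a)        rewrite splitAt-↑ʳ (m + t) t a = refl

pattern S = zero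
pattern X = suc zero
pattern Y = suc (suc zero)

-- The cover `T` takes S, the rest of the class containing `M` takes X, the other class of the host
-- takes Y. Independence of `T` excludes edges within S, the covering property excludes edges within
-- X.
decomp⇒colouring : ∀ {h m} (H : Graph h) (M : Graph m) → DecCond H M → (T : Fin m → Bool) → IndCover M T →
  Σ (Fin h → Fin 3) λ col → Proper H col × size col S ≤ count T
decomp⇒colouring {h} {m} H M (f , f-inj , f-edge) T (ind , cov) = (λ x → colour (classify (f x))) , proper , small
  where
  colour : Code m h → Fin 3
  colour (inj₁ (inj₁ a)) = if T a then S else X
  colour (inj₁ (inj₂ a)) = X
  colour (inj₂ a)        = Y
  separated : ∀ c d → adjS M c d ≡ true → colour c ≢ colour d
  separated (inj₁ (inj₁ a)) (inj₁ (inj₁ b)) e q with T a in Ta | T b in Tb | cov a b e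
  ... | true  | true  | _ = ind a b e (Ta , Tb)
  ... | false | false | inj₁ ()
  ... | false | false | inj₂ ()
  separated (inj₁ (inj₁ a)) (inj₁ (inj₁ b)) e () | true | false | _
  separated (inj₁ (inj₁ a)) (inj₁ (inj₁ b)) e () | false | true | _
  separated (inj₁ (inj₁ a)) (inj₂ b) e q with T a
  separated (inj₁ (inj₁ a)) (inj₂ b) e () | true
  separated (inj₁ (inj₁ a)) (inj₂ b) e () | false
  separated (inj₁ (inj₂ a)) (inj₂ b) e ()
  separated (inj₂ a) (inj₁ (inj₁ b)) e q with T b
  separated (inj₂ a) (inj₁ (inj₁ b)) e () | true
  separated (inj₂ a) (inj₁ (inj₁ b)) e () | false
  separated (inj₂ a) (inj₁ (inj₂ b)) e ()
  proper : Proper H (λ x → colour (classify (f x)))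
  proper x y a = separated (classify (f x)) (classify (f y)) (f-edge x y a)
  inT : Code m h → Bool
  inT c = colour c == S
  small : count (λ x → inT (classify (f x))) ≤ count T
  small = begin
    count (λ x → inT (classify (f x))) ≤⟨ count-injection (λ x → inT (classify (f x))) (λ z → inT (classify {m} {h} z)) f (λ _ e → e) (λ x y _ _ → f-inj x y) ⟩
    count (λ z → inT (classify {m} {h} z)) ≡⟨ count-++ (m + h) {h} (λ z → inT (classify {m} {h} z)) ⟩
    count (λ i → inT (classify {m} {h} (i ↑ˡ h))) + count {h} (λ j → inT (classify {m} {h} ((m + h) ↑ʳ j)))
      ≡⟨ cong₂ _+_ (count-++ m {h} (λ i → inT (classify {m} {h} (i ↑ˡ h))))
           (trans (count-cong (λ j → inT (classify {m} {h} ((m + h) ↑ʳ j))) (λ _ → false) (λ j → cong inT (classify-encode {m} {h} (inj₂ j)))) (count-false h)) ⟩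
    count (λ a → inT (classify {m} {h} ((a ↑ˡ h) ↑ˡ h))) + count {h} (λ j → inT (classify {m} {h} ((m ↑ʳ j) ↑ˡ h))) + 0
      ≡⟨ cong (_+ 0) (cong₂ _+_ (count-cong (λ a → inT (classify {m} {h} ((a ↑ˡ h) ↑ˡ h))) T (λ a → trans (cong inT (classify-encode {m} {h} (inj₁ (inj₁ a)))) (pick (T a))))
           (trans (count-cong (λ j → inT (classify {m} {h} ((m ↑ʳ j) ↑ˡ h))) (λ _ → false) (λ j → cong inT (classify-encode {m} {h} (inj₁ (inj₂ j))))) (count-false h))) ⟩
    count T + 0 + 0 ≡⟨ trans (+-identityʳ _) (+-identityʳ _) ⟩
    count T ∎
    where
    open ≤-Reasoning
    pick : ∀ b → ((if b then S else X) == zero {2}) ≡ b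
    pick true  = refl
    pick false = refl

-- The converse passage: `M` is induced by the vertices that are not Y and have a neighbour of the
-- same kind, with the S-vertices as independent cover. Vertices left isolated go to the edgeless
-- part and Y-vertices to the far class; both have `h` places, so each vertex serves as its own
-- index.
module ColouringDecomp {h} (H : Graph h) (col : Fin h → Fin 3) (proper : Proper H col) where

  low : Fin h → Bool
  low x = not (col x == Y)

  V : Fin h → Bool
  V x = low x ∧ (0 <ᵇ count (λ y → adj H x y ∧ low y))

  V-intro : ∀ {x y} → low x ≡ true → adj H x y ≡ true → low y ≡ true → V x ≡ true
  V-intro {x} {y} lx a ly = ∧-intro lx (<ᵇ-complete (∃⇒count>0 (λ y → adj H x y ∧ low y) (∧-intro a ly)))

  V-low : ∀ {x} → V x ≡ true → low x ≡ true
  V-low {x} e = proj₁ (∧-elim (low x) e)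

  V-edge : ∀ {x} → V x ≡ true → ∃ λ y → adj H x y ≡ true × V y ≡ true
  V-edge {x} e with count>0⇒∃ (λ y → adj H x y ∧ low y) (<ᵇ-sound (proj₂ (∧-elim (low x) e)))
  ... | y , q = y , proj₁ (∧-elim (adj H x y) q) , V-intro (proj₂ (∧-elim (adj H x y) q)) (adj-sym H (proj₁ (∧-elim (adj H x y) q))) (V-low {x} e)

  m : ℕ
  m = count V

  listing : Σ (Fin m → Fin h) λ f → (∀ i → V (f i) ≡ true) × (∀ i j → f i ≡ f j → i ≡ j)
  listing = enumerate V ≤-refl

  e : Fin m → Fin h
  e = proj₁ listing

  e-V : ∀ i → V (e i) ≡ true
  e-V = proj₁ (proj₂ listing)

  e-inj : ∀ i j → e i ≡ e j → i ≡ j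
  e-inj = proj₂ (proj₂ listing)

  index : ∀ x → V x ≡ true → ∃ λ i → e i ≡ x
  index x Vx with injective-onto (λ _ → true) V e (λ i _ → e-V i) (λ i j _ _ → e-inj i j) (≤-reflexive (≡-sym (count-true m))) x Vx
  ... | i , _ , q = i , q

  M : Graph m
  M = record { adj = λ i j → adj H (e i) (e j) ; sym = λ i j → sym H (e i) (e j) ; irr = λ i → irr H (e i) }

  noIsolated : NoIsolated M
  noIsolated i with V-edge (e-V i)
  ... | y , a , Vy with index y Vy
  ...   | j , q = j , trans (cong (adj H (e i)) q) a

  T : Fin m → Bool
  T i = col (e i) == S

  notY : ∀ {c c' : Fin 3} → not (c == Y) ≡ true → not (c' == Y) ≡ true → c ≢ c' → (c == S) ≡ true ⊎ (c' == S) ≡ true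
  notY {S} _ _ _ = inj₁ refl
  notY {X} {S} _ _ _ = inj₂ refl
  notY {X} {X} _ _ ne = ⊥-elim (ne refl)
  notY {Y} () _ _
  notY {X} {Y} _ () _

  cover : IndCover M T
  cover = (λ i j a (s , t) → proper _ _ a (trans (==-sound s) (≡-sym (==-sound t))))
        , (λ i j a → notY (V-low (e-V i)) (V-low (e-V j)) (proper _ _ a))

  T-small : count T ≤ size col S
  T-small = count-injection T (λ x → col x == S) e (λ _ q → q) (λ i j _ _ → e-inj i j)

  data View (x : Fin h) : Code m h → Set where
    inM   : ∀ i → e i ≡ x → View x (inj₁ (inj₁ i))
    alone : V x ≡ false → low x ≡ true → View x (inj₁ (inj₂ x))
    high  : col x ≡ Y → View x (inj₂ x)

  view : ∀ x → Σ (Code m h) (View x)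
  view x with col x == Y in eY
  ... | true  = _ , high (==-sound eY)
  ... | false with V x in eV
  ...   | true  = _ , inM _ (proj₂ (index x eV))
  ...   | false = _ , alone eV (cong not eY)

  View-inj : ∀ {x y c} → View x c → View y c → x ≡ y
  View-inj (inM i p) (inM .i q) = trans (≡-sym p) q
  View-inj (alone _ _) (alone _ _) = refl
  View-inj (high _) (high _) = refl

  low-of : ∀ {x i} → e i ≡ x → low x ≡ true
  low-of {i = i} refl = V-low (e-V i)

  View-edge : ∀ {x y c d} → View x c → View y d → adj H x y ≡ true → adjS M c d ≡ true
  View-edge (inM i refl) (inM j refl) a = a
  View-edge {x} {y} (inM i p) (alone ny ly) a = false≢true ny (V-intro ly (adj-sym H a) (low-of p))
  View-edge (alone nx lx) (inM j q) a = false≢true nx (V-intro lx a (low-of q))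
  View-edge (alone nx lx) (alone _ ly) a = false≢true nx (V-intro lx a ly)
  View-edge (inM _ _) (high _) a = refl
  View-edge (alone _ _) (high _) a = refl
  View-edge (high _) (inM _ _) a = refl
  View-edge (high _) (alone _ _) a = refl
  View-edge {x} {y} (high p) (high q) a = ⊥-elim (proper x y a (trans p (≡-sym q)))

  decCond : DecCond H M
  decCond = (λ x → encode (proj₁ (view x))) , inj , edge
    where
    code-inj : ∀ {c d : Code m h} → encode c ≡ encode d → c ≡ d
    code-inj {c} {d} q = trans (≡-sym (classify-encode c)) (trans (cong (classify {m} {h}) q) (classify-encode d))
    inj : ∀ x y → encode (proj₁ (view x)) ≡ encode (proj₁ (view y)) → x ≡ y
    inj x y q = View-inj (proj₂ (view x)) (subst (View y) (≡-sym (code-inj q)) (proj₂ (view y)))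
    edge : ∀ x y → adj H x y ≡ true → adjS M (classify (encode (proj₁ (view x)))) (classify (encode (proj₁ (view y)))) ≡ true
    edge x y a rewrite classify-encode (proj₁ (view x)) | classify-encode (proj₁ (view y)) = View-edge (proj₂ (view x)) (proj₂ (view y)) a

IndCover⇒Bipartite : ∀ {m} {M : Graph m} {T} → IndCover M T → Bipartite M
IndCover⇒Bipartite {M = M} {T} (ind , cov) = T , λ x y a q → case cov x y a of λ
  { (inj₁ t) → ind x y a (t , trans (≡-sym q) t) ; (inj₂ t) → ind x y a (trans q t , t) }

-- The graph read off a colouring need not be minimal. A subgraph with least `m' + degreeSum M'`
-- that still satisfies `DecCond` belongs to the family, and the cover restricts to it. That
-- subgraph and its smallest cover exist only classically, which is harmless because the conclusion
-- is a decidable inequality.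
q-minimal : ∀ {h q} {H : Graph h} → IsQ H q → (col : Fin h → Fin 3) → Proper H col → q ≤ size col S
q-minimal {h} {q} {H} (_ , least-q) col proper = decidable-stable (q ≤? size col S) λ not-le →
  least-element Candidate _ start λ { (_ , (m₁ , M₁ , (ni₁ , dc₁ , M₁⊆M) , refl) , _ , least) →
    let cover₁ = InducedIndCover {A = M₁} {B = M} M₁⊆M cover
        decomp₁ = ni₁ , dc₁ , (λ m' M' ni' dc' M'⊆M₁ →
          let le = least _ (m' , M' , (ni' , dc' , ⊆-trans {A = M'} {B = M₁} {C = M} M'⊆M₁ M₁⊆M) , refl)
          -- Passing to `M'` cannot increase the number of vertices or the degree sum, so minimality
          -- of their sum forces both to stay equal.
          in ⊆-antisym {A = M'} {B = M₁} M'⊆M₁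
               (+-cancelʳ-≤ (degreeSum M₁) _ _ (≤-trans le (+-monoʳ-≤ m' (⊆-degreeSum {A = M'} {B = M₁} M'⊆M₁))))
               (+-cancelˡ-≤ m₁ _ _ (≤-trans le (+-monoˡ-≤ (degreeSum M') (⊆-vertices {A = M'} {B = M₁} M'⊆M₁)))))
    in least-element (λ k → Σ (Fin m₁ → Bool) λ T → IndCover M₁ T × count T ≡ k) _ (_ , cover₁ , refl)
         λ { (q' , attained , q'≤ , q'-least) → not-le (≤-trans
           (least-q m₁ M₁ decomp₁ (IndCover⇒Bipartite {M = M₁} cover₁) q' (attained , λ T c → q'-least _ (T , c , refl)))
           (≤-trans q'≤ (≤-trans (count-injection _ T (proj₁ M₁⊆M) (λ _ t → t) (λ x y _ _ → proj₁ (proj₂ M₁⊆M) x y)) T-small))) } }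
  where
  open ColouringDecomp H col proper
  Candidate : ℕ → Set
  Candidate k = Σ ℕ λ m' → Σ (Graph m') λ M' → (NoIsolated M' × DecCond H M' × M' ⊆ M) × m' + degreeSum M' ≡ k
  start : Candidate (m + degreeSum M)
  start = m , M , (noIsolated , decCond , (λ x → x) , (λ _ _ q → q) , (λ _ _ a → a)) , refl

q-attained : ∀ {h q} {H : Graph h} → IsQ H q → Σ (Fin h → Fin 3) λ col → Proper H col × size col S ≤ q
q-attained {H = H} ((m , M , (_ , dc , _) , _ , (T , cover , refl) , _) , _) = decomp⇒colouring H M dc T cover

-- Colourings of an odd-ballooning

toXY : Bool → Fin 3
toXY true  = X
toXY false = Y

toXY-inj : ∀ {a b} → toXY a ≡ toXY b → a ≡ b
toXY-inj {true}  {true}  _ = refl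
toXY-inj {false} {false} _ = refl

toXY≢S : ∀ {b} → toXY b ≢ S
toXY≢S {true}  ()
toXY≢S {false} ()

not-≢ : ∀ b → b ≢ not b
not-≢ true  ()
not-≢ false ()

odd : ℕ → Bool
odd zero    = false
odd (suc i) = not (odd i)

-- With `p = 2 * r + 1` interior vertices the far end of the path has the even position `p + 1`;
-- this is how the oddness of the cycles enters.
odd-of-even : ∀ r → odd (suc (suc (2 * r))) ≡ false
odd-of-even zero    = refl
odd-of-even (suc r) = trans (cong (λ t → not (not (odd t))) (e r)) (cong (λ b → not (not b)) (odd-of-even r))
  where e : ∀ r → 2 * suc r ≡ suc (suc (2 * r))
        e = solve-∀

-- The colour of the i-th vertex on a path whose only vertex of colour S is at position s, the
-- vertices before (after) it alternating so that an even position has colour a (b).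
pathColour : ℕ → ℕ → Bool → Bool → Fin 3
pathColour zero    zero    a b = S
pathColour zero    (suc i) a b = toXY (b xor odd (suc i))
pathColour (suc s) zero    a b = toXY a
pathColour (suc s) (suc i) a b = pathColour s i (not a) (not b)

pathColour-step : ∀ s i a b → pathColour s i a b ≢ pathColour s (suc i) a b
pathColour-step zero    zero    a b e = toXY≢S (≡-sym e)
pathColour-step zero    (suc i) a b e = flip b (odd (suc i)) (toXY-inj e)
  where flip : ∀ b c → b xor c ≢ b xor not c
        flip true  true  ()
        flip true  false ()
        flip false true  ()
        flip false false ()
pathColour-step (suc zero)    zero    a b e = toXY≢S e
pathColour-step (suc (suc s)) zero    a b e = not-≢ a (toXY-inj e)
pathColour-step (suc s)       (suc i) a b = pathColour-step s i (not a) (not b)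

pathColour-S : ∀ s i a b → pathColour s i a b ≡ S → i ≡ s
pathColour-S zero    zero    a b e = refl
pathColour-S zero    (suc i) a b e = ⊥-elim (toXY≢S {b xor odd (suc i)} e)
pathColour-S (suc s) zero    a b e = ⊥-elim (toXY≢S e)
pathColour-S (suc s) (suc i) a b e = cong suc (pathColour-S s i (not a) (not b) e)

pathColour-after : ∀ s i a b → s < i → pathColour s i a b ≡ toXY (b xor odd i)
pathColour-after zero    (suc i) a b _ = refl
pathColour-after (suc s) (suc i) a b (s≤s lt) = trans (pathColour-after s i (not a) (not b) lt) (cong toXY (shift b (odd i)))
  where shift : ∀ b c → not b xor c ≡ b xor not c
        shift true  true  = refl
        shift true  false = refl
        shift false _     = refl

pathColour-at : ∀ s a b → pathColour s s a b ≡ S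
pathColour-at zero    a b = refl
pathColour-at (suc s) a b = pathColour-at s (not a) (not b)

cv-int : ∀ {h} (a b : Fin h) p (f : Fin p → Fin h) j → cv a b p f (suc (toℕ j)) ≡ f j
cv-int a b (suc p) f zero    = refl
cv-int a b (suc p) f (suc j) = cv-int (f zero) b p (λ j → f (suc j)) j

cv-end : ∀ {h} (a b : Fin h) p (f : Fin p → Fin h) → cv a b p f (suc p) ≡ b
cv-end a b zero    f = refl
cv-end a b (suc p) f = cv-end (f zero) b p (λ j → f (suc j))

data Position (p : ℕ) : ℕ → Set where
  start  : Position p 0
  inner  : (j : Fin p) → Position p (suc (toℕ j))
  finish : Position p (suc p)

position : ∀ p i → i ≤ suc p → Position p i
position p zero le = start
position zero (suc zero) (s≤s le) = finish
position (suc p) (suc zero) le = inner zero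
position (suc p) (suc (suc i)) (s≤s le) with position p (suc i) le
... | inner j = inner (suc j)
... | finish  = finish

-- A partner is available only for `x` in `P`. The value of `P x` is passed along with its equation
-- so that a total function can be extracted.
count-relation : ∀ {a} (P Q : Fin a → Bool) (R : Fin a → Fin a → Set) →
  (∀ x → P x ≡ true → ∃ λ y → R x y × Q y ≡ true) → (∀ x x' y → R x y → R x' y → x ≡ x') → count P ≤ count Q
count-relation {a} P Q R total inj = count-injection P Q f Qf f-inj
  where
  choose : ∀ x b → P x ≡ b → Fin a
  choose x true  e = proj₁ (total x e)
  choose x false e = x
  f : Fin a → Fin a
  f x = choose x (P x) refl
  chosen : ∀ x b (e : P x ≡ b) → b ≡ true → R x (choose x b e) × Q (choose x b e) ≡ true
  chosen x true e _ = proj₂ (total x e)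
  Qf : ∀ x → P x ≡ true → Q (f x) ≡ true
  Qf x e = proj₂ (chosen x (P x) refl e)
  f-inj : ∀ x y → P x ≡ true → P y ≡ true → f x ≡ f y → x ≡ y
  f-inj x y e e' q = inj x y (f x) (proj₁ (chosen x (P x) refl e)) (subst (R y) (≡-sym q) (proj₁ (chosen y (P y) refl e')))

degree-one : ∀ {k} (F : Graph k) {u v w} → deg F u ≡ 1 → adj F u v ≡ true → adj F u w ≡ true → v ≡ w
degree-one F {u} {v} {w} d a b with v ≟ w
... | yes e = e
... | no ne = ⊥-elim (<-irrefl refl (≤-trans two (≤-reflexive d)))
  where
  two : 2 ≤ deg F u
  two = ≤-trans (s≤s (∃⇒count>0 (λ z → adj F u z ∧ not (z == v)) (∧-intro b (cong not (≢⇒==-false (λ e → ne (≡-sym e)))))))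
    (≤-trans (+-monoˡ-≤ (count (λ z → adj F u z ∧ not (z == v))) (∃⇒count>0 (λ z → adj F u z ∧ (z == v)) (∧-intro a (==-refl v))))
      (≤-reflexive (≡-sym (count-split (adj F u) (λ z → z == v)))))

module Ballooned {k h} {F : Graph k} {H : Graph h} (ob : OddBallooning F H) where
  open OddBallooning ob

  cyc : Fin k → Fin k → ℕ → Fin h
  cyc u v = cv (φ u) (φ v) (p u v) (int u v)

  cyc-int : ∀ u v j → cyc u v (suc (toℕ j)) ≡ int u v j
  cyc-int u v = cv-int (φ u) (φ v) (p u v) (int u v)

  inner-at : ∀ u v {i} → i < p u v → ∃ λ j → toℕ j ≡ i × cyc u v (suc i) ≡ int u v j
  inner-at u v lt = fromℕ< lt , toℕ-fromℕ< lt , trans (cong (λ i → cyc u v (suc i)) (≡-sym (toℕ-fromℕ< lt))) (cyc-int u v (fromℕ< lt))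

  cyc-end : ∀ u v → cyc u v (suc (p u v)) ≡ φ v
  cyc-end u v = cv-end (φ u) (φ v) (p u v) (int u v)

  path-edge : ∀ {u v} → E F u v → ∀ i → i ≤ p u v → adj H (cyc u v i) (cyc u v (suc i)) ≡ true
  path-edge {u} {v} e i le = Equivalence.from (adj-iff _ _) (u , v , e , inj₂ (inj₂ (i , le , inj₁ (refl , refl))))

  direct-edge : ∀ {u v} → E F u v → adj H (φ u) (φ v) ≡ true
  direct-edge {u} {v} e = Equivalence.from (adj-iff _ _) (u , v , e , inj₁ (refl , refl))

  inner-position : ∀ {u v u' v'} (j : Fin (p u v)) i → E F u v → E F u' v' → i ≤ suc (p u' v') → int u v j ≡ cyc u' v' i →
    u ≡ u' × v ≡ v' × i ≡ suc (toℕ j)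
  inner-position {u} {v} {u'} {v'} j i e e' le q with position (p u' v') i le
  ... | start   = ⊥-elim (int-fresh u v j u' e q)
  ... | finish  = ⊥-elim (int-fresh u v j v' e (trans q (cyc-end u' v')))
  ... | inner j' with int-inj u v u' v' j j' e e' (trans q (cyc-int u' v' j'))
  ...   | a , b , c = a , b , cong suc (≡-sym c)

  -- New vertices are fresh and belong to one cycle, so an interior vertex sees only its two
  -- neighbours on the path.
  inner-neighbour : ∀ {u v} (j : Fin (p u v)) y → E F u v → adj H (int u v j) y ≡ true →
    y ≡ cyc u v (toℕ j) ⊎ y ≡ cyc u v (suc (suc (toℕ j)))
  inner-neighbour {u} {v} j y e a with Equivalence.to (adj-iff _ _) a
  ... | u' , v' , e' , inj₁ (q , _) = ⊥-elim (int-fresh u v j u' e q)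
  ... | u' , v' , e' , inj₂ (inj₁ (q , _)) = ⊥-elim (int-fresh u v j v' e q)
  ... | u' , v' , e' , inj₂ (inj₂ (i , le , inj₁ (q , r))) with inner-position j i e e' (≤-trans le (n≤1+n _)) q
  ...   | refl , refl , refl = inj₂ r
  inner-neighbour {u} {v} j y e a | u' , v' , e' , inj₂ (inj₂ (i , le , inj₂ (r , q))) with inner-position j (suc i) e e' (s≤s le) q
  ...   | refl , refl , refl = inj₁ r

  -- An edge of `F` is stored with its smaller end first, so `w` meets its cycles from either end:
  -- `first` is the next vertex on a path that starts at `w`, `final` the previous one on a path
  -- that ends there.
  data OldNeighbour (w : Fin k) (y : Fin h) : Set where
    forward  : ∀ {v} → E F w v → y ≡ φ v → OldNeighbour w y
    backward : ∀ {u} → E F u w → y ≡ φ u → OldNeighbour w y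
    first    : ∀ {v} → E F w v → (j : Fin (p w v)) → toℕ j ≡ 0 → y ≡ int w v j → OldNeighbour w y
    final    : ∀ {u} → E F u w → (j : Fin (p u w)) → suc (toℕ j) ≡ p u w → y ≡ int u w j → OldNeighbour w y

  last-inner : ∀ {u v} → E F u v → ∃ λ r → p u v ≡ suc r
  last-inner e = _ , proj₂ (p-odd _ _ e)

  old-neighbour : ∀ w y → adj H (φ w) y ≡ true → OldNeighbour w y
  old-neighbour w y a with Equivalence.to (adj-iff _ _) a
  ... | u , v , e , inj₁ (q , r) with φ-inj w u q
  ...   | refl = forward e r
  old-neighbour w y a | u , v , e , inj₂ (inj₁ (q , r)) with φ-inj w v q
  ...   | refl = backward e r
  old-neighbour w y a | u , v , e , inj₂ (inj₂ (i , le , inj₁ (q , r))) with position (p u v) i (≤-trans le (n≤1+n _))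
  ... | inner j = ⊥-elim (int-fresh u v j w e (≡-sym (trans q (cyc-int u v j))))
  ... | finish  = ⊥-elim (<-irrefl refl le)
  ... | start with φ-inj w u q | last-inner e
  ...   | refl | _ , ep with inner-at u v {0} (subst (0 <_) (≡-sym ep) (s≤s z≤n))
  ...     | j , tj , qj = first e j tj (trans r qj)
  old-neighbour w y a | u , v , e , inj₂ (inj₂ (i , le , inj₂ (r , q))) with position (p u v) (suc i) (s≤s le)
  ... | inner j = ⊥-elim (int-fresh u v j w e (≡-sym (trans q (cyc-int u v j))))
  ... | finish with φ-inj w v (trans q (cyc-end u v)) | last-inner e
  ...   | refl | i' , ep with inner-at u v {i'} (subst (i' <_) (≡-sym ep) ≤-refl)
  ...     | j , tj , qj = final e j (trans (cong suc tj) (≡-sym ep)) (trans r (trans (cong (cyc u v) ep) qj))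

-- Each replacing cycle receives exactly one S-vertex: its end in `T` if it has one, an interior
-- vertex otherwise. In the second case the cycle must be longer than a triangle, and `c` must
-- separate the two ends because they are adjacent.
module BallooningColouring {k h} {F : Graph k} {H : Graph h} (ob : OddBallooning F H) (T c : Fin k → Bool)
  (indep : ∀ u v → E F u v → T u ≡ true → T v ≡ true → ⊥)
  (uncovered : ∀ u v → E F u v → T u ≡ false → T v ≡ false → OddBallooning.p ob u v ≢ 1 × c u ≢ c v) where
  open OddBallooning ob
  open Ballooned ob

  base : Fin k → Fin 3
  base w = if T w then S else toXY (c w)

  -- The path position of the S-vertex. On an uncovered edge it is 2: there `p` is at least 3, so
  -- positions 1 and 3 are interior and the S-vertex is adjacent to no vertex of `F`.
  spot : Fin k → Fin k → ℕ
  spot u v = if T u then 0 else if T v then suc (p u v) else 2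

  track : Fin k → Fin k → ℕ → Fin 3
  track u v i = pathColour (spot u v) i (c u) (c v)

  long : ∀ {u v} → E F u v → p u v ≢ 1 → 3 ≤ p u v
  long {u} {v} e ne with p-odd u v e
  ... | zero  , q = ⊥-elim (ne q)
  ... | suc r , q = ≤-trans (s≤s (s≤s (≤-trans (s≤s z≤n) (m≤n+m (suc (r + 0)) r)))) (≤-reflexive (≡-sym q))

  odd-end : ∀ {u v} → E F u v → odd (suc (p u v)) ≡ false
  odd-end {u} {v} e with p-odd u v e
  ... | r , q = trans (cong (λ i → odd (suc i)) q) (odd-of-even r)

  track-start : ∀ {u v} → track u v 0 ≡ base u
  track-start {u} {v} with T u | T v
  ... | true  | _     = refl
  ... | false | true  = refl
  ... | false | false = refl

  track-after : ∀ {u v} → E F u v → spot u v < suc (p u v) → track u v (suc (p u v)) ≡ toXY (c v)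
  track-after {u} {v} e lt = trans (pathColour-after (spot u v) (suc (p u v)) (c u) (c v) lt)
    (cong toXY (trans (cong (c v xor_) (odd-end e)) (xor-identityʳ (c v))))

  spot-T : ∀ {u v} → T u ≡ true → spot u v ≡ 0
  spot-T {u} t rewrite t = refl

  spot-T' : ∀ {u v} → T u ≡ false → T v ≡ true → spot u v ≡ suc (p u v)
  spot-T' t t' rewrite t | t' = refl

  spot-open : ∀ {u v} → T u ≡ false → T v ≡ false → spot u v ≡ 2
  spot-open t t' rewrite t | t' = refl

  base-S : ∀ {w} → T w ≡ true → base w ≡ S
  base-S t rewrite t = refl

  base-XY : ∀ {w} → T w ≡ false → base w ≡ toXY (c w)
  base-XY t rewrite t = refl

  track-end : ∀ {u v} → E F u v → track u v (suc (p u v)) ≡ base v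
  track-end {u} {v} e with bool-cases (T u) | bool-cases (T v)
  ... | inj₁ t | inj₁ t' = ⊥-elim (indep u v e t t')
  ... | inj₁ t | inj₂ t' = trans (track-after e (≤-trans (≤-reflexive (cong suc (spot-T {u} {v} t))) (s≤s z≤n))) (≡-sym (base-XY t'))
  ... | inj₂ t | inj₁ t' = trans (trans (cong (λ s → pathColour s (suc (p u v)) (c u) (c v)) (spot-T' t t')) (pathColour-at (suc (p u v)) (c u) (c v))) (≡-sym (base-S t'))
  ... | inj₂ t | inj₂ t' = trans (track-after e (≤-trans (≤-reflexive (cong suc (spot-open t t'))) (≤-trans (long e (proj₁ (uncovered u v e t t'))) (n≤1+n _)))) (≡-sym (base-XY t'))

  Location : Fin h → Set
  Location x = (∃ λ w → φ w ≡ x) ⊎ (∃ λ u → ∃ λ v → E F u v × ∃ λ (j : Fin (p u v)) → int u v j ≡ x)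

  tint : ∀ {x} → Location x → Fin 3
  tint (inj₁ (w , _)) = base w
  tint (inj₂ (u , v , _ , j , _)) = track u v (suc (toℕ j))

  colour : Fin h → Fin 3
  colour x = tint (cover x)

  colour-φ : ∀ w → colour (φ w) ≡ base w
  colour-φ w with cover (φ w)
  ... | inj₁ (w' , q) = cong base (φ-inj w' w q)
  ... | inj₂ (u , v , e , j , q) = ⊥-elim (int-fresh u v j w e q)

  colour-int : ∀ {u v} → E F u v → ∀ j → colour (int u v j) ≡ track u v (suc (toℕ j))
  colour-int {u} {v} e j with cover (int u v j)
  ... | inj₁ (w' , q) = ⊥-elim (int-fresh u v j w' e (≡-sym q))
  ... | inj₂ (u' , v' , e' , j' , q) with int-inj u' v' u v j' j e' e q
  ...   | refl , refl , r = cong (λ i → track u v (suc i)) r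

  colour-cyc : ∀ {u v} → E F u v → ∀ i → i ≤ suc (p u v) → colour (cyc u v i) ≡ track u v i
  colour-cyc {u} {v} e i le with position (p u v) i le
  ... | start   = trans (colour-φ u) (≡-sym (track-start {u} {v}))
  ... | inner j = trans (cong colour (cyc-int u v j)) (colour-int e j)
  ... | finish  = trans (trans (cong colour (cyc-end u v)) (colour-φ v)) (≡-sym (track-end e))

  step-≢ : ∀ {u v} → E F u v → ∀ i → i ≤ p u v → colour (cyc u v i) ≢ colour (cyc u v (suc i))
  step-≢ {u} {v} e i le q = pathColour-step (spot u v) i (c u) (c v)
    (trans (≡-sym (colour-cyc e i (≤-trans le (n≤1+n _)))) (trans q (colour-cyc e (suc i) (s≤s le))))

  base-≢ : ∀ {u v} → E F u v → base u ≢ base v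
  base-≢ {u} {v} e q with bool-cases (T u) | bool-cases (T v)
  ... | inj₁ t | inj₁ t' = indep u v e t t'
  ... | inj₁ t | inj₂ t' = toXY≢S (trans (≡-sym (base-XY t')) (trans (≡-sym q) (base-S t)))
  ... | inj₂ t | inj₁ t' = toXY≢S (trans (≡-sym (base-XY t)) (trans q (base-S t')))
  ... | inj₂ t | inj₂ t' = proj₂ (uncovered u v e t t') (toXY-inj (trans (≡-sym (base-XY t)) (trans q (base-XY t'))))

  proper : Proper H colour
  proper x y a q with Equivalence.to (adj-iff x y) a
  ... | u , v , e , inj₁ (refl , refl) = base-≢ e (trans (≡-sym (colour-φ u)) (trans q (colour-φ v)))
  ... | u , v , e , inj₂ (inj₁ (refl , refl)) = base-≢ e (trans (≡-sym (colour-φ u)) (trans (≡-sym q) (colour-φ v)))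
  ... | u , v , e , inj₂ (inj₂ (i , le , inj₁ (refl , refl))) = step-≢ e i le q
  ... | u , v , e , inj₂ (inj₂ (i , le , inj₂ (refl , refl))) = step-≢ e i le (≡-sym q)

  S-position : ∀ {u v} → E F u v → ∀ i → i ≤ suc (p u v) → colour (cyc u v i) ≡ S → i ≡ spot u v
  S-position {u} {v} e i le q = pathColour-S (spot u v) i (c u) (c v) (trans (≡-sym (colour-cyc e i le)) q)

  -- Both neighbours of an interior vertex lie on its own cycle, which carries S at a single
  -- position.
  inner-S-unique : ∀ {u v} → E F u v → ∀ j s t → adj H s (int u v j) ≡ true → adj H t (int u v j) ≡ true →
    colour s ≡ S → colour t ≡ S → s ≡ t
  inner-S-unique {u} {v} e j s t a b cs ct = trans (≡-sym (proj₂ (at s a cs))) (trans (cong (cyc u v) (trans (proj₁ (proj₂ (proj₁ (at s a cs)))) (≡-sym (proj₁ (proj₂ (proj₁ (at t b ct))))))) (proj₂ (at t b ct)))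
    where
    at : ∀ y → adj H y (int u v j) ≡ true → colour y ≡ S → Σ (Σ ℕ λ i → i ≡ spot u v × i ≤ suc (p u v)) λ { (i , _) → cyc u v i ≡ y }
    at y a cy with inner-neighbour j y e (adj-sym H a)
    ... | inj₁ refl = (toℕ j , S-position e (toℕ j) le cy , le) , refl
      where le : toℕ j ≤ suc (p u v)
            le = ≤-trans (<⇒≤ (toℕ<n j)) (n≤1+n _)
    ... | inj₂ refl = (suc (suc (toℕ j)) , S-position e (suc (suc (toℕ j))) le cy , le) , refl
      where le : suc (suc (toℕ j)) ≤ suc (p u v)
            le = s≤s (toℕ<n j)

  data IsS (x : Fin h) : Set where
    old   : ∀ w → T w ≡ true → x ≡ φ w → IsS x
    inner : ∀ u v → E F u v → T u ≡ false → T v ≡ false → (j : Fin (p u v)) → toℕ j ≡ 1 → x ≡ int u v j → IsS x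

  locate-S : ∀ x → colour x ≡ S → IsS x
  locate-S x q with cover x in eq
  ... | inj₁ (w , refl) with bool-cases (T w)
  ...   | inj₁ t = old w t refl
  ...   | inj₂ t = ⊥-elim (toXY≢S (trans (≡-sym (base-XY t)) q))
  locate-S x q | inj₂ (u , v , e , j , refl) with bool-cases (T u) | bool-cases (T v) | pathColour-S (spot u v) (suc (toℕ j)) (c u) (c v) q
  ...   | inj₁ t | _ | r with trans r (spot-T {u} {v} t)
  ...     | ()
  locate-S x q | inj₂ (u , v , e , j , refl) | inj₂ t | inj₁ t' | r = ⊥-elim (<-irrefl (suc-injective (trans r (spot-T' t t'))) (toℕ<n j))
  locate-S x q | inj₂ (u , v , e , j , refl) | inj₂ t | inj₂ t' | r = inner u v e t t' j (suc-injective (trans r (spot-open t t'))) refl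

-- The two colourings of a good odd-ballooning.

≡ᵇ-sound : ∀ {a b} → (a ≡ᵇ b) ≡ true → a ≡ b
≡ᵇ-sound {zero}  {zero}  _ = refl
≡ᵇ-sound {suc a} {suc b} e = cong suc (≡ᵇ-sound e)

≡ᵇ-complete : ∀ {a b} → a ≡ b → (a ≡ᵇ b) ≡ true
≡ᵇ-complete {zero}  refl = refl
≡ᵇ-complete {suc a} refl = ≡ᵇ-complete {a} refl

-- The S-X edges form a matching, so they can be laid on a matching of `G` inside one part; no
-- vertex there has to meet two requirements.
record MatchingColouring {h} (H : Graph h) : Set where
  field
    col      : Fin h → Fin 3
    proper   : Proper H col
    S-unique : ∀ x s t → col x ≡ X → col s ≡ S → col t ≡ S → adj H s x ≡ true → adj H t x ≡ true → s ≡ t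
    X-unique : ∀ s x y → col s ≡ S → col x ≡ X → col y ≡ X → adj H s x ≡ true → adj H s y ≡ true → x ≡ y

-- The vertex `s` can be placed where only one large neighbourhood is known: its X-neighbours have
-- no other S-vertex to respect.
record SpecialColouring {h} (H : Graph h) (q : ℕ) : Set where
  field
    col     : Fin h → Fin 3
    proper  : Proper H col
    small   : size col S ≤ q
    s       : Fin h
    s-S     : col s ≡ S
    private-leaves : ∀ x t → col x ≡ X → col t ≡ S → adj H s x ≡ true → adj H t x ≡ true → t ≡ s

module _ {k h} {F : Graph k} {side : Fin k → Bool} (bip : BipartiteAB F side) {H : Graph h} (ob : OddBallooning F H) (good : Good F side ob) where
  open OddBallooning ob
  open Ballooned ob

  sides-differ : ∀ {u v} → adj F u v ≡ true → side u ≡ true → side v ≡ true → ⊥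
  sides-differ {u} {v} a su sv = proj₁ bip u v a (trans su (≡-sym sv))

  leaf : Fin k → Bool
  leaf w = side w ∧ (deg F w ≡ᵇ 1)

  leaf-side : ∀ {w} → leaf w ≡ true → side w ≡ true
  leaf-side {w} e = proj₁ (∧-elim (side w) e)

  leaf-degree : ∀ {w} → leaf w ≡ true → deg F w ≡ 1
  leaf-degree {w} e = ≡ᵇ-sound (proj₂ (∧-elim (side w) e))

  triangle-leaf : ∀ {u v} → E F u v → p u v ≡ 1 → leaf u ≡ true ⊎ leaf v ≡ true
  triangle-leaf {u} {v} e q with good u v e q
  ... | inj₁ (s , d) = inj₁ (∧-intro s (≡ᵇ-complete d))
  ... | inj₂ (s , d) = inj₂ (∧-intro s (≡ᵇ-complete d))

  -- Leaves in B take S, other vertices of B take X, A takes Y. An interior S-vertex has one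
  -- X-neighbour because `side` differs at the ends of its edge; a leaf lies on one cycle and its
  -- neighbour in A is Y. A vertex of `F` coloured X has no S-neighbour at all, since the S-vertices
  -- of its cycles sit at position 2 of paths with at least three interior vertices. Goodness
  -- ensures that every cycle without a leaf of B has that length.
  matchingColouring : MatchingColouring H
  matchingColouring = record { col = colour ; proper = proper ; S-unique = S-unique ; X-unique = X-unique }
    where
    indep : ∀ u v → E F u v → leaf u ≡ true → leaf v ≡ true → ⊥
    indep u v (_ , a) l l' = sides-differ a (leaf-side l) (leaf-side l')
    uncovered : ∀ u v → E F u v → leaf u ≡ false → leaf v ≡ false → p u v ≢ 1 × side u ≢ side v
    uncovered u v e l l' = (λ q → case triangle-leaf e q of λ { (inj₁ t) → false≢true l t ; (inj₂ t) → false≢true l' t }) , proj₁ bip u v (proj₂ e)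
    open BallooningColouring ob leaf side indep uncovered
    X-side : ∀ w → base w ≡ X → side w ≡ true
    X-side w q with leaf w
    X-side w () | true
    ... | false = toXY-inj q
    S-leaf : ∀ w → base w ≡ S → leaf w ≡ true
    S-leaf w q with leaf w
    ... | true  = refl
    ... | false = ⊥-elim (toXY≢S q)
    inner-S : ∀ {u v} → E F u v → (j : Fin (p u v)) → colour (int u v j) ≡ S → toℕ j ≡ 1 × 3 ≤ p u v
    inner-S {u} {v} e j q with locate-S (int u v j) q
    ... | old w _ r = ⊥-elim (int-fresh u v j w e r)
    ... | inner u' v' e' t t' j' r q' with int-inj u v u' v' j j' e e' q'
    ...   | refl , refl , r' = trans r' r , long e (proj₁ (uncovered u v e t t'))
    no-S : ∀ w t → base w ≡ X → colour t ≡ S → adj H (φ w) t ≡ true → ⊥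
    no-S w t cw ct a with old-neighbour w t a
    ... | forward {v} e refl  = sides-differ (proj₂ e) (X-side w cw) (leaf-side (S-leaf v (trans (≡-sym (colour-φ v)) ct)))
    ... | backward {u} e refl = sides-differ (proj₂ e) (leaf-side (S-leaf u (trans (≡-sym (colour-φ u)) ct))) (X-side w cw)
    ... | first e j z refl    = 0≢1 (trans (≡-sym z) (proj₁ (inner-S e j ct)))
      where 0≢1 : 0 ≢ 1
            0≢1 ()
    ... | final e j z refl with inner-S e j ct
    ...   | r , l = <-irrefl refl (≤-trans l (≤-reflexive (trans (≡-sym z) (cong suc r))))
    S-unique : ∀ x s t → colour x ≡ X → colour s ≡ S → colour t ≡ S → adj H s x ≡ true → adj H t x ≡ true → s ≡ t
    S-unique x s t cx cs ct a b with cover x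
    ... | inj₁ (w , refl) = ⊥-elim (no-S w s cx cs (adj-sym H a))
    ... | inj₂ (u , v , e , j , refl) = inner-S-unique e j s t a b cs ct
    no-X : ∀ {w v} → leaf w ≡ true → adj F w v ≡ true → colour (φ v) ≡ X → ⊥
    no-X {w} {v} l a q = sides-differ a (leaf-side l) (X-side v (trans (≡-sym (colour-φ v)) q))
    order : ∀ {u w v} → leaf w ≡ true → E F u w → E F w v → ⊥
    order {u} {w} {v} l (lt , a) (lt' , b) with degree-one F (leaf-degree l) (adj-sym F a) b
    ... | refl = <-asym lt lt'
    old-X : ∀ w x y → leaf w ≡ true → colour x ≡ X → colour y ≡ X → OldNeighbour w x → OldNeighbour w y → x ≡ y
    old-X w x y l cx cy (forward e refl) _ = ⊥-elim (no-X l (proj₂ e) cx)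
    old-X w x y l cx cy (backward e refl) _ = ⊥-elim (no-X l (adj-sym F (proj₂ e)) cx)
    old-X w x y l cx cy (first _ _ _ _) (forward e refl) = ⊥-elim (no-X l (proj₂ e) cy)
    old-X w x y l cx cy (first _ _ _ _) (backward e refl) = ⊥-elim (no-X l (adj-sym F (proj₂ e)) cy)
    old-X w x y l cx cy (final _ _ _ _) (forward e refl) = ⊥-elim (no-X l (proj₂ e) cy)
    old-X w x y l cx cy (final _ _ _ _) (backward e refl) = ⊥-elim (no-X l (adj-sym F (proj₂ e)) cy)
    old-X w x y l cx cy (first e j z refl) (first e' j' z' refl) with degree-one F (leaf-degree l) (proj₂ e) (proj₂ e')
    ... | refl = cong (int w _) (toℕ-injective (trans z (≡-sym z')))
    old-X w x y l cx cy (final e j z refl) (final e' j' z' refl) with degree-one F (leaf-degree l) (adj-sym F (proj₂ e)) (adj-sym F (proj₂ e'))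
    ... | refl = cong (int _ w) (toℕ-injective (suc-injective (trans z (≡-sym z'))))
    old-X w x y l cx cy (first e _ _ _) (final e' _ _ _) = ⊥-elim (order l e' e)
    old-X w x y l cx cy (final e _ _ _) (first e' _ _ _) = ⊥-elim (order l e e')
    both-sides : ∀ a b → toXY (not a) ≡ X → toXY (not b) ≡ X → a ≡ b
    both-sides false false _ _ = refl
    both-sides true  _ () _
    both-sides false true _ ()
    X-unique : ∀ s x y → colour s ≡ S → colour x ≡ X → colour y ≡ X → adj H s x ≡ true → adj H s y ≡ true → x ≡ y
    X-unique s x y cs cx cy a b with locate-S s cs
    ... | old w l refl = old-X w x y l cx cy (old-neighbour w x a) (old-neighbour w y b)
    ... | inner u v e t t' j r refl = meet cx cy (inner-neighbour j x e a) (inner-neighbour j y e b)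
      where
      -- Position 1 has the colour opposite to `side u` and position 3 the colour opposite to
      -- `side v`, so exactly one of them is X.
      c₁ : colour (cyc u v (toℕ j)) ≡ X → toXY (not (side u)) ≡ X
      c₁ q = trans (≡-sym (trans (colour-cyc e (toℕ j) (≤-trans (<⇒≤ (toℕ<n j)) (n≤1+n _)))
        (trans (cong (track u v) r) (cong (λ s → pathColour s 1 (side u) (side v)) (spot-open t t'))))) q
      xor-true : ∀ b → (not (not b) xor true) ≡ not b
      xor-true true  = refl
      xor-true false = refl
      c₃ : colour (cyc u v (suc (suc (toℕ j)))) ≡ X → toXY (not (side v)) ≡ X
      c₃ q = trans (≡-sym (trans (colour-cyc e (suc (suc (toℕ j))) (s≤s (toℕ<n j)))
        (trans (cong (λ i → track u v (suc (suc i))) r) (trans (cong (λ s → pathColour s 3 (side u) (side v)) (spot-open t t')) (cong toXY (xor-true (side v))))))) q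
      clash : colour (cyc u v (toℕ j)) ≡ X → colour (cyc u v (suc (suc (toℕ j)))) ≡ X → ⊥
      clash q q' = proj₂ (uncovered u v e t t') (both-sides _ _ (c₁ q) (c₃ q'))
      meet : ∀ {x y} → colour x ≡ X → colour y ≡ X → x ≡ cyc u v (toℕ j) ⊎ x ≡ cyc u v (suc (suc (toℕ j))) →
        y ≡ cyc u v (toℕ j) ⊎ y ≡ cyc u v (suc (suc (toℕ j))) → x ≡ y
      meet _  _  (inj₁ refl) (inj₁ refl) = refl
      meet cx cy (inj₁ refl) (inj₂ refl) = ⊥-elim (clash cx cy)
      meet cx cy (inj₂ refl) (inj₁ refl) = ⊥-elim (clash cy cx)
      meet _  _  (inj₂ refl) (inj₂ refl) = refl

no-S⇒Bipartite : ∀ {h} (H : Graph h) (col : Fin h → Fin 3) → Proper H col → (∀ x → (col x == S) ≡ false) → Bipartite H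
no-S⇒Bipartite H col proper none = (λ x → col x == X) , λ x y a q → proper x y a (same (col x) (col y) (none x) (none y) q)
  where
  same : ∀ (a b : Fin 3) → (a == S) ≡ false → (b == S) ≡ false → (a == X) ≡ (b == X) → a ≡ b
  same X X _ _ _ = refl
  same Y Y _ _ _ = refl
  same S _ () _ _
  same X S _ () _
  same Y S _ () _
  same X Y _ _ ()
  same Y X _ _ ()

alternating : ∀ (g : ℕ → Bool) n → (∀ i → i < n → g (suc i) ≡ not (g i)) → g n ≡ g 0 xor odd n
alternating g zero    step = ≡-sym (xor-identityʳ (g 0))
alternating g (suc n) step = trans (step n ≤-refl) (trans (cong not (alternating g n (λ i lt → step i (≤-trans lt (n≤1+n n))))) (x (g 0) (odd n)))
  where x : ∀ a b → not (a xor b) ≡ a xor not b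
        x true  true  = refl
        x true  false = refl
        x false b     = refl

module _ {k h} {F : Graph k} {side : Fin k → Bool} (bip : BipartiteAB F side) {H : Graph h} (ob : OddBallooning F H) (good : Good F side ob)
  (col₀ : Fin h → Fin 3) (proper₀ : Proper H col₀) where
  open OddBallooning ob
  open Ballooned ob

  -- Without S the path would alternate between X and Y. Its length `p + 1` is even, so its adjacent
  -- ends would have the same colour.
  cycle-meets-S : ∀ {u v} → E F u v → col₀ (φ u) ≢ S → col₀ (φ v) ≢ S → ∃ λ j → col₀ (int u v j) ≡ S
  cycle-meets-S {u} {v} e nu nv with find (λ j → col₀ (int u v j) == S)
  ... | inj₁ (j , q) = j , ==-sound q
  ... | inj₂ none = ⊥-elim (proper₀ _ _ (direct-edge e) (≡X-inj nu nv (trans (≡-sym (xor-identityʳ (g 0))) (trans (cong (g 0 xor_) (≡-sym ends)) (trans (≡-sym alt) (cong (λ y → col₀ y == X) (cyc-end u v)))))))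
    where
    g : ℕ → Bool
    g i = col₀ (cyc u v i) == X
    nonS : ∀ i → i ≤ suc (p u v) → col₀ (cyc u v i) ≢ S
    nonS i le q with position (p u v) i le
    ... | start   = nu q
    ... | inner j = ==-false (none j) (trans (cong col₀ (≡-sym (cyc-int u v j))) q)
    ... | finish  = nv (trans (cong col₀ (≡-sym (cyc-end u v))) q)
    opposite : ∀ (a b : Fin 3) → a ≢ S → b ≢ S → a ≢ b → (b == X) ≡ not (a == X)
    opposite S _ na _ _ = ⊥-elim (na refl)
    opposite _ S _ nb _ = ⊥-elim (nb refl)
    opposite X X _ _ ne = ⊥-elim (ne refl)
    opposite X Y _ _ _  = refl
    opposite Y X _ _ _  = refl
    opposite Y Y _ _ ne = ⊥-elim (ne refl)
    ≡X-inj : ∀ {a b : Fin 3} → a ≢ S → b ≢ S → (a == X) ≡ (b == X) → a ≡ b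
    ≡X-inj {S} na _ _ = ⊥-elim (na refl)
    ≡X-inj {X} {S} _ nb _ = ⊥-elim (nb refl)
    ≡X-inj {Y} {S} _ nb _ = ⊥-elim (nb refl)
    ≡X-inj {X} {X} _ _ _ = refl
    ≡X-inj {X} {Y} _ _ ()
    ≡X-inj {Y} {X} _ _ ()
    ≡X-inj {Y} {Y} _ _ _ = refl
    alt : g (suc (p u v)) ≡ g 0 xor odd (suc (p u v))
    alt = alternating g (suc (p u v)) (λ i lt → opposite _ _ (nonS i (<⇒≤ lt)) (nonS (suc i) lt) (proper₀ _ _ (path-edge e i (s≤s⁻¹ lt))))
    ends : odd (suc (p u v)) ≡ false
    ends with p-odd u v e
    ... | r , q = trans (cong (λ i → odd (suc i)) q) (odd-of-even r)

  -- `L` consists of the leaves in B whose neighbour lies outside `T₀`. Their cycles may be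
  -- triangles, too short for an S-vertex at position 2, so such a leaf takes the colour S itself.
  T₀ L T : Fin k → Bool
  T₀ w = col₀ (φ w) == S
  L w = leaf bip ob good w ∧ all (λ a → adj F w a ⇒ᵇ not (T₀ a))
  T w = T₀ w ∨ L w

  T-cases : ∀ {w} → T w ≡ true → T₀ w ≡ true ⊎ L w ≡ true
  T-cases {w} t with T₀ w
  ... | true  = inj₁ refl
  ... | false = inj₂ t

  T-false : ∀ {w} → T w ≡ false → T₀ w ≡ false × L w ≡ false
  T-false {w} t with T₀ w
  ... | false = refl , t

  L-leaf : ∀ {w} → L w ≡ true → leaf bip ob good w ≡ true
  L-leaf {w} l = proj₁ (∧-elim (leaf bip ob good w) l)

  L-side : ∀ {w} → L w ≡ true → side w ≡ true
  L-side l = leaf-side bip ob good (L-leaf l)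

  L-neighbour : ∀ {w a} → L w ≡ true → adj F w a ≡ true → T₀ a ≡ false
  L-neighbour {w} {a} l e = not-elim (⇒ᵇ-elim {adj F w a} (all-elim _ (proj₂ (∧-elim (leaf bip ob good w) l)) a) e)

  L-intro : ∀ {w a} → leaf bip ob good w ≡ true → adj F w a ≡ true → T₀ a ≡ false → L w ≡ true
  L-intro {w} {a} l e t = ∧-intro l (all-intro _ (λ b → ⇒ᵇ-intro (adj F w b) (λ e' →
    cong not (subst (λ z → T₀ z ≡ false) (degree-one F (leaf-degree bip ob good l) e e') t))))

  T-indep : ∀ u v → E F u v → T u ≡ true → T v ≡ true → ⊥
  T-indep u v e tu tv with T-cases {u} tu | T-cases {v} tv
  ... | inj₁ a | inj₁ b = proper₀ _ _ (direct-edge e) (trans (==-sound a) (≡-sym (==-sound b)))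
  ... | inj₁ a | inj₂ b = false≢true (L-neighbour b (adj-sym F (proj₂ e))) a
  ... | inj₂ a | inj₁ b = false≢true (L-neighbour a (proj₂ e)) b
  ... | inj₂ a | inj₂ b = sides-differ bip ob good (proj₂ e) (L-side a) (L-side b)

  T-long : ∀ u v → E F u v → T u ≡ false → T v ≡ false → p u v ≢ 1
  T-long u v e tu tv q with triangle-leaf bip ob good e q
  ... | inj₁ l = false≢true (proj₂ (T-false {u} tu)) (L-intro l (proj₂ e) (proj₁ (T-false {v} tv)))
  ... | inj₂ l = false≢true (proj₂ (T-false {v} tv)) (L-intro l (adj-sym F (proj₂ e)) (proj₁ (T-false {u} tu)))

  module _ (c : Fin k → Bool) (differ : ∀ u v → E F u v → T u ≡ false → T v ≡ false → c u ≢ c v) where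
    open BallooningColouring ob T c T-indep (λ u v e t t' → T-long u v e t t' , differ u v e t t')

    data Owner (u v : Fin k) (x : Fin h) : Set where
      interior : T u ≡ false → T v ≡ false → (j : Fin (p u v)) → toℕ j ≡ 1 → x ≡ int u v j → Owner u v x
      atLeft   : L u ≡ true → x ≡ φ u → Owner u v x
      atRight  : L v ≡ true → x ≡ φ v → Owner u v x

    -- Charges a new S-vertex to an old one: a vertex of `T₀` to itself, any other to an old
    -- S-vertex in the interior of the cycle that it owns. Interiors are disjoint and each cycle has
    -- one owner, so the charging is injective and the class S does not grow.
    data Moved (x y : Fin h) : Set where
      stays  : ∀ w → x ≡ φ w → y ≡ φ w → Moved x y
      along : ∀ {u v} → E F u v → (j : Fin (p u v)) → y ≡ int u v j → Owner u v x → Moved x y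

    owner-unique : ∀ {u v x x'} → E F u v → Owner u v x → Owner u v x' → x ≡ x'
    owner-unique e (interior _ _ j r refl) (interior _ _ j' r' refl) = cong (int _ _) (toℕ-injective (trans r (≡-sym r')))
    owner-unique {u} e (interior t _ _ _ _) (atLeft l _) = false≢true (proj₂ (T-false {u} t)) l
    owner-unique {v = v} e (interior _ t _ _ _) (atRight l _) = false≢true (proj₂ (T-false {v} t)) l
    owner-unique {u} e (atLeft l _) (interior t _ _ _ _) = false≢true (proj₂ (T-false {u} t)) l
    owner-unique e (atLeft _ refl) (atLeft _ refl) = refl
    owner-unique e (atLeft l _) (atRight l' _) = ⊥-elim (sides-differ bip ob good (proj₂ e) (L-side l) (L-side l'))
    owner-unique {v = v} e (atRight l _) (interior _ t _ _ _) = false≢true (proj₂ (T-false {v} t)) l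
    owner-unique e (atRight l _) (atLeft l' _) = ⊥-elim (sides-differ bip ob good (proj₂ e) (L-side l') (L-side l))
    owner-unique e (atRight _ refl) (atRight _ refl) = refl

    moved-injective : ∀ x x' y → Moved x y → Moved x' y → x ≡ x'
    moved-injective x x' y (stays w refl refl) (stays w' refl q) = q
    moved-injective x x' y (stays w _ refl) (along {u} {v} e j q _) = ⊥-elim (int-fresh u v j w e (≡-sym q))
    moved-injective x x' y (along {u} {v} e j refl _) (stays w _ q) = ⊥-elim (int-fresh u v j w e q)
    moved-injective x x' y (along {u} {v} e j refl o) (along {u'} {v'} e' j' q o') with int-inj u v u' v' j j' e e' q
    ... | refl , refl , _ = owner-unique e o o'

    notS : ∀ {w} → T₀ w ≡ false → col₀ (φ w) ≢ S
    notS = ==-false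

    leaf-edge : ∀ {w} → leaf bip ob good w ≡ true → ∃ λ a → adj F w a ≡ true
    leaf-edge {w} l = count>0⇒∃ (adj F w) (≤-reflexive (≡-sym (leaf-degree bip ob good l)))

    relocate : ∀ x → (colour x == S) ≡ true → ∃ λ y → Moved x y × (col₀ y == S) ≡ true
    relocate x q with locate-S x (==-sound q)
    ... | inner u v e t t' j r refl with cycle-meets-S e (notS (proj₁ (T-false {u} t))) (notS (proj₁ (T-false {v} t')))
    ...   | i , si = int u v i , along e i refl (interior t t' j r refl) , ==-complete si
    relocate x q | old w t refl with bool-cases (T₀ w)
    ... | inj₁ t₀ = φ w , stays w refl refl , t₀
    ... | inj₂ t₀ with T-cases {w} t
    ...   | inj₁ t₁ = false≢true t₀ t₁
    ...   | inj₂ l with leaf-edge (L-leaf l)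
    ...     | a , wa with <-cmp (toℕ w) (toℕ a)
    ...       | tri< lt _ _ = case cycle-meets-S (lt , wa) (notS t₀) (notS (L-neighbour l wa)) of λ
                { (i , si) → int w a i , along (lt , wa) i refl (atLeft l refl) , ==-complete si }
    ...       | tri≈ _ eq _ = ⊥-elim (adj⇒≢ F wa (toℕ-injective eq))
    ...       | tri> _ _ gt = case cycle-meets-S (gt , adj-sym F wa) (notS (L-neighbour l wa)) (notS t₀) of λ
                { (i , si) → int a w i , along (gt , adj-sym F wa) i refl (atRight l refl) , ==-complete si }

    relocated-small : size colour S ≤ size col₀ S
    relocated-small = count-relation (λ x → colour x == S) (λ y → col₀ y == S) Moved relocate moved-injective

  openEdge : Fin k → Fin k → Bool
  openEdge u v = (toℕ u <ᵇ toℕ v) ∧ (adj F u v ∧ (not (T u) ∧ not (T v)))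

  -- If some edge of `F` has no end in `T`, the S-vertex inside its cycle serves as `s`, for its
  -- neighbours are interior. Otherwise all of `F` outside `T` can be coloured Y; then every
  -- X-vertex is interior and sees at most one S-vertex, so any S-vertex serves. One exists because
  -- `H` is not bipartite.
  specialColouring : ∀ {q} → size col₀ S ≤ q → ¬ Bipartite H → SpecialColouring H q
  specialColouring {q} small₀ nonbip with find (λ u → 0 <ᵇ count (openEdge u))
  ... | inj₂ none = record
    { col = colour ; proper = proper ; small = ≤-trans (relocated-small (λ _ → false) differ) small₀
    ; s = proj₁ witness ; s-S = proj₂ witness ; private-leaves = leaves }
    where
    differ : ∀ u v → E F u v → T u ≡ false → T v ≡ false → false ≢ false
    differ u v e t t' _ = false≢true (none u) (<ᵇ-complete (∃⇒count>0 (openEdge u) {v}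
      (∧-intro (<ᵇ-complete (proj₁ e)) (∧-intro (proj₂ e) (∧-intro (cong not t) (cong not t'))))))
    open BallooningColouring ob T (λ _ → false) T-indep (λ u v e t t' → T-long u v e t t' , differ u v e t t')
    witness : ∃ λ x → colour x ≡ S
    witness with find (λ x → colour x == S)
    ... | inj₁ (x , e)  = x , ==-sound e
    ... | inj₂ noS = ⊥-elim (nonbip (no-S⇒Bipartite H colour proper noS))
    leaves : ∀ x t → colour x ≡ X → colour t ≡ S → adj H (proj₁ witness) x ≡ true → adj H t x ≡ true → t ≡ proj₁ witness
    leaves x t cx ct a b with cover x
    ... | inj₂ (u , v , e , j , refl) = inner-S-unique e j t (proj₁ witness) b a ct (proj₂ witness)
    ... | inj₁ (w , refl) with T w
    leaves x t () ct a b | inj₁ (w , refl) | true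
    leaves x t () ct a b | inj₁ (w , refl) | false
  specialColouring {q} small₀ nonbip | inj₁ (u , some) with count>0⇒∃ (openEdge u) (<ᵇ-sound some)
  ... | v , o = record
    { col = colour ; proper = proper ; small = ≤-trans (relocated-small side differ) small₀
    ; s = int u v j₁ ; s-S = s-S ; private-leaves = leaves }
    where
    differ : ∀ u v → E F u v → T u ≡ false → T v ≡ false → side u ≢ side v
    differ u v e _ _ = proj₁ bip u v (proj₂ e)
    open BallooningColouring ob T side T-indep (λ u v e t t' → T-long u v e t t' , differ u v e t t')
    o' : adj F u v ∧ (not (T u) ∧ not (T v)) ≡ true
    o' = proj₂ (∧-elim (toℕ u <ᵇ toℕ v) o)
    tu : T u ≡ false
    tu = not-elim (proj₁ (∧-elim (not (T u)) (proj₂ (∧-elim (adj F u v) o'))))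
    tv : T v ≡ false
    tv = not-elim (proj₂ (∧-elim (not (T u)) (proj₂ (∧-elim (adj F u v) o'))))
    e : E F u v
    e = <ᵇ-sound (proj₁ (∧-elim (toℕ u <ᵇ toℕ v) o)) , proj₁ (∧-elim (adj F u v) o')
    p≥3 : 3 ≤ p u v
    p≥3 = long e (T-long u v e tu tv)
    at₁ : ∃ λ j → toℕ j ≡ 1 × cyc u v 2 ≡ int u v j
    at₁ = inner-at u v (≤-trans (s≤s (s≤s z≤n)) p≥3)
    j₁ : Fin (p u v)
    j₁ = proj₁ at₁
    s-S : colour (int u v j₁) ≡ S
    s-S = trans (colour-int e j₁) (trans (cong (λ i → track u v (suc i)) (proj₁ (proj₂ at₁))) (cong (λ s → pathColour s 2 (side u) (side v)) (spot-open tu tv)))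
    is-inner : ∀ x → x ≡ cyc u v (toℕ j₁) ⊎ x ≡ cyc u v (suc (suc (toℕ j₁))) → ∃ λ j → x ≡ int u v j
    is-inner x (inj₁ q) = let j , _ , r = inner-at u v {0} (≤-trans (s≤s z≤n) p≥3) in j , trans q (trans (cong (cyc u v) (proj₁ (proj₂ at₁))) r)
    is-inner x (inj₂ q) = let j , _ , r = inner-at u v {2} p≥3 in j , trans q (trans (cong (λ i → cyc u v (suc (suc i))) (proj₁ (proj₂ at₁))) r)
    leaves : ∀ x t → colour x ≡ X → colour t ≡ S → adj H (int u v j₁) x ≡ true → adj H t x ≡ true → t ≡ int u v j₁
    leaves x t cx ct a b with is-inner x (inner-neighbour j₁ x e a)
    ... | j , refl = inner-S-unique e j t (int u v j₁) b a ct s-S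

-- Parts of an extremal graph

≤-quotient : ∀ L .⦃ _ : NonZero L ⦄ {x n} → L * x ≤ n → x ≤ n / L
≤-quotient L {x} {n} le = ≤-trans (≤-reflexive (≡-sym (trans (cong (_/ L) (*-comm L x)) (m*n/n≡m x L)))) (/-monoˡ-≤ L le)

quotient-≤ : ∀ n L .⦃ _ : NonZero L ⦄ → L * (n / L) ≤ n
quotient-≤ n L = ≤-trans (≤-reflexive (*-comm L (n / L))) (m/n*n≤m n L)

quotient-< : ∀ n L .⦃ _ : NonZero L ⦄ {d} → n / L < d → n ≤ L * d
quotient-< n L {d} lt = ≮⇒≥ λ bad → <⇒≱ lt (≤-quotient L (<⇒≤ bad))

-- `Stable` after division, recording only adjacencies within the core. Vertices outside the core
-- are classified later by their degrees into `coreIn true` and `coreIn false`.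
record Cut {n} (G : Graph n) (δ : ℕ) : Set where
  field
    side core : Fin n → Bool
  coreIn : Bool → Fin n → Bool
  coreIn b v = core v ∧ not (side v xor b)
  coreSize : Bool → ℕ
  coreSize b = count (coreIn b)
  field
    few     : count (λ v → not (core v)) ≤ δ
    within  : ∀ b v → coreIn b v ≡ true → count (λ u → adj G v u ∧ coreIn b u) ≤ δ
    missing : ∀ b v → coreIn b v ≡ true → count (λ u → coreIn (not b) u ∧ not (adj G v u)) ≤ δ
    large   : ∀ b → n ≤ 2 * coreSize b + 3 * δ

stable⇒cut : ∀ {n} {G : Graph n} L .⦃ _ : NonZero L ⦄ → Stable G L → Cut G (n / L)
stable⇒cut {n} {G} L st = record
  { side = c ; core = core ; few = few'
  ; within = λ b v e → ≤-trans (count-mono _ _ (λ u e' → wrong b v u e e')) (bad-few v (proj₁ (∧-elim (core v) e)))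
  ; missing = λ b v e → ≤-trans (count-mono _ _ (λ u e' → absent b v u e e')) (bad-few v (proj₁ (∧-elim (core v) e)))
  ; large = large }
  where
  open Stable st
  few' : count (λ v → not (core v)) ≤ n / L
  few' = ≤-quotient L exceptional-few
  coreIn : Bool → Fin n → Bool
  coreIn b v = core v ∧ not (c v xor b)
  bad-few : ∀ v → core v ≡ true → count (mismatch G c v) ≤ n / L
  bad-few v e = ≤-quotient L (≤ᵇ-sound e)
  xor-t : ∀ x y b → not (x xor b) ≡ true → not (y xor b) ≡ true → true xor (x xor y) ≡ true
  xor-t true  true  _ _ _ = refl
  xor-t false false _ _ _ = refl
  xor-t true  false true _ ()
  xor-t true  false false ()
  xor-t false true  true ()
  xor-t false true  false _ ()
  xor-f : ∀ x y b → not (x xor b) ≡ true → not (y xor not b) ≡ true → false xor (x xor y) ≡ true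
  xor-f true  false _ _ _ = refl
  xor-f false true  _ _ _ = refl
  xor-f true  true true _ ()
  xor-f true  true false ()
  xor-f false false true ()
  xor-f false false false _ ()
  wrong : ∀ b v u → coreIn b v ≡ true → adj G v u ∧ coreIn b u ≡ true → mismatch G c v u ≡ true
  wrong b v u e e' with ∧-elim (adj G v u) e'
  ... | a , f rewrite a = xor-t (c v) (c u) b (proj₂ (∧-elim (core v) e)) (proj₂ (∧-elim (core u) f))
  absent : ∀ b v u → coreIn b v ≡ true → coreIn (not b) u ∧ not (adj G v u) ≡ true → mismatch G c v u ≡ true
  absent b v u e e' with ∧-elim (coreIn (not b) u) e'
  ... | f , a rewrite not-elim a = xor-f (c v) (c u) b (proj₂ (∧-elim (core v) e)) (proj₂ (∧-elim (core u) f))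
  side-core : ∀ b → side-size c b ≤ count (coreIn b) + n / L
  side-core b = ≤-trans (≤-reflexive (count-split (λ v → not (c v xor b)) core)) (+-mono-≤
    (count-mono (λ v → not (c v xor b) ∧ core v) (coreIn b) (λ v e → ∧-intro (proj₂ (∧-elim (not (c v xor b)) e)) (proj₁ (∧-elim (not (c v xor b)) e))))
    (≤-trans (count-mono (λ v → not (c v xor b) ∧ not (core v)) (λ v → not (core v)) (λ v e → proj₂ (∧-elim (not (c v xor b)) e))) few'))
  sides : ∀ b → side-size c b + side-size c (not b) ≡ n
  sides b = trans (cong (side-size c b +_) (count-cong (λ v → not (c v xor not b)) (λ v → not (not (c v xor b))) (λ v → flip (c v) b))) (count-not (λ v → not (c v xor b)))
    where flip : ∀ x b → not (x xor not b) ≡ not (not (x xor b))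
          flip true  true  = refl
          flip true  false = refl
          flip false true  = refl
          flip false false = refl
  gap : ∀ b → side-size c b ≤ side-size c (not b) + n / L
  gap b with ≤-total (side-size c b) (side-size c (not b))
  ... | inj₁ le = ≤-trans le (m≤m+n _ _)
  ... | inj₂ le with m≤n⇒∃[o]m+o≡n le
  ...   | d , q = ≤-trans (≤-reflexive (≡-sym q)) (+-monoʳ-≤ (side-size c (not b)) (≤-quotient L (+-cancelˡ-≤ (L * side-size c (not b)) _ _
            (≤-trans (≤-reflexive (trans (≡-sym (*-distribˡ-+ L (side-size c (not b)) d)) (cong (L *_) q))) (balanced b)))))
  -- Of the three quotients, one is the imbalance of the sides and two pay for exceptional vertices.
  large : ∀ b → n ≤ 2 * count (coreIn b) + 3 * (n / L)
  large b = begin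
    n ≡⟨ ≡-sym (trans (+-comm (side-size c (not b)) (side-size c b)) (sides b)) ⟩
    side-size c (not b) + side-size c b ≤⟨ +-mono-≤ (≤-trans (gap (not b)) (≤-reflexive (cong (λ b' → side-size c b' + n / L) (not-involutive b)))) ≤-refl ⟩
    side-size c b + n / L + side-size c b ≤⟨ +-mono-≤ (+-monoˡ-≤ (n / L) (side-core b)) (side-core b) ⟩
    count (coreIn b) + n / L + n / L + (count (coreIn b) + n / L) ≡⟨ ring (count (coreIn b)) (n / L) ⟩
    2 * count (coreIn b) + 3 * (n / L) ∎
    where
    open ≤-Reasoning
    ring : ∀ a d → a + d + d + (a + d) ≡ 2 * a + 3 * d
    ring = solve-∀

-- A copy of `H` would pull the classes back to a proper colouring whose S-class is no larger than
-- the first part.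
tripartite-free : ∀ {h n q} {H : Graph h} → ((col : Fin h → Fin 3) → Proper H col → q ≤ size col S) →
  (cl : Fin n → Fin 3) → size cl S < q → Free H (tripartite cl)
tripartite-free {H = H} least cl small (f , f-inj , f-edge) =
  <⇒≱ small (≤-trans (least (λ x → cl (f x)) (λ x y a e → false≢true (cong not (==-complete e)) (f-edge x y a)))
    (count-injection (λ x → cl (f x) == S) (λ v → cl v == S) f (λ _ e → e) (λ x y _ _ → f-inj x y)))

degreeSum-lower : ∀ {h n q} {H : Graph h} {G : Graph n} → IsEx n H G → ((col : Fin h → Fin 3) → Proper H col → q ≤ size col S) →
  ∀ a b c → a + b + c ≡ n → a < q → n * n ≤ degreeSum G + (a * a + b * b + c * c)
degreeSum-lower {n = n} {H = H} {G} ex least a b c e a<q with classes n a b c e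
... | cl , refl , refl , refl = ≤-trans (≤-reflexive (≡-sym (across-count cl)))
  (+-monoˡ-≤ _ (extremal-degreeSum {H = H} {G = G} ex (tripartite cl) (tripartite-free {H = H} least cl a<q)))

square-sum-lower : ∀ a b → (a + b) * (a + b) ≤ 2 * (a * a + b * b)
square-sum-lower a b with ≤-total a b
... | inj₁ le with m≤n⇒∃[o]m+o≡n le
...   | d , refl = ≤-trans (m≤m+n _ (d * d)) (≤-reflexive (≡-sym (expand a d)))
  where expand : ∀ a d → 2 * (a * a + (a + d) * (a + d)) ≡ (a + (a + d)) * (a + (a + d)) + d * d
        expand = solve-∀
square-sum-lower a b | inj₂ le with m≤n⇒∃[o]m+o≡n le
...   | d , refl = ≤-trans (m≤m+n _ (d * d)) (≤-reflexive (≡-sym (expand b d)))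
  where expand : ∀ b d → 2 * ((b + d) * (b + d) + b * b) ≡ (b + d + b) * (b + d + b) + d * d
        expand = solve-∀

-- The unit in `balanced` is attained for odd `N`; in `optimal` it disappears by parity.
record Halving (N : ℕ) : Set where
  field
    f c      : ℕ
    total    : f + c ≡ N
    optimal  : ∀ a b → a + b ≡ N → f * f + c * c ≤ a * a + b * b
    balanced : 2 * (f * f + c * c) ≤ N * N + 1

halving : ∀ N → Halving N
halving N with ⌊ N /2⌋ | ⌈ N /2⌉ | ⌊n/2⌋+⌈n/2⌉≡n N | ⌊n/2⌋≤⌈n/2⌉ N | ⌈n/2⌉≤⌊n/2⌋+1 N
  where
  ⌈n/2⌉≤⌊n/2⌋+1 : ∀ n → ⌈ n /2⌉ ≤ suc ⌊ n /2⌋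
  ⌈n/2⌉≤⌊n/2⌋+1 zero          = z≤n
  ⌈n/2⌉≤⌊n/2⌋+1 (suc zero)    = s≤s z≤n
  ⌈n/2⌉≤⌊n/2⌋+1 (suc (suc n)) = s≤s (⌈n/2⌉≤⌊n/2⌋+1 n)
... | f | c | refl | f≤c | c≤f+1 = record { f = f ; c = c ; total = refl ; optimal = opt ; balanced = bal f≤c c≤f+1 }
  where
  bal : ∀ {f c} → f ≤ c → c ≤ suc f → 2 * (f * f + c * c) ≤ (f + c) * (f + c) + 1
  bal {f} {c} l u with m≤n⇒m<n∨m≡n l
  ... | inj₂ refl = ≤-trans (≤-reflexive (r f)) (m≤m+n _ 1)
    where r : ∀ f → 2 * (f * f + f * f) ≡ (f + f) * (f + f)
          r = solve-∀
  ... | inj₁ lt with ≤-antisym u lt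
  ...   | refl = ≤-reflexive (r f)
    where r : ∀ f → 2 * (f * f + suc f * suc f) ≡ (f + suc f) * (f + suc f) + 1
          r = solve-∀
  opt : ∀ a b → a + b ≡ f + c → f * f + c * c ≤ a * a + b * b
  opt a b e = s≤s⁻¹ (*-cancelˡ-< 2 _ _ (begin-strict
    2 * (f * f + c * c) ≤⟨ bal f≤c c≤f+1 ⟩
    (f + c) * (f + c) + 1 ≡⟨ cong (λ t → t * t + 1) (≡-sym e) ⟩
    (a + b) * (a + b) + 1 ≤⟨ +-monoˡ-≤ 1 (square-sum-lower a b) ⟩
    2 * (a * a + b * b) + 1 <⟨ +-monoʳ-< (2 * (a * a + b * b)) (s≤s (s≤s z≤n)) ⟩
    2 * (a * a + b * b) + 2 ≡⟨ r (a * a + b * b) ⟩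
    2 * suc (a * a + b * b) ∎))
    where
    open ≤-Reasoning
    r : ∀ x → 2 * x + 2 ≡ 2 * suc x
    r = solve-∀

record Matching {n} (G : Graph n) (P : Fin n → Bool) (k : ℕ) : Set where
  field
    l r    : Fin k → Fin n
    l-in   : ∀ i → P (l i) ≡ true
    r-in   : ∀ i → P (r i) ≡ true
    edge   : ∀ i → adj G (l i) (r i) ≡ true
    l-inj  : ∀ i j → l i ≡ l j → i ≡ j
    r-inj  : ∀ i j → r i ≡ r j → i ≡ j
    l≢r    : ∀ i j → l i ≢ r j

Covers : ∀ {n} → Graph n → (P T : Fin n → Bool) → Set
Covers G P T = ∀ x y → P x ≡ true → P y ≡ true → adj G x y ≡ true → T x ≡ true ⊎ T y ≡ true

ends : ∀ {n k} → (Fin k → Fin n) → (Fin k → Fin n) → Fin n → Bool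
ends l r v = 0 <ᵇ (count (λ i → l i == v) + count (λ i → r i == v))

ends-count : ∀ {n k} (l r : Fin k → Fin n) → count (ends l r) ≤ k + k
ends-count {n} {k} l r = begin
  count (ends l r) ≡⟨ count-sum (ends l r) ⟩
  sumFin (λ v → ⟦ ends l r v ⟧) ≤⟨ sum-mono (λ v → pt (count (λ i → l i == v) + count (λ i → r i == v))) ⟩
  sumFin (λ v → count (λ i → l i == v) + count (λ i → r i == v)) ≡⟨ sum-+ (λ v → count (λ i → l i == v)) (λ v → count (λ i → r i == v)) ⟩
  sumFin (λ v → count (λ i → l i == v)) + sumFin (λ v → count (λ i → r i == v)) ≡⟨ cong₂ _+_ (each l) (each r) ⟩
  k + k ∎
  where
  open ≤-Reasoning
  pt : ∀ x → ⟦ 0 <ᵇ x ⟧ ≤ x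
  pt zero    = z≤n
  pt (suc x) = s≤s z≤n
  each : ∀ (f : Fin k → Fin n) → sumFin (λ v → count (λ i → f i == v)) ≡ k
  each f = trans (sum-cong (λ v → count-sum (λ i → f i == v))) (trans (sum-swap (λ v i → ⟦ f i == v ⟧))
    (trans (sum-cong (λ i → trans (≡-sym (count-sum (λ v → f i == v))) (trans (count-cong (λ v → f i == v) (λ v → v == f i) (λ v → ==-sym (f i) v)) (count-== (f i)))))
      (trans (sum-const k 1) (*-identityʳ k))))

ends-false : ∀ {n k} (l r : Fin k → Fin n) v → ends l r v ≡ false → (∀ i → l i ≢ v) × (∀ i → r i ≢ v)
ends-false l r v e = (λ i q → none {count (λ i → l i == v)} e (∃⇒count>0 (λ i → l i == v) (==-complete q))) ,
                     (λ i q → none' (count (λ i → l i == v)) e (∃⇒count>0 (λ i → r i == v) (==-complete q)))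
  where
  none : ∀ {a b} → (0 <ᵇ (a + b)) ≡ false → ¬ (0 < a)
  none {suc a} () _
  none' : ∀ a {b} → (0 <ᵇ (a + b)) ≡ false → ¬ (0 < b)
  none' zero    {suc b} () _
  none' (suc a) ()

-- Either some edge inside `P` avoids the ends of the current matching and extends it, or these ends
-- already meet all edges inside `P`.
matching-or-cover : ∀ {n} (G : Graph n) (P : Fin n → Bool) k →
  Matching G P k ⊎ (Σ (Fin n → Bool) λ T → count T ≤ k + k × Covers G P T)
matching-or-cover G P zero = inj₁ (record { l = λ () ; r = λ () ; l-in = λ () ; r-in = λ () ; edge = λ () ; l-inj = λ () ; r-inj = λ () ; l≢r = λ () })
matching-or-cover {n} G P (suc k) with matching-or-cover G P k
... | inj₂ (T , small , cov) = inj₂ (T , ≤-trans small (+-mono-≤ (n≤1+n k) (n≤1+n k)) , cov)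
... | inj₁ M = extend (find (λ x → outside x ∧ (0 <ᵇ count (λ y → adj G x y ∧ outside y))))
  where
  open Matching M
  outside : Fin n → Bool
  outside x = P x ∧ not (ends l r x)
  fresh : ∀ {x} → outside x ≡ true → (∀ i → l i ≢ x) × (∀ i → r i ≢ x)
  fresh {x} e = ends-false l r x (not-elim (proj₂ (∧-elim (P x) e)))
  cons : Fin n → (Fin k → Fin n) → Fin (suc k) → Fin n
  cons x f zero    = x
  cons x f (suc i) = f i
  extend : (∃ λ x → outside x ∧ (0 <ᵇ count (λ y → adj G x y ∧ outside y)) ≡ true) ⊎
           (∀ x → outside x ∧ (0 <ᵇ count (λ y → adj G x y ∧ outside y)) ≡ false) →
    Matching G P (suc k) ⊎ (Σ (Fin n → Bool) λ T → count T ≤ suc k + suc k × Covers G P T)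
  extend (inj₂ none) = inj₂ (ends l r , ≤-trans (ends-count l r) (+-mono-≤ (n≤1+n k) (n≤1+n k)) , cov)
    where
    cov : Covers G P (ends l r)
    cov x y Px Py a with bool-cases (ends l r x) | bool-cases (ends l r y)
    ... | inj₁ t | _      = inj₁ t
    ... | inj₂ _ | inj₁ t = inj₂ t
    ... | inj₂ f | inj₂ f' = false≢true (none x) (∧-intro (∧-intro Px (cong not f))
            (<ᵇ-complete (∃⇒count>0 (λ y → adj G x y ∧ outside y) (∧-intro a (∧-intro Py (cong not f'))))))
  extend (inj₁ (x , e)) with count>0⇒∃ (λ y → adj G x y ∧ outside y) (<ᵇ-sound (proj₂ (∧-elim (outside x) e)))
  ... | y , e' = inj₁ (record
    { l = cons x l ; r = cons y r
    ; l-in = λ { zero → proj₁ (∧-elim (P x) ox) ; (suc i) → l-in i }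
    ; r-in = λ { zero → proj₁ (∧-elim (P y) oy) ; (suc i) → r-in i }
    ; edge = λ { zero → xy ; (suc i) → edge i }
    ; l-inj = λ { zero zero _ → refl ; zero (suc j) q → ⊥-elim (proj₁ (fresh ox) j (≡-sym q)) ; (suc i) zero q → ⊥-elim (proj₁ (fresh ox) i q) ; (suc i) (suc j) q → cong suc (l-inj i j q) }
    ; r-inj = λ { zero zero _ → refl ; zero (suc j) q → ⊥-elim (proj₂ (fresh oy) j (≡-sym q)) ; (suc i) zero q → ⊥-elim (proj₂ (fresh oy) i q) ; (suc i) (suc j) q → cong suc (r-inj i j q) }
    ; l≢r = λ { zero zero q → adj⇒≢ G xy q ; zero (suc j) q → proj₂ (fresh ox) j (≡-sym q) ; (suc i) zero q → proj₁ (fresh oy) i q ; (suc i) (suc j) q → l≢r i j q } })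
    where
    ox : outside x ≡ true
    ox = proj₁ (∧-elim (outside x) e)
    oy : outside y ≡ true
    oy = proj₂ (∧-elim (adj G x y) e')
    xy : adj G x y ≡ true
    xy = proj₁ (∧-elim (adj G x y) e')

-- Each edge inside `P` is charged to an end in `T`, which carries at most `d` of them; the factor
-- two counts both orders.
cover-bound : ∀ {n} (G : Graph n) (P T : Fin n → Bool) t d → count T ≤ t → Covers G P T →
  (∀ v → P v ≡ true → count (λ u → adj G v u ∧ P u) ≤ d) →
  pairCount (λ u v → (P u ∧ P v) ∧ adj G u v) ≤ 2 * (t * d)
cover-bound {n} G P T t d small cov deg≤ = begin
  pairCount (λ u v → (P u ∧ P v) ∧ adj G u v) ≤⟨ sum-mono (λ u → ≤-trans (count-mono (λ v → (P u ∧ P v) ∧ adj G u v) (λ v → R u v ∨ R v u) (pt u)) (count-∨ (R u) (λ v → R v u))) ⟩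
  sumFin (λ u → count (R u) + count (λ v → R v u)) ≡⟨ trans (sum-+ (λ u → count (R u)) (λ u → count (λ v → R v u))) (cong (pairCount R +_) (≡-sym (pairCount-swap R))) ⟩
  pairCount R + pairCount R ≤⟨ +-mono-≤ bound bound ⟩
  t * d + t * d ≡⟨ ring (t * d) ⟩
  2 * (t * d) ∎
  where
  open ≤-Reasoning
  ring : ∀ x → x + x ≡ 2 * x
  ring = solve-∀
  R : Fin n → Fin n → Bool
  R u v = (T u ∧ P u) ∧ (adj G u v ∧ P v)
  ∨-introˡ : ∀ {a b} → a ≡ true → a ∨ b ≡ true
  ∨-introˡ refl = refl
  ∨-introʳ : ∀ a {b} → b ≡ true → a ∨ b ≡ true
  ∨-introʳ true  _ = refl
  ∨-introʳ false e = e
  pt : ∀ u v → (P u ∧ P v) ∧ adj G u v ≡ true → R u v ∨ R v u ≡ true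
  pt u v e with ∧-elim (P u ∧ P v) e
  ... | pq , a with ∧-elim (P u) pq
  ...   | Pu , Pv with cov u v Pu Pv a
  ...     | inj₁ t = ∨-introˡ (∧-intro (∧-intro t Pu) (∧-intro a Pv))
  ...     | inj₂ t = ∨-introʳ (R u v) (∧-intro (∧-intro t Pv) (∧-intro (adj-sym G a) Pu))
  row : ∀ u → count (R u) ≤ ⟦ T u ⟧ * d
  row u with bool-cases (T u) | bool-cases (P u)
  ... | inj₂ f | _ = ≤-trans (≤-reflexive (trans (count-cong (R u) (λ _ → false) (λ v → cong (λ b → (b ∧ P u) ∧ (adj G u v ∧ P v)) f)) (count-false n))) z≤n
  ... | inj₁ t | inj₂ f = ≤-trans (≤-reflexive (trans (count-cong (R u) (λ _ → false) (λ v → trans (cong (λ b → (T u ∧ b) ∧ (adj G u v ∧ P v)) f) (cong (λ b → (b ∧ false) ∧ (adj G u v ∧ P v)) t))) (count-false n))) z≤n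
  ... | inj₁ t | inj₁ p = ≤-trans (count-mono (R u) (λ v → adj G u v ∧ P v) (λ v e → proj₂ (∧-elim (T u ∧ P u) e)))
                            (≤-trans (deg≤ u p) (≤-reflexive (trans (≡-sym (+-identityʳ d)) (cong (λ b → ⟦ b ⟧ * d) (≡-sym t)))))
  bound : pairCount R ≤ t * d
  bound = ≤-trans (sum-mono row) (≤-trans (≤-reflexive (trans (sum-*ʳ d (λ u → ⟦ T u ⟧)) (cong (_* d) (≡-sym (count-sum T))))) (*-monoˡ-≤ d small))

role-of : Fin 3 → Role
role-of S = fixed
role-of X = middle
role-of Y = last

role-fixed : ∀ c → role-of c ≡ fixed → c ≡ S
role-fixed S _ = refl
role-fixed X ()
role-fixed Y ()

role-middle : ∀ c → role-of c ≡ middle → c ≡ X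
role-middle X _ = refl
role-middle S ()
role-middle Y ()

role-last : ∀ c → role-of c ≡ last → c ≡ Y
role-last Y _ = refl
role-last S ()
role-last X ()

embed-colouring : ∀ {h n} (H : Graph h) (G : Graph n) (col : Fin h → Fin 3) → Proper H col →
  (σ : Fin h → Fin n) (D : Fin h → Fin n → Bool) (P : Fin n → Bool) (μ : ℕ) →
  (∀ x y → col x ≡ S → col y ≡ S → σ x ≡ σ y → x ≡ y) →
  (∀ x → col x ≡ X → h ≤ count (D x)) →
  (∀ x s z → col x ≡ X → col s ≡ S → D x z ≡ true → z ≢ σ s) →
  (∀ x s z → col x ≡ X → col s ≡ S → adj H s x ≡ true → D x z ≡ true → adj G (σ s) z ≡ true) →
  (∀ x z → col x ≡ X → D x z ≡ true → count (λ y → P y ∧ not (adj G z y)) ≤ μ) →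
  (∀ s z → col s ≡ S → P z ≡ true → adj G (σ s) z ≡ true) →
  h + h * μ ≤ count P → H ⊆ G
embed-colouring H G col proper σ D P μ inj big fresh edge miss P-edge P-big =
  embed H G (λ x → role-of (col x)) σ D P μ
    (λ x y a p q → proper x y a (trans (role-middle _ p) (≡-sym (role-middle _ q))))
    (λ x y a p q → proper x y a (trans (role-last _ p) (≡-sym (role-last _ q))))
    (λ x y p q → inj x y (role-fixed _ p) (role-fixed _ q))
    (λ x y p q a → ⊥-elim (proper x y a (trans (role-fixed _ p) (≡-sym (role-fixed _ q)))))
    (λ x p → big x (role-middle _ p))
    (λ x s z p q → fresh x s z (role-middle _ p) (role-fixed _ q))
    (λ x s z p q → edge x s z (role-middle _ p) (role-fixed _ q))
    (λ x z p → miss x z (role-middle _ p))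
    (λ s z p → P-edge s z (role-fixed _ p))
    P-big

-- Classification of all vertices by their degrees into the two cores.

cls : Bool → Fin 3
cls true  = X
cls false = Y

cls≢S : ∀ b → cls b ≢ S
cls≢S true  ()
cls≢S false ()

∧-swap : ∀ a {b} → a ∧ b ≡ true → b ∧ a ≡ true
∧-swap true {true} _ = refl

_∧ˡ_ : ∀ a {b} → a ∧ b ≡ true → a ≡ true
a ∧ˡ e = proj₁ (∧-elim a e)

_∧ʳ_ : ∀ a {b} → a ∧ b ≡ true → b ≡ true
a ∧ʳ e = proj₂ (∧-elim a e)

-- `δ` measures the defects of the cut and `θ` is the degree threshold that defines W. `θ-large`
-- puts `θ` above constants depending on `h`; `θ-small` makes each core larger than any loss of
-- order `h * h * θ` that occurs.
record Setting {h n} (H : Graph h) (G : Graph n) (q δ θ : ℕ) : Set where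
  field
    ex       : IsEx n H G
    special  : SpecialColouring H q
    matching : MatchingColouring H
    least-S  : (col : Fin h → Fin 3) → Proper H col → q ≤ size col S
    cut      : Cut G δ
    h>0      : 0 < h
    δ<θ      : δ < θ
    θ-large  : 4 * (h * h) + 4 ≤ θ
    θ-small  : 200 * (h * h * θ) ≤ n

module Parts {h n} {H : Graph h} {G : Graph n} {q δ θ : ℕ} (setting : Setting H G q δ θ) where
  open Setting setting
  open Cut cut

  Θ ν : ℕ
  Θ = h * h * θ
  ν = 2 * θ

  h≤hh : h ≤ h * h
  h≤hh = m≤m*n h h ⦃ >-nonZero h>0 ⦄

  θ>0 : 0 < θ
  θ>0 = ≤-trans (s≤s z≤n) δ<θ

  θ≤Θ : θ ≤ Θ
  θ≤Θ = ≤-trans (≤-reflexive (≡-sym (*-identityˡ θ))) (*-monoˡ-≤ θ (*-mono-≤ h>0 h>0))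

  hθ≤Θ : h * θ ≤ Θ
  hθ≤Θ = *-monoˡ-≤ θ h≤hh

  h≤Θ : h ≤ Θ
  h≤Θ = ≤-trans (m≤m*n h θ ⦃ >-nonZero θ>0 ⦄) hθ≤Θ

  δ≤θ : δ ≤ θ
  δ≤θ = <⇒≤ δ<θ

  hδ≤Θ : h * δ ≤ Θ
  hδ≤Θ = ≤-trans (*-monoʳ-≤ h δ≤θ) hθ≤Θ

  -- Half of 200, reduced to pay for `3 * δ`. Later losses are measured in units of `Θ` against this
  -- reserve.
  core-large : ∀ b → 98 * Θ ≤ coreSize b
  core-large b = *-cancelˡ-≤ 2 (+-cancelʳ-≤ (3 * δ) _ _ (begin
    2 * (98 * Θ) + 3 * δ ≤⟨ +-monoʳ-≤ (2 * (98 * Θ)) (*-monoʳ-≤ 3 (≤-trans δ≤θ θ≤Θ)) ⟩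
    2 * (98 * Θ) + 3 * Θ ≤⟨ m≤m+n _ Θ ⟩
    2 * (98 * Θ) + 3 * Θ + Θ ≡⟨ ring Θ ⟩
    200 * Θ ≤⟨ θ-small ⟩
    n ≤⟨ large b ⟩
    2 * coreSize b + 3 * δ ∎))
    where
    open ≤-Reasoning
    ring : ∀ x → 2 * (98 * x) + 3 * x + x ≡ 200 * x
    ring = solve-∀

  Θ≤core : ∀ c b → {_ : c ≤ 98} → c * Θ ≤ coreSize b
  Θ≤core c b {le} = ≤-trans (*-monoˡ-≤ Θ le) (core-large b)

  d miss : Bool → Fin n → ℕ
  d b v    = count (λ u → coreIn b u ∧ adj G v u)
  miss b v = count (λ u → coreIn b u ∧ not (adj G v u))

  d+miss : ∀ b v → coreSize b ≡ d b v + miss b v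
  d+miss b v = count-split (coreIn b) (adj G v)

  -- A vertex joins the side in whose core it has few neighbours, and `S` collects those with more
  -- than `θ` neighbours in both cores. Vertices outside the core are sorted by the same test.
  part : Fin n → Fin 3
  part v = if d true v ≤ᵇ θ then X else if d false v ≤ᵇ θ then Y else S

  part-cls : ∀ b v → part v ≡ cls b → d b v ≤ θ
  part-cls b v e with d true v ≤ᵇ θ in et | d false v ≤ᵇ θ in ef
  part-cls true  v e  | true  | _     = ≤ᵇ-sound et
  part-cls false v () | true  | _
  part-cls true  v () | false | true
  part-cls false v e  | false | true  = ≤ᵇ-sound ef
  part-cls true  v () | false | false
  part-cls false v () | false | false

  part-W : ∀ v → part v ≡ S → ∀ b → θ < d b v
  part-W v e b with d true v ≤ᵇ θ in et | d false v ≤ᵇ θ in ef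
  part-W v () b | true  | _
  part-W v () b | false | true
  part-W v e true  | false | false = ≤ᵇ-false et
  part-W v e false | false | false = ≤ᵇ-false ef

  core-within : ∀ b v → coreIn b v ≡ true → d b v ≤ θ
  core-within b v e = ≤-trans (count-mono _ _ (λ u → ∧-swap (coreIn b u))) (≤-trans (within b v e) δ≤θ)

  -- The test against the true core comes first. A core vertex of the other side fails it because it
  -- misses at most `δ` of the true core, which is far larger than `θ + δ`.
  core-part : ∀ b v → coreIn b v ≡ true → part v ≡ cls b
  core-part true v e rewrite ≤ᵇ-complete (core-within true v e) = refl
  core-part false v e with d true v ≤ᵇ θ in et
  ... | true = ⊥-elim (<-irrefl refl (begin-strict
    coreSize true ≡⟨ d+miss true v ⟩
    d true v + miss true v ≤⟨ +-mono-≤ (≤ᵇ-sound et) (missing false v e) ⟩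
    θ + δ <⟨ +-mono-≤-< θ≤Θ (≤-trans δ<θ θ≤Θ) ⟩
    Θ + Θ ≡⟨ ring Θ ⟩
    2 * Θ ≤⟨ Θ≤core 2 true {s≤s (s≤s z≤n)} ⟩
    coreSize true ∎))
    where
    open ≤-Reasoning
    ring : ∀ x → x + x ≡ 2 * x
    ring = solve-∀
  ... | false rewrite ≤ᵇ-complete (core-within false v e) = refl

  side-of : ∀ v → core v ≡ true → ∃ λ b → coreIn b v ≡ true
  side-of v e = side v , ∧-intro e (xnor (side v))
    where xnor : ∀ b → not (b xor b) ≡ true
          xnor true  = refl
          xnor false = refl

  degree-split : ∀ b v → deg G v ≤ d b v + d (not b) v + δ
  degree-split b v = begin
    deg G v ≤⟨ count-mono (adj G v) _ cover ⟩
    count (λ u → ((coreIn b u ∧ adj G v u) ∨ (coreIn (not b) u ∧ adj G v u)) ∨ not (core u))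
      ≤⟨ count-∨ (λ u → (coreIn b u ∧ adj G v u) ∨ (coreIn (not b) u ∧ adj G v u)) (λ u → not (core u)) ⟩
    count (λ u → (coreIn b u ∧ adj G v u) ∨ (coreIn (not b) u ∧ adj G v u)) + count (λ u → not (core u))
      ≤⟨ +-mono-≤ (count-∨ (λ u → coreIn b u ∧ adj G v u) (λ u → coreIn (not b) u ∧ adj G v u)) few ⟩
    d b v + d (not b) v + δ ∎
    where
    open ≤-Reasoning
    bits : ∀ c s b a → a ≡ true → (((c ∧ not (s xor b)) ∧ a) ∨ ((c ∧ not (s xor not b)) ∧ a)) ∨ not c ≡ true
    bits false s     b     true _ = refl
    bits true  true  true  true _ = refl
    bits true  true  false true _ = refl
    bits true  false true  true _ = refl
    bits true  false false true _ = refl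
    cover : ∀ u → adj G v u ≡ true → ((coreIn b u ∧ adj G v u) ∨ (coreIn (not b) u ∧ adj G v u)) ∨ not (core u) ≡ true
    cover u = bits (core u) (side u) b (adj G v u)

  -- By extremality `v` cannot be profitably replaced by a vertex joined to `coreIn b`: any `h`
  -- vertices of that core have many common neighbours in the opposite one. The unit stands for `v`
  -- itself.
  core≤degree : ∀ b v → coreSize b ≤ suc (deg G v)
  core≤degree b v = ≤-trans (count-remove (coreIn b) v) (s≤s
    (neighbourhood≤degree {H = H} {G = G} ex v (coreIn b) (coreIn (not b)) δ (λ u → missing b u) (≤-trans small (Θ≤core 4 (not b) {s≤s (s≤s (s≤s (s≤s z≤n)))}))))
    where
    ring : ∀ x → x + x + x + x ≡ 4 * x
    ring = solve-∀
    small : 2 + h + h * δ ≤ 4 * Θ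
    small = ≤-trans (+-mono-≤ (+-mono-≤ (≤-trans (s≤s (s≤s z≤n)) (≤-trans (≤-trans (m≤n+m 4 (4 * (h * h))) θ-large) (≤-trans θ≤Θ (m≤m+n Θ Θ)))) h≤Θ) hδ≤Θ) (≤-reflexive (ring Θ))

  -- In part `b`, `v` has at most `θ` neighbours in its own core and `δ` outside both cores, yet its
  -- degree is at least the size of the opposite core minus one. So all but `2 * θ` of that core are
  -- neighbours.
  part-misses : ∀ b v → part v ≡ cls b → miss (not b) v ≤ ν
  part-misses b v e = +-cancelˡ-≤ (d (not b) v) _ _ (begin
    d (not b) v + miss (not b) v ≡⟨ ≡-sym (d+miss (not b) v) ⟩
    coreSize (not b) ≤⟨ core≤degree (not b) v ⟩
    suc (deg G v) ≤⟨ s≤s (degree-split b v) ⟩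
    suc (d b v + d (not b) v + δ) ≤⟨ s≤s (+-monoˡ-≤ δ (+-monoˡ-≤ (d (not b) v) (part-cls b v e))) ⟩
    suc (θ + d (not b) v + δ) ≡⟨ r₁ θ (d (not b) v) δ ⟩
    d (not b) v + (θ + suc δ) ≤⟨ +-monoʳ-≤ (d (not b) v) (+-monoʳ-≤ θ δ<θ) ⟩
    d (not b) v + (θ + θ) ≡⟨ cong (d (not b) v +_) (r₂ θ) ⟩
    d (not b) v + ν ∎)
    where
    open ≤-Reasoning
    r₁ : ∀ a b c → suc (a + b + c) ≡ b + (a + suc c)
    r₁ = solve-∀
    r₂ : ∀ a → a + a ≡ 2 * a
    r₂ = solve-∀

  inPart : Bool → Fin n → Bool
  inPart b v = part v == cls b

  inDegree : Bool → Fin n → ℕ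
  inDegree b v = count (λ u → adj G v u ∧ inPart b u)

  part-core : ∀ b u → inPart b u ≡ true → core u ≡ true → coreIn b u ≡ true
  part-core b u e c with side-of u c
  ... | b' , e' with same b' b (trans (≡-sym (core-part b' u e')) (==-sound e))
    where same : ∀ b' b → cls b' ≡ cls b → b' ≡ b
          same true  true  _ = refl
          same false false _ = refl
  ...   | refl = e'

  inDegree-small : ∀ b v → inPart b v ≡ true → inDegree b v ≤ ν
  inDegree-small b v e = begin
    inDegree b v ≤⟨ count-mono _ (λ u → (coreIn b u ∧ adj G v u) ∨ not (core u)) cover ⟩
    count (λ u → (coreIn b u ∧ adj G v u) ∨ not (core u)) ≤⟨ count-∨ (λ u → coreIn b u ∧ adj G v u) (λ u → not (core u)) ⟩
    d b v + count (λ u → not (core u)) ≤⟨ +-mono-≤ (part-cls b v (==-sound e)) (≤-trans few δ≤θ) ⟩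
    θ + θ ≡⟨ ring θ ⟩
    ν ∎
    where
    open ≤-Reasoning
    ring : ∀ a → a + a ≡ 2 * a
    ring = solve-∀
    ∨-elimʳ : ∀ {a} b → (b ≡ true → a ≡ true) → a ∨ not b ≡ true
    ∨-elimʳ {true}  b     _ = refl
    ∨-elimʳ {false} true  f = f refl
    ∨-elimʳ {false} false f = refl
    cover : ∀ u → adj G v u ∧ inPart b u ≡ true → (coreIn b u ∧ adj G v u) ∨ not (core u) ≡ true
    cover u e' = ∨-elimʳ (core u) (λ c → ∧-intro (part-core b u (adj G v u ∧ʳ e') c) (adj G v u ∧ˡ e'))

  W : Fin n → Bool
  W v = part v == S

  W≢core : ∀ {b v w} → W w ≡ true → coreIn b v ≡ true → v ≢ w
  W≢core {b} {v} e c refl = cls≢S b (trans (≡-sym (core-part b v c)) (==-sound e))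

  free : Free H G
  free = proj₁ ex

  -- With S in W, X in `coreIn b` and Y in the opposite core, each X-image misses at most `δ` of the
  -- candidates for Y, so only the requirements at S are left to check.
  core-embedding : ∀ b (col : Fin h → Fin 3) → Proper H col → (σ : Fin h → Fin n) (D : Fin h → Fin n → Bool) (P : Fin n → Bool) →
    (∀ x y → col x ≡ S → col y ≡ S → σ x ≡ σ y → x ≡ y) →
    (∀ s → col s ≡ S → W (σ s) ≡ true) →
    (∀ x z → D x z ≡ true → coreIn b z ≡ true) →
    (∀ z → P z ≡ true → coreIn (not b) z ≡ true) →
    (∀ x → col x ≡ X → h ≤ count (D x)) →
    (∀ x s z → col x ≡ X → col s ≡ S → adj H s x ≡ true → D x z ≡ true → adj G (σ s) z ≡ true) →
    (∀ s z → col s ≡ S → P z ≡ true → adj G (σ s) z ≡ true) →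
    h + h * δ ≤ count P → ⊥
  core-embedding b col proper σ D P inj σW DC PC big edge P-edge P-big = free
    (embed-colouring H G col proper σ D P δ inj big (λ x s z _ cs Dz → W≢core {b} (σW s cs) (DC x z Dz)) edge
      (λ x z _ Dz → ≤-trans (count-mono _ _ (λ u e → ∧-intro (PC u (P u ∧ˡ e)) (P u ∧ʳ e))) (missing b z (DC x z Dz)))
      P-edge P-big)

common-elim : ∀ {X K} (I : Integral X) (σ : Fin K → Bool) (A : Fin K → X → Bool) {y i} → common I σ A y ≡ true → σ i ≡ true → A i y ≡ true
common-elim I σ A {y} {i} e s = ⇒ᵇ-elim {σ i} (all-elim (λ i → σ i ⇒ᵇ A i y) e i) s

module PartsBounds {h n} {H : Graph h} {G : Graph n} {q δ θ : ℕ} (setting : Setting H G q δ θ) where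
  open Setting setting
  open Cut cut
  open Parts setting

  n>0 : 0 < n
  n>0 = ≤-trans (≤-trans (≤-trans θ>0 θ≤Θ) (m≤n*m Θ 200)) θ-small

  v₀ : Fin n
  v₀ = proj₁ (count>0⇒∃ {n} (λ _ → true) (≤-trans n>0 (≤-reflexive (≡-sym (count-true n)))))

  -- Two rounds of `dense-common`: of `K` members of W, `K₁` have linearly many common neighbours in
  -- one core, and `h` of those have linearly many in the other. These `h` vertices could host all
  -- of S.
  W-bounded : ∀ m K₁ K C₀ C₁ → n ≤ m * suc θ → K₁ ≡ suc (2 * m * h) → K ≡ suc (2 * m * K₁) →
    C₀ ≡ 2 * m * 2 ^ K → C₁ ≡ 2 * m * 2 ^ K₁ → C₀ * (h + h * δ) ≤ n → C₁ * (h + h * δ) ≤ n → count W < K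
  W-bounded m K₁ K C₀ C₁ n≤ eK₁ eK eC₀ eC₁ big₀ big₁ = ≰⇒> λ many → contradict many
    where
    open SpecialColouring special
    I : Integral (Fin n)
    I = vertices n
    A : Bool → Fin n → Fin n → Bool
    A b w u = coreIn b u ∧ adj G w u
    dense : ∀ b w → W w ≡ true → Integral.total I ≤ m * Integral.measure I (A b w)
    dense b w e = ≤-trans (≤-reflexive (total-vertices n)) (≤-trans n≤ (*-monoʳ-≤ m
      (≤-trans (part-W w (==-sound e) b) (≤-reflexive (count-sum (A b w))))))
    tot>0 : 0 < Integral.total I
    tot>0 = ≤-trans n>0 (≤-reflexive (≡-sym (total-vertices n)))
    contradict : K ≤ count W → ⊥
    contradict many = core-embedding true col proper (proj₁ place) (λ _ → D) P
      (λ x y cx cy → proj₂ (proj₂ place) x y (==-complete cx) (==-complete cy))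
      (λ s cs → proj₁ (proj₂ chosen) _ (σ⊆ _ (τ⊆ _ (placed s cs))))
      (λ x z Dz → coreIn true z ∧ˡ common-elim I σ (A true) Dz (proj₂ σ-some))
      (λ z Pz → coreIn false z ∧ˡ common-elim I τ (A false) Pz (proj₂ τ-some))
      (λ x _ → ≤-trans (m≤m+n h (h * δ)) D-big)
      (λ x s z _ cs _ Dz → coreIn true z ∧ʳ common-elim I σ (A true) Dz (τ⊆ _ (placed s cs)))
      (λ s z cs Pz → coreIn false z ∧ʳ common-elim I τ (A false) Pz (placed s cs))
      P-big
      where
      chosen : Σ (Fin n → Bool) λ W' → (∀ i → W' i ≡ true → W i ≡ true) × count W' ≡ K
      chosen = subset-of-size W K many
      first-stage : Σ (Fin n → Bool) λ σ → (∀ i → σ i ≡ true → proj₁ chosen i ≡ true) × count σ ≡ K₁ ×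
        Integral.total I ≤ 2 * m * 2 ^ K * Integral.measure I (common I σ (A true))
      first-stage = dense-common I (proj₁ chosen) (A true) m K₁ K (≤-trans (n≤1+n _) (≤-reflexive (≡-sym eK)))
        (≤-trans (s≤s z≤n) (≤-reflexive (≡-sym eK))) (proj₂ (proj₂ chosen)) tot>0 (λ w e → dense true w (proj₁ (proj₂ chosen) w e))
      σ : Fin n → Bool
      σ = proj₁ first-stage
      σ⊆ : ∀ i → σ i ≡ true → proj₁ chosen i ≡ true
      σ⊆ = proj₁ (proj₂ first-stage)
      second-stage : Σ (Fin n → Bool) λ τ → (∀ i → τ i ≡ true → σ i ≡ true) × count τ ≡ h ×
        Integral.total I ≤ 2 * m * 2 ^ K₁ * Integral.measure I (common I τ (A false))
      second-stage = dense-common I σ (A false) m h K₁ (≤-trans (n≤1+n _) (≤-reflexive (≡-sym eK₁)))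
        (≤-trans (s≤s z≤n) (≤-reflexive (≡-sym eK₁))) (proj₁ (proj₂ (proj₂ first-stage))) tot>0
        (λ w e → dense false w (proj₁ (proj₂ chosen) w (σ⊆ w e)))
      τ : Fin n → Bool
      τ = proj₁ second-stage
      τ⊆ : ∀ i → τ i ≡ true → σ i ≡ true
      τ⊆ = proj₁ (proj₂ second-stage)
      τ-count : count τ ≡ h
      τ-count = proj₁ (proj₂ (proj₂ second-stage))
      τ-some : ∃ λ i → τ i ≡ true
      τ-some = count>0⇒∃ τ (≤-trans h>0 (≤-reflexive (≡-sym τ-count)))
      σ-some : ∃ λ i → σ i ≡ true
      σ-some = proj₁ τ-some , τ⊆ _ (proj₂ τ-some)
      D P : Fin n → Bool
      D = common I σ (A true)
      P = common I τ (A false)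
      D-big : h + h * δ ≤ count D
      D-big = c*k≤c*x⇒k≤x {C₀} n>0 big₀ (≤-trans (≤-reflexive (≡-sym (total-vertices n))) (≤-trans (proj₂ (proj₂ (proj₂ first-stage)))
        (≤-reflexive (cong₂ _*_ (≡-sym eC₀) (≡-sym (count-sum D))))))
      P-big : h + h * δ ≤ count P
      P-big = c*k≤c*x⇒k≤x {C₁} n>0 big₁ (≤-trans (≤-reflexive (≡-sym (total-vertices n))) (≤-trans (proj₂ (proj₂ (proj₂ second-stage)))
        (≤-reflexive (cong₂ _*_ (≡-sym eC₁) (≡-sym (count-sum P))))))
      place : Σ (Fin h → Fin n) λ f → (∀ x → (col x == S) ≡ true → τ (f x) ≡ true) ×
        (∀ x y → (col x == S) ≡ true → (col y == S) ≡ true → f x ≡ f y → x ≡ y)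
      place = partial-injection (λ x → col x == S) τ v₀ (≤-trans (count≤n (λ x → col x == S)) (≤-reflexive (≡-sym τ-count)))
      placed : ∀ s → col s ≡ S → τ (proj₁ place s) ≡ true
      placed s cs = proj₁ (proj₂ place) s (==-complete cs)

  -- A matching would carry a copy of `H`: an S-vertex `s` goes to `l s` and its X-neighbour, if
  -- any, to `r s`; the remaining X-vertices go to the core of part `b`, and Y to common neighbours
  -- of all matching ends in the opposite core. Each end misses at most `ν` of that core.
  no-matching : ∀ b → ¬ Matching G (inPart b) h
  no-matching b M = free (embed H G role σ (λ _ → D) P δ middle-indep last-indep σ-inj σ-edge (λ _ _ → D-big) D-fresh D-edge D-miss P-edge P-big)
    where
    open Matching M
    open MatchingColouring matching
    S-neighbour : Fin h → Fin h → Bool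
    S-neighbour x s = adj H s x ∧ (col s == S)
    roleBy : Fin 3 → Bool → Role
    roleBy S _     = fixed
    roleBy X true  = fixed
    roleBy X false = middle
    roleBy Y _     = last
    leafy : Fin h → Bool
    leafy x = 0 <ᵇ count (S-neighbour x)
    role : Fin h → Role
    role x = roleBy (col x) (leafy x)
    -- The default `x` stands for the case without an S-neighbour; such an X-vertex has role
    -- `middle`.
    mate : ∀ x → (∃ λ s → S-neighbour x s ≡ true) ⊎ (∀ s → S-neighbour x s ≡ false) → Fin h
    mate x (inj₁ (s , _)) = s
    mate x (inj₂ _)       = x
    placeBy : Fin 3 → Fin h → Fin n
    placeBy S x = l x
    placeBy X x = r (mate x (find (S-neighbour x)))
    placeBy Y x = v₀
    σ : Fin h → Fin n
    σ x = placeBy (col x) x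
    data Fixed (x : Fin h) : Set where
      isS    : col x ≡ S → σ x ≡ l x → Fixed x
      isLeaf : col x ≡ X → ∀ s → adj H s x ≡ true → col s ≡ S → σ x ≡ r s → Fixed x
    fixed-view : ∀ x c lf → col x ≡ c → leafy x ≡ lf → roleBy c lf ≡ fixed → Fixed x
    fixed-view x S lf e _ _ = isS e (cong (λ c → placeBy c x) e)
    fixed-view x X true e el _ with find (S-neighbour x) in ef
    ... | inj₁ (s , sx) = isLeaf e s (adj H s x ∧ˡ sx) (==-sound (adj H s x ∧ʳ sx))
                            (trans (cong (λ c → placeBy c x) e) (cong (λ t → r (mate x t)) ef))
    ... | inj₂ none with count>0⇒∃ (S-neighbour x) (<ᵇ-sound el)
    ...   | s , sx = false≢true (none s) sx
    fixed-view x X false e _ ()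
    fixed-view x Y lf e _ ()
    view : ∀ x → role x ≡ fixed → Fixed x
    view x = fixed-view x _ _ refl refl
    middle-view : ∀ c lf → roleBy c lf ≡ middle → c ≡ X × lf ≡ false
    middle-view X false _ = refl , refl
    middle-view S _ ()
    middle-view X true ()
    middle-view Y _ ()
    last-view : ∀ c lf → roleBy c lf ≡ last → c ≡ Y
    last-view Y _ _ = refl
    last-view S _ ()
    last-view X true ()
    last-view X false ()
    middle-indep : ∀ x y → adj H x y ≡ true → role x ≡ middle → role y ≢ middle
    middle-indep x y a p p' = proper x y a (trans (proj₁ (middle-view _ _ p)) (≡-sym (proj₁ (middle-view _ _ p'))))
    last-indep : ∀ x y → adj H x y ≡ true → role x ≡ last → role y ≢ last
    last-indep x y a p p' = proper x y a (trans (last-view _ _ p) (≡-sym (last-view _ _ p')))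
    σ-inj : ∀ x y → role x ≡ fixed → role y ≡ fixed → σ x ≡ σ y → x ≡ y
    σ-inj x y p p' e with view x p | view y p'
    ... | isS _ u | isS _ v = l-inj x y (trans (≡-sym u) (trans e v))
    ... | isS _ u | isLeaf _ s _ _ v = ⊥-elim (l≢r x s (trans (≡-sym u) (trans e v)))
    ... | isLeaf _ s _ _ u | isS _ v = ⊥-elim (l≢r y s (trans (≡-sym v) (trans (≡-sym e) u)))
    ... | isLeaf cx s a cs u | isLeaf cy t a' ct v with r-inj s t (trans (≡-sym u) (trans e v))
    ...   | refl = X-unique s x y cs cx cy a a'
    σ-edge : ∀ x y → role x ≡ fixed → role y ≡ fixed → adj H x y ≡ true → adj G (σ x) (σ y) ≡ true
    σ-edge x y p p' xy with view x p | view y p'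
    ... | isS cx _ | isS cy _ = ⊥-elim (proper x y xy (trans cx (≡-sym cy)))
    ... | isLeaf cx _ _ _ _ | isLeaf cy _ _ _ _ = ⊥-elim (proper x y xy (trans cx (≡-sym cy)))
    ... | isS cx u | isLeaf cy t a ct v rewrite u | v | S-unique y x t cy cx ct xy a = edge t
    ... | isLeaf cx t a ct u | isS cy v rewrite u | v | S-unique x y t cx cy ct (adj-sym H xy) a = adj-sym G (edge t)
    D P P' : Fin n → Bool
    D z  = coreIn b z ∧ not (ends l r z)
    P' z = coreIn (not b) z ∧ all (λ i → true ⇒ᵇ adj G (l i) z)
    P z  = P' z ∧ all (λ i → true ⇒ᵇ adj G (r i) z)
    D-big : h ≤ count D
    D-big = +-cancelʳ-≤ (h + h) _ _ (begin
      h + (h + h) ≤⟨ +-mono-≤ h≤Θ (+-mono-≤ h≤Θ h≤Θ) ⟩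
      Θ + (Θ + Θ) ≡⟨ ring Θ ⟩
      3 * Θ ≤⟨ Θ≤core 3 b {s≤s (s≤s (s≤s z≤n))} ⟩
      coreSize b ≡⟨ count-split (coreIn b) (ends l r) ⟩
      count (λ z → coreIn b z ∧ ends l r z) + count D ≤⟨ +-monoˡ-≤ (count D) (≤-trans (count-mono _ (ends l r) (λ z e → coreIn b z ∧ʳ e)) (ends-count l r)) ⟩
      h + h + count D ≡⟨ +-comm (h + h) _ ⟩
      count D + (h + h) ∎)
      where
      open ≤-Reasoning
      ring : ∀ x → x + (x + x) ≡ 3 * x
      ring = solve-∀
    D-fresh : ∀ x s z → role x ≡ middle → role s ≡ fixed → D z ≡ true → z ≢ σ s
    D-fresh x s z _ p Dz e with view s p | ends-false l r z (not-elim (coreIn b z ∧ʳ Dz))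
    ... | isS _ u | nl , _ = nl s (trans (≡-sym u) (≡-sym e))
    ... | isLeaf _ t _ _ u | _ , nr = nr t (trans (≡-sym u) (≡-sym e))
    D-edge : ∀ x s z → role x ≡ middle → role s ≡ fixed → adj H s x ≡ true → D z ≡ true → adj G (σ s) z ≡ true
    D-edge x s z p p' a _ with middle-view _ _ p | view s p'
    ... | cx , nl | isS cs _ = false≢true nl (<ᵇ-complete (∃⇒count>0 (S-neighbour x) (∧-intro a (==-complete cs))))
    ... | cx , _ | isLeaf cs _ _ _ _ = ⊥-elim (proper s x a (trans cs (≡-sym cx)))
    P-core : ∀ z → P z ≡ true → coreIn (not b) z ≡ true
    P-core z e = coreIn (not b) z ∧ˡ (P' z ∧ˡ e)
    D-miss : ∀ x z → role x ≡ middle → D z ≡ true → count (λ y → P y ∧ not (adj G z y)) ≤ δ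
    D-miss x z _ Dz = ≤-trans (count-mono _ _ (λ y e → ∧-intro (P-core y (P y ∧ˡ e)) (P y ∧ʳ e))) (missing b z (coreIn b z ∧ˡ Dz))
    P-edge : ∀ s z → role s ≡ fixed → P z ≡ true → adj G (σ s) z ≡ true
    P-edge s z p Pz with view s p
    ... | isS _ u rewrite u = all-elim (λ i → true ⇒ᵇ adj G (l i) z) (coreIn (not b) z ∧ʳ (P' z ∧ˡ Pz)) s
    ... | isLeaf _ t _ _ u rewrite u = all-elim (λ i → true ⇒ᵇ adj G (r i) z) (P' z ∧ʳ Pz) t
    P-big : h + h * δ ≤ count P
    P-big = +-cancelʳ-≤ (h * ν) _ _ (+-cancelʳ-≤ (h * ν) _ _ (begin
      h + h * δ + h * ν + h * ν ≤⟨ +-mono-≤ (+-mono-≤ (+-mono-≤ h≤Θ hδ≤Θ) hν) hν ⟩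
      Θ + Θ + 2 * Θ + 2 * Θ ≡⟨ ring Θ ⟩
      6 * Θ ≤⟨ Θ≤core 6 (not b) {s≤s (s≤s (s≤s (s≤s (s≤s (s≤s z≤n)))))} ⟩
      coreSize (not b) ≤⟨ count-all (coreIn (not b)) (λ _ → true) (λ i z → adj G (l i) z) ν (λ i _ → part-misses b (l i) (==-sound (l-in i))) ⟩
      count P' + h * ν ≤⟨ +-monoˡ-≤ (h * ν) (count-all P' (λ _ → true) (λ i z → adj G (r i) z) ν
         (λ i _ → ≤-trans (count-mono _ _ (λ z e → ∧-intro (coreIn (not b) z ∧ˡ (P' z ∧ˡ e)) (P' z ∧ʳ e))) (part-misses b (r i) (==-sound (r-in i))))) ⟩
      count P + h * ν + h * ν ∎))
      where
      open ≤-Reasoning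
      ring : ∀ x → x + x + 2 * x + 2 * x ≡ 6 * x
      ring = solve-∀
      r₁ : ∀ h θ → h * (2 * θ) ≡ 2 * (h * θ)
      r₁ = solve-∀
      hν : h * ν ≤ 2 * Θ
      hν = ≤-trans (≤-reflexive (r₁ h θ)) (*-monoʳ-≤ 2 hθ≤Θ)

  -- Since the matching is impossible, the part has a cover of size `2 * h`; counting both orders of
  -- an edge doubles this to the factor four.
  inside-edges : ∀ b t → (∀ v → inPart b v ≡ true → inDegree b v ≤ t) →
    pairCount (λ u v → (inPart b u ∧ inPart b v) ∧ adj G u v) ≤ 4 * h * t
  inside-edges b t deg≤ with matching-or-cover G (inPart b) h
  ... | inj₁ M = ⊥-elim (no-matching b M)
  ... | inj₂ (T , small , cov) = ≤-trans (cover-bound G (inPart b) T (h + h) t small cov deg≤) (≤-reflexive (ring h t))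
    where ring : ∀ h t → 2 * ((h + h) * t) ≡ 4 * h * t
          ring = solve-∀

-- Counting non-edges at W

least-true : ∀ (P : ℕ → Bool) k → P k ≡ true → ∃ λ a → a ≤ k × P a ≡ true × (∀ a' → a' < a → P a' ≡ false)
least-true P k Pk with bool-cases (P 0)
... | inj₁ t = 0 , z≤n , t , λ _ ()
least-true P zero    Pk | inj₂ f = false≢true f Pk
least-true P (suc k) Pk | inj₂ f with least-true (λ i → P (suc i)) k Pk
... | a , le , Pa , below = suc a , s≤s le , Pa , λ { zero _ → f ; (suc a') lt → below a' (s≤s⁻¹ lt) }

-- The comparison is doubled and the squares of the large parts are replaced by `M = n - k` and
-- `N = n - q'`. Expanding cancels `n * n` and leaves the linear terms `2 * k * n` and `2 * q' * n`;
-- `E` collects the rest.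
excess-arith : ∀ {k q' N M n E I Miss sq sq'} → N + q' ≡ n → M + k ≡ n → Miss + (k * k + sq) ≤ I + (q' * q' + sq') →
  M * M ≤ 2 * sq → 2 * sq' ≤ N * N + 1 → 2 * I + 3 * (q' * q') + 1 ≤ 3 * (k * k) + E → 2 * Miss + 2 * q' * n ≤ 2 * k * n + E
excess-arith {k} {q'} {N} {M} {n} {E} {I} {Miss} {sq} {sq'} eN eM main lo hi eE =
  +-cancelʳ-≤ (3 * (k * k) + n * n) _ _ (begin
    2 * Miss + 2 * q' * n + (3 * (k * k) + n * n) ≡⟨ cong (λ t → 2 * Miss + 2 * q' * n + (3 * (k * k) + t * t)) (≡-sym eM) ⟩
    2 * Miss + 2 * q' * n + (3 * (k * k) + (M + k) * (M + k)) ≡⟨ r₁ Miss (q' * n) k M q' n ⟩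
    2 * (Miss + k * k) + M * M + (2 * k * (M + k) + 2 * q' * n) ≤⟨ +-monoˡ-≤ _ (+-monoʳ-≤ (2 * (Miss + k * k)) lo) ⟩
    2 * (Miss + k * k) + 2 * sq + (2 * k * (M + k) + 2 * q' * n) ≡⟨ r₂ Miss k sq (2 * k * (M + k) + 2 * q' * n) ⟩
    2 * (Miss + (k * k + sq)) + (2 * k * (M + k) + 2 * q' * n) ≤⟨ +-monoˡ-≤ _ (*-monoʳ-≤ 2 main) ⟩
    2 * (I + (q' * q' + sq')) + (2 * k * (M + k) + 2 * q' * n) ≡⟨ r₃ I q' sq' (2 * k * (M + k) + 2 * q' * n) ⟩
    2 * I + 2 * (q' * q') + 2 * sq' + (2 * k * (M + k) + 2 * q' * n) ≤⟨ +-monoˡ-≤ _ (+-monoʳ-≤ (2 * I + 2 * (q' * q')) hi) ⟩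
    2 * I + 2 * (q' * q') + (N * N + 1) + (2 * k * (M + k) + 2 * q' * n) ≡⟨ cong₂ (λ s t → 2 * I + 2 * (q' * q') + (N * N + 1) + (2 * k * s + 2 * q' * t)) eM (≡-sym eN) ⟩
    2 * I + 2 * (q' * q') + (N * N + 1) + (2 * k * n + 2 * q' * (N + q')) ≡⟨ r₄ I q' N (2 * k * n) ⟩
    2 * k * n + (2 * I + 3 * (q' * q') + 1) + (N + q') * (N + q') ≡⟨ cong (λ t → 2 * k * n + (2 * I + 3 * (q' * q') + 1) + t * t) eN ⟩
    2 * k * n + (2 * I + 3 * (q' * q') + 1) + n * n ≤⟨ +-monoˡ-≤ (n * n) (+-monoʳ-≤ (2 * k * n) eE) ⟩
    2 * k * n + (3 * (k * k) + E) + n * n ≡⟨ r₅ (2 * k * n) (3 * (k * k)) E (n * n) ⟩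
    2 * k * n + E + (3 * (k * k) + n * n) ∎)
  where
  open ≤-Reasoning
  r₁ : ∀ Miss x k M q' n → 2 * Miss + 2 * q' * n + (3 * (k * k) + (M + k) * (M + k)) ≡ 2 * (Miss + k * k) + M * M + (2 * k * (M + k) + 2 * q' * n)
  r₁ = solve-∀
  r₂ : ∀ Miss k sq z → 2 * (Miss + k * k) + 2 * sq + z ≡ 2 * (Miss + (k * k + sq)) + z
  r₂ = solve-∀
  r₃ : ∀ I q' sq' z → 2 * (I + (q' * q' + sq')) + z ≡ 2 * I + 2 * (q' * q') + 2 * sq' + z
  r₃ = solve-∀
  r₄ : ∀ I q' N z → 2 * I + 2 * (q' * q') + (N * N + 1) + (z + 2 * q' * (N + q')) ≡ z + (2 * I + 3 * (q' * q') + 1) + (N + q') * (N + q')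
  r₄ = solve-∀
  r₅ : ∀ a b c d → a + (b + c) + d ≡ a + c + (b + d)
  r₅ = solve-∀

module Counting {h n} {H : Graph h} {G : Graph n} {q' δ θ : ℕ} (setting : Setting H G (suc q') δ θ) where
  open Setting setting
  open Cut cut
  open Parts setting
  open PartsBounds setting

  k s₁ s₂ D Missing Inside A : ℕ
  k  = count W
  s₁ = size part X
  s₂ = size part Y
  D  = degreeSum G
  Missing = pairCount (λ u v → across part u v ∧ not (adj G u v))
  Inside  = pairCount (λ u v → adj G u v ∧ not (across part u v))
  A = pairCount (across part)

  exchange : D + Missing ≡ A + Inside
  exchange = pairCount-exchange (adj G) (λ u v → across part u v ∧ not (adj G u v)) (across part) (λ u v → adj G u v ∧ not (across part u v))
    (λ u v → pt (adj G u v) (across part u v))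
    where
    pt : ∀ a b → ⟦ a ⟧ + ⟦ b ∧ not a ⟧ ≡ ⟦ b ⟧ + ⟦ a ∧ not b ⟧
    pt true  true  = refl
    pt true  false = refl
    pt false true  = refl
    pt false false = refl

  missing-bound : ∀ f c → q' + f + c ≡ n → Missing + (k * k + (s₁ * s₁ + s₂ * s₂)) ≤ Inside + (q' * q' + (f * f + c * c))
  missing-bound f c e = +-cancelˡ-≤ (A + D) _ _ (begin
    A + D + (Missing + (k * k + (s₁ * s₁ + s₂ * s₂))) ≡⟨ r₁ A D Missing (k * k) (s₁ * s₁) (s₂ * s₂) ⟩
    D + Missing + (A + (k * k + s₁ * s₁ + s₂ * s₂)) ≤⟨ +-mono-≤ (≤-reflexive exchange) (≤-trans (≤-reflexive (across-count part)) (degreeSum-lower {H = H} {G = G} ex least-S q' f c e ≤-refl)) ⟩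
    A + Inside + (D + (q' * q' + f * f + c * c)) ≡⟨ r₂ A Inside D (q' * q') (f * f) (c * c) ⟩
    A + D + (Inside + (q' * q' + (f * f + c * c))) ∎)
    where
    open ≤-Reasoning
    r₁ : ∀ A D M x y z → A + D + (M + (x + (y + z))) ≡ D + M + (A + (x + y + z))
    r₁ = solve-∀
    r₂ : ∀ A I D x y z → A + I + (D + (x + y + z)) ≡ A + D + (I + (x + (y + z)))
    r₂ = solve-∀

  -- All pairs within W are allowed for by `k * k`; each large part contributes through
  -- `inside-edges`.
  inside-bound : ∀ t → (∀ b v → inPart b v ≡ true → inDegree b v ≤ t) → Inside ≤ k * k + 8 * h * t
  inside-bound t deg≤ = begin
    Inside ≤⟨ sum-mono (λ u → ≤-trans (≤-reflexive (count-sum (R u))) (sum-mono (λ v → pt u v))) ⟩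
    sumFin (λ u → sumFin (λ v → ⟦ W u ∧ W v ⟧ + (⟦ In true u v ⟧ + ⟦ In false u v ⟧)))
      ≡⟨ sum-cong (λ u → trans (sum-+ (λ v → ⟦ W u ∧ W v ⟧) (λ v → ⟦ In true u v ⟧ + ⟦ In false u v ⟧))
           (cong₂ _+_ (≡-sym (count-sum (λ v → W u ∧ W v))) (trans (sum-+ (λ v → ⟦ In true u v ⟧) (λ v → ⟦ In false u v ⟧))
              (cong₂ _+_ (≡-sym (count-sum (In true u))) (≡-sym (count-sum (In false u))))))) ⟩
    sumFin (λ u → count (λ v → W u ∧ W v) + (count (In true u) + count (In false u)))
      ≡⟨ trans (sum-+ (λ u → count (λ v → W u ∧ W v)) (λ u → count (In true u) + count (In false u)))
           (cong₂ _+_ WW (sum-+ (λ u → count (In true u)) (λ u → count (In false u)))) ⟩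
    k * k + (pairCount (In true) + pairCount (In false)) ≤⟨ +-monoʳ-≤ (k * k) (+-mono-≤ (inside-edges true t (deg≤ true)) (inside-edges false t (deg≤ false))) ⟩
    k * k + (4 * h * t + 4 * h * t) ≡⟨ cong (k * k +_) (ring h t) ⟩
    k * k + 8 * h * t ∎
    where
    open ≤-Reasoning
    ring : ∀ h t → 4 * h * t + 4 * h * t ≡ 8 * h * t
    ring = solve-∀
    R : Fin n → Fin n → Bool
    R u v = adj G u v ∧ not (across part u v)
    In : Bool → Fin n → Fin n → Bool
    In b u v = (inPart b u ∧ inPart b v) ∧ adj G u v
    pt' : ∀ (a : Bool) (x y : Fin 3) → ⟦ a ∧ not (not (x == y)) ⟧ ≤
      ⟦ (x == S) ∧ (y == S) ⟧ + (⟦ ((x == X) ∧ (y == X)) ∧ a ⟧ + ⟦ ((x == Y) ∧ (y == Y)) ∧ a ⟧)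
    pt' false x y = z≤n
    pt' true S S = s≤s z≤n
    pt' true S X = z≤n
    pt' true S Y = z≤n
    pt' true X S = z≤n
    pt' true X X = s≤s z≤n
    pt' true X Y = z≤n
    pt' true Y S = z≤n
    pt' true Y X = z≤n
    pt' true Y Y = s≤s z≤n
    pt : ∀ u v → ⟦ R u v ⟧ ≤ ⟦ W u ∧ W v ⟧ + (⟦ In true u v ⟧ + ⟦ In false u v ⟧)
    pt u v = pt' (adj G u v) (part u) (part v)
    WW : sumFin (λ u → count (λ v → W u ∧ W v)) ≡ k * k
    WW = trans (sum-cong (λ u → row (W u))) (trans (sum-*ʳ k (λ u → ⟦ W u ⟧)) (cong (_* k) (≡-sym (count-sum W))))
      where row : ∀ b → count (λ v → b ∧ W v) ≡ ⟦ b ⟧ * k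
            row true  = ≡-sym (+-identityʳ k)
            row false = count-false n

  parts-total : s₁ + s₂ + k ≡ n
  parts-total = trans (+-comm (s₁ + s₂) k) (size-total part)

  q'≤h : q' ≤ h
  q'≤h = ≤-trans (n≤1+n q') (≤-trans (least-S _ (SpecialColouring.proper special)) (count≤n (λ v → SpecialColouring.col special v == S)))

  q'≤n : q' ≤ n
  q'≤n = ≤-trans q'≤h (≤-trans h≤Θ (≤-trans (m≤n*m Θ 200) θ-small))

  rest : Halving (n ∸ q')
  rest = halving (n ∸ q')

  rest-total : q' + Halving.f rest + Halving.c rest ≡ n
  rest-total = trans (+-assoc q' _ _) (trans (cong (q' +_) (Halving.total rest)) (m+[n∸m]≡n q'≤n))

  -- Twice the bound `8 * h * ν` on inside pairs, plus what remains of the squares after `k * k` has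
  -- been absorbed.
  E₀ : ℕ
  E₀ = 16 * h * ν + 3 * (q' * q') + 1

  E₀≤33Θ : E₀ ≤ 33 * Θ
  E₀≤33Θ = begin
    16 * h * ν + 3 * (q' * q') + 1 ≡⟨ r₁ h θ (q' * q') ⟩
    32 * (h * θ) + (3 * (q' * q') + 1) ≤⟨ +-mono-≤ (*-monoʳ-≤ 32 hθ≤Θ) (≤-trans small θ≤Θ) ⟩
    32 * Θ + Θ ≡⟨ r₂ Θ ⟩
    33 * Θ ∎
    where
    open ≤-Reasoning
    r₁ : ∀ h θ x → 16 * h * (2 * θ) + 3 * x + 1 ≡ 32 * (h * θ) + (3 * x + 1)
    r₁ = solve-∀
    r₂ : ∀ x → 32 * x + x ≡ 33 * x
    r₂ = solve-∀
    small : 3 * (q' * q') + 1 ≤ θ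
    small = ≤-trans (+-mono-≤ (*-mono-≤ {3} {4} (s≤s (s≤s (s≤s z≤n))) (*-mono-≤ q'≤h q'≤h)) (s≤s z≤n)) θ-large

  E₀<n : E₀ < n
  E₀<n = ≤-trans (s≤s E₀≤33Θ) (≤-trans (≤-trans (+-monoˡ-≤ (33 * Θ) (≤-trans θ>0 θ≤Θ)) (*-monoˡ-≤ Θ {34} {200} (m≤m+n 34 166))) θ-small)

  -- In other words, the missing ordered pairs number at most `(k - q') * n` up to half of `E₀`,
  -- which is below `n`. Members of W beyond `q'` are the only source of linearly many non-edges.
  excess : 2 * Missing + 2 * q' * n ≤ 2 * k * n + E₀
  excess = excess-arith {k} {q'} {n ∸ q'} {s₁ + s₂} {n} {E₀} {Inside} {Missing} {s₁ * s₁ + s₂ * s₂} {Halving.f rest * Halving.f rest + Halving.c rest * Halving.c rest} (m∸n+n≡m q'≤n) parts-total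
    (missing-bound (Halving.f rest) (Halving.c rest) rest-total) (square-sum-lower s₁ s₂) (Halving.balanced rest) (begin
      2 * Inside + 3 * (q' * q') + 1 ≤⟨ +-monoˡ-≤ 1 (+-monoˡ-≤ (3 * (q' * q')) (*-monoʳ-≤ 2 (inside-bound ν (λ b v e → inDegree-small b v e)))) ⟩
      2 * (k * k + 8 * h * ν) + 3 * (q' * q') + 1 ≤⟨ m≤m+n _ (k * k) ⟩
      2 * (k * k + 8 * h * ν) + 3 * (q' * q') + 1 + k * k ≡⟨ ring k h ν (q' * q') ⟩
      3 * (k * k) + E₀ ∎)
    where
    open ≤-Reasoning
    ring : ∀ k h ν x → 2 * (k * k + 8 * h * ν) + 3 * x + 1 + k * k ≡ 3 * (k * k) + (16 * h * ν + 3 * x + 1)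
    ring = solve-∀

  missW : Fin n → ℕ
  missW u = count (λ w → W w ∧ not (adj G w u))

  Q : Bool → ℕ
  Q b = pairCount (λ u w → coreIn b u ∧ (W w ∧ not (adj G w u)))

  -- A non-edge between the core and W is missing in both orders, and these are different pairs
  -- because W and the core are disjoint.
  core-W-missing : 2 * (Q true + Q false) ≤ Missing
  core-W-missing = begin
    2 * (Q true + Q false) ≡⟨ cong (2 *_) (trans (pairCount-exchange (Qb true) (Qb false) Qc (λ _ _ → false) merge) (trans (cong (pairCount Qc +_) (trans (sum-cong {n} (λ u → count-false n)) (sum-zero n))) (+-identityʳ _))) ⟩
    2 * pairCount Qc ≡⟨ trans (ring (pairCount Qc)) (cong (pairCount Qc +_) (pairCount-swap Qc)) ⟩
    pairCount Qc + pairCount (λ u v → Qc v u) ≡⟨ pairCount-+ Qc (λ u v → Qc v u) ⟩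
    sumFin (λ u → sumFin (λ v → ⟦ Qc u v ⟧ + ⟦ Qc v u ⟧)) ≤⟨ sum-mono (λ u → sum-mono (λ v → pt u v)) ⟩
    sumFin (λ u → sumFin (λ v → ⟦ across part u v ∧ not (adj G u v) ⟧)) ≡⟨ ≡-sym (pairCount-sum (λ u v → across part u v ∧ not (adj G u v))) ⟩
    Missing ∎
    where
    open ≤-Reasoning
    ring : ∀ x → 2 * x ≡ x + x
    ring = solve-∀
    Qb : Bool → Fin n → Fin n → Bool
    Qb b u w = coreIn b u ∧ (W w ∧ not (adj G w u))
    Qc : Fin n → Fin n → Bool
    Qc u w = core u ∧ (W w ∧ not (adj G w u))
    merge : ∀ u v → ⟦ Qb true u v ⟧ + ⟦ Qb false u v ⟧ ≡ ⟦ Qc u v ⟧ + 0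
    merge u v = m (core u) (side u) (W v ∧ not (adj G v u))
      where m : ∀ c s x → ⟦ (c ∧ not (s xor true)) ∧ x ⟧ + ⟦ (c ∧ not (s xor false)) ∧ x ⟧ ≡ ⟦ c ∧ x ⟧ + 0
            m false s     x = refl
            m true  true  x = refl
            m true  false x = ≡-sym (+-identityʳ _)
    part-core-≢ : ∀ u → core u ≡ true → part u ≢ S
    part-core-≢ u c e with side-of u c
    ... | b , e' = cls≢S b (trans (≡-sym (core-part b u e')) e)
    different : ∀ {u w} → Qc u w ≡ true → across part u w ≡ true × adj G w u ≡ false × W u ≡ false × core w ≡ false
    different {u} {w} e = cong not (≢⇒==-false (λ q → part-core-≢ u cu (trans q wS))) , not-elim (W w ∧ʳ (core u ∧ʳ e)) , ≢⇒==-false (part-core-≢ u cu) , ≢true (λ cw → part-core-≢ w cw wS)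
      where cu : core u ≡ true
            cu = core u ∧ˡ e
            wS : part w ≡ S
            wS = ==-sound (W w ∧ˡ (core u ∧ʳ e))
    exclusive : ∀ {x y z} → (x ≡ true → z ≡ true) → (y ≡ true → z ≡ true) → (x ≡ true → y ≡ true → ⊥) → ⟦ x ⟧ + ⟦ y ⟧ ≤ ⟦ z ⟧
    exclusive {true}  {true}  _ _ h = ⊥-elim (h refl refl)
    exclusive {true}  {false} f _ _ = ≤-trans (≤-reflexive (+-identityʳ 1)) (⟦⟧-mono {true} f)
    exclusive {false} {y}     _ g _ = ⟦⟧-mono g
    pt : ∀ u v → ⟦ Qc u v ⟧ + ⟦ Qc v u ⟧ ≤ ⟦ across part u v ∧ not (adj G u v) ⟧
    pt u v = exclusive
      (λ t → let a , na , _ = different {u} {v} t in ∧-intro a (cong not (trans (sym G u v) na)))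
      (λ t → let a , na , _ = different {v} {u} t in ∧-intro (trans (cong not (==-sym (part u) (part v))) a) (cong not na))
      (λ t t' → false≢true (proj₂ (proj₂ (proj₂ (different {u} {v} t)))) (core v ∧ˡ t'))

  excess-W : 4 * (Q true + Q false) + 2 * q' * n ≤ 2 * k * n + E₀
  excess-W = ≤-trans (+-monoˡ-≤ (2 * q' * n) (≤-trans (≤-reflexive (ring (Q true + Q false))) (*-monoʳ-≤ 2 core-W-missing))) excess
    where ring : ∀ x → 4 * x ≡ 2 * (2 * x)
          ring = solve-∀

  -- One member too few would leave a deficit of `2 * n`, more than `E₀` can cover.
  q'≤k : q' ≤ k
  q'≤k = ≮⇒≥ λ lt → <-irrefl refl (begin-strict
    2 * k * n + E₀ <⟨ +-monoʳ-< (2 * k * n) E₀<n ⟩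
    2 * k * n + n ≤⟨ m≤m+n _ n ⟩
    2 * k * n + n + n ≡⟨ ring k n ⟩
    2 * suc k * n ≤⟨ *-monoˡ-≤ n (*-monoʳ-≤ 2 lt) ⟩
    2 * q' * n ≤⟨ m≤n+m _ (4 * (Q true + Q false)) ⟩
    4 * (Q true + Q false) + 2 * q' * n ≤⟨ excess-W ⟩
    2 * k * n + E₀ ∎)
    where
    open ≤-Reasoning
    ring : ∀ k n → 2 * k * n + n + n ≡ 2 * suc k * n
    ring = solve-∀

  missW≤k : ∀ u → missW u ≤ k
  missW≤k u = count-mono (λ w → W w ∧ not (adj G w u)) W (λ w e → W w ∧ˡ e)

-- Types of core vertices and the exact size of W.

special-others : ∀ {h q'} {H : Graph h} (sp : SpecialColouring H (suc q')) →
  count (λ x → (SpecialColouring.col sp x == S) ∧ not (x == SpecialColouring.s sp)) ≤ q'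
special-others sp = s≤s⁻¹ (≤-trans (≤-trans
    (+-monoˡ-≤ (count (λ x → (col x == S) ∧ not (x == s))) (∃⇒count>0 (λ x → (col x == S) ∧ (x == s)) {s} (∧-intro (==-complete s-S) (==-refl s))))
    (≤-reflexive (≡-sym (count-split (λ x → col x == S) (λ x → x == s))))) small)
  where open SpecialColouring sp

-- `σ b` is a set of members of W seen in full by a large pool in `coreIn b`. The hypothesis
-- `type-sizes` bounds the sum of the two set sizes, written as union plus intersection.
module Selection {h n} {H : Graph h} {G : Graph n} {q' δ θ : ℕ} (setting : Setting H G (suc q') δ θ)
  (σ : Bool → Fin n → Bool) (σ⊆W : ∀ b w → σ b w ≡ true → Parts.W setting w ≡ true)
  (pool-big : ∀ b → h + h * δ ≤ count (λ u → Cut.coreIn (Setting.cut setting) b u ∧ common (vertices n) (σ b) (adj G) u))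
  (type-sizes : count (Parts.W setting) + q' ≤ count (λ w → σ true w ∨ σ false w) + count (λ w → σ true w ∧ σ false w)) where
  open Setting setting
  open Cut cut
  open Parts setting
  open PartsBounds setting
  open Counting setting using (k; q'≤k)

  pool : Bool → Fin n → Bool
  pool b u = coreIn b u ∧ common (vertices n) (σ b) (adj G) u

  pool-adj : ∀ b {w u} → pool b u ≡ true → σ b w ≡ true → adj G w u ≡ true
  pool-adj b {w} {u} e s = common-elim (vertices n) (σ b) (adj G) {u} {w} (coreIn b u ∧ʳ e) s

  both : Fin n → Bool
  both w = σ true w ∧ σ false w

  both⊆ : ∀ b w → both w ≡ true → σ b w ≡ true
  both⊆ true  w e = σ true w ∧ˡ e
  both⊆ false w e = σ true w ∧ʳ e

  ∨-elim : ∀ a {b} → a ∨ b ≡ true → a ≡ true ⊎ b ≡ true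
  ∨-elim true  _ = inj₁ refl
  ∨-elim false e = inj₂ e

  either : Fin n → Bool
  either w = σ true w ∨ σ false w

  either≤k : count either ≤ k
  either≤k = count-mono either W (λ w e → case ∨-elim (σ true w) e of λ { (inj₁ s) → σ⊆W true w s ; (inj₂ s) → σ⊆W false w s })

  q'≤both : q' ≤ count both
  q'≤both = +-cancelˡ-≤ k _ _ (≤-trans type-sizes (+-monoˡ-≤ (count both) either≤k))

  -- The union has at most `k` elements, so the intersection has at least `q'`. If the two sets
  -- differ, `w` is taken outside the intersection. If they agree, twice their size is at least
  -- `k + q'`, hence above `2 * q'`, and a vertex of the intersection can be spared.
  extra-vertex : q' < k → ∃ λ w → either w ≡ true × q' ≤ count (λ x → both x ∧ not (x == w))
  extra-vertex lt with find (λ w → either w ∧ not (both w))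
  ... | inj₁ (w , e) = w , either w ∧ˡ e , ≤-trans q'≤both (count-mono both (λ x → both x ∧ not (x == w))
          (λ x bx → ∧-intro bx (cong not (≢⇒==-false (λ q → false≢true (not-elim (either w ∧ʳ e)) (subst (λ z → both z ≡ true) q bx))))))
  ... | inj₂ none = w , either-w , s≤s⁻¹ (≤-trans more (count-remove both w))
    where
    either⊆both : ∀ w → either w ≡ true → both w ≡ true
    either⊆both w e with bool-cases (both w)
    ... | inj₁ t = t
    ... | inj₂ f = false≢true (none w) (∧-intro e (cong not f))
    more : suc q' ≤ count both
    more = ≮⇒≥ λ few → <-irrefl refl (begin-strict
      count both + count both <⟨ +-mono-≤ few (s≤s⁻¹ few) ⟩
      suc q' + q' ≤⟨ +-monoˡ-≤ q' lt ⟩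
      k + q' ≤⟨ type-sizes ⟩
      count either + count both ≤⟨ +-monoˡ-≤ (count both) (count-mono either both either⊆both) ⟩
      count both + count both ∎)
      where open ≤-Reasoning
    some-w : ∃ λ w → both w ≡ true
    some-w = count>0⇒∃ both (≤-trans (s≤s z≤n) more)
    w : Fin n
    w = proj₁ some-w
    either-w : either w ≡ true
    either-w = cong (_∨ σ false w) (both⊆ true w (proj₂ some-w))

  -- Here `w` carries `s` and members of both types carry the other S-vertices. Y goes to the pool
  -- of side `b`, which sees all of them, and ordinary X-vertices to the other pool. The
  -- X-neighbours of `s` go to neighbours of `w` in that other core: there are more than `θ` of
  -- these, and by `private-leaves` they have no further requirement.
  too-many : ∀ b w → σ b w ≡ true → q' ≤ count (λ x → both x ∧ not (x == w)) → ⊥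
  too-many b w σw enough = core-embedding (not b) col proper place cand (pool b) inj place-W D-core
      (λ z e → subst (λ b' → coreIn b' z ≡ true) (≡-sym (not-involutive b)) (coreIn b z ∧ˡ e)) D-big D-edge
      (λ t z ct e → pool-adj b e (place-σ t ct)) (pool-big b)
    where
    open SpecialColouring special
    others : Fin h → Bool
    others x = (col x == S) ∧ not (x == s)
    f : Σ (Fin h → Fin n) λ f → (∀ x → others x ≡ true → (both (f x) ∧ not (f x == w)) ≡ true) ×
      (∀ x y → others x ≡ true → others y ≡ true → f x ≡ f y → x ≡ y)
    f = partial-injection others (λ x → both x ∧ not (x == w)) v₀ (≤-trans (special-others special) enough)
    place : Fin h → Fin n
    place x = if x == s then w else proj₁ f x
    data Placed (x : Fin h) : Set where
      isSpecial : x ≡ s → place x ≡ w → Placed x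
      isOther   : x ≢ s → others x ≡ true → place x ≡ proj₁ f x → Placed x
    placed : ∀ x → col x ≡ S → Placed x
    placed x cx with bool-cases (x == s)
    ... | inj₁ t = isSpecial (==-sound t) (cong (λ b → if b then w else proj₁ f x) t)
    ... | inj₂ t = isOther (==-false t) (∧-intro (==-complete cx) (cong not t)) (cong (λ b → if b then w else proj₁ f x) t)
    f-both : ∀ {x} → others x ≡ true → both (proj₁ f x) ≡ true
    f-both {x} o = both (proj₁ f x) ∧ˡ proj₁ (proj₂ f) x o
    f-≢w : ∀ {x} → others x ≡ true → proj₁ f x ≢ w
    f-≢w {x} o = ==-false (not-elim (both (proj₁ f x) ∧ʳ proj₁ (proj₂ f) x o))
    place-σ : ∀ t → col t ≡ S → σ b (place t) ≡ true
    place-σ t ct with placed t ct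
    ... | isSpecial _ e = trans (cong (σ b) e) σw
    ... | isOther _ o e = trans (cong (σ b) e) (both⊆ b _ (f-both o))
    place-W : ∀ t → col t ≡ S → W (place t) ≡ true
    place-W t ct = σ⊆W b _ (place-σ t ct)
    inj : ∀ x y → col x ≡ S → col y ≡ S → place x ≡ place y → x ≡ y
    inj x y cx cy e with placed x cx | placed y cy
    ... | isSpecial refl _ | isSpecial refl _ = refl
    ... | isSpecial _ u | isOther _ o v = ⊥-elim (f-≢w o (trans (≡-sym v) (trans (≡-sym e) u)))
    ... | isOther _ o u | isSpecial _ v = ⊥-elim (f-≢w o (trans (≡-sym u) (trans e v)))
    ... | isOther _ o u | isOther _ o' v = proj₂ (proj₂ f) x y o o' (trans (≡-sym u) (trans e v))
    near : Fin n → Bool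
    near z = coreIn (not b) z ∧ adj G w z
    cand : Fin h → Fin n → Bool
    cand x = if adj H s x then near else pool (not b)
    D-cases : ∀ x z → cand x z ≡ true → (adj H s x ≡ true × near z ≡ true) ⊎ (adj H s x ≡ false × pool (not b) z ≡ true)
    D-cases x z e with bool-cases (adj H s x)
    ... | inj₁ t = inj₁ (t , trans (cong (λ c → (if c then near else pool (not b)) z) (≡-sym t)) e)
    ... | inj₂ t = inj₂ (t , trans (cong (λ c → (if c then near else pool (not b)) z) (≡-sym t)) e)
    D-core : ∀ x z → cand x z ≡ true → coreIn (not b) z ≡ true
    D-core x z e with D-cases x z e
    ... | inj₁ (_ , p) = coreIn (not b) z ∧ˡ p
    ... | inj₂ (_ , p) = coreIn (not b) z ∧ˡ p
    h≤θ : h ≤ θ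
    h≤θ = ≤-trans h≤hh (≤-trans (≤-trans (m≤n*m (h * h) 4) (m≤m+n _ 4)) θ-large)
    D-big : ∀ x → col x ≡ X → h ≤ count (cand x)
    D-big x _ with bool-cases (adj H s x)
    ... | inj₁ t = ≤-trans (≤-trans h≤θ (<⇒≤ (part-W w (==-sound (σ⊆W b w σw)) (not b)))) (≤-reflexive (cong (λ c → count (if c then near else pool (not b))) (≡-sym t)))
    ... | inj₂ t = ≤-trans (≤-trans (m≤m+n h (h * δ)) (pool-big (not b))) (≤-reflexive (cong (λ c → count (if c then near else pool (not b))) (≡-sym t)))
    D-edge : ∀ x t z → col x ≡ X → col t ≡ S → adj H t x ≡ true → cand x z ≡ true → adj G (place t) z ≡ true
    D-edge x t z cx ct tx e with D-cases x z e | placed t ct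
    ... | inj₁ (_ , p) | isSpecial _ u = trans (cong (λ v → adj G v z) u) (coreIn (not b) z ∧ʳ p)
    ... | inj₁ (sx , p) | isOther ne _ _ = ⊥-elim (ne (private-leaves x t cx ct sx tx))
    ... | inj₂ (nsx , p) | isSpecial refl _ = false≢true nsx tx
    ... | inj₂ (_ , p) | isOther _ o u = trans (cong (λ v → adj G v z) u) (pool-adj (not b) p (both⊆ (not b) _ (f-both o)))

  W-exact : k ≡ q'
  W-exact = ≤-antisym (≮⇒≥ λ lt → case extra-vertex lt of λ { (w , e , enough) →
    case ∨-elim (σ true w) e of λ { (inj₁ s) → too-many true w s enough ; (inj₂ s) → too-many false w s enough } }) q'≤k

module Types {h n} {H : Graph h} {G : Graph n} {q' δ θ : ℕ} (setting : Setting H G (suc q') δ θ) (τ K : ℕ)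
  (k<K : count (Parts.W setting) < K) (τ-small : 2 * K * (4 * τ + 6 * δ) ≤ n) (τ-large : 2 ^ K * (h + h * δ) ≤ τ) where
  open Setting setting
  open Cut cut
  open Parts setting
  open PartsBounds setting
  open Counting setting

  τ>0 : 0 < τ
  τ>0 = ≤-trans (*-mono-≤ (m^n>0 2 K) (≤-trans h>0 (m≤m+n h (h * δ)))) τ-large

  τ≤core : ∀ b → τ ≤ coreSize b
  τ≤core b = *-cancelˡ-≤ 3 (begin
    3 * τ ≤⟨ *-monoˡ-≤ τ {3} {4} (s≤s (s≤s (s≤s z≤n))) ⟩
    4 * τ ≤⟨ m≤m+n (4 * τ) (6 * δ) ⟩
    4 * τ + 6 * δ ≤⟨ m≤n*m (4 * τ + 6 * δ) (2 * K) ⦃ >-nonZero (*-mono-≤ {1} {2} (s≤s z≤n) (≤-trans (s≤s z≤n) k<K)) ⦄ ⟩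
    2 * K * (4 * τ + 6 * δ) ≤⟨ τ-small ⟩
    n ≤⟨ large b ⟩
    2 * coreSize b + 3 * δ ≤⟨ +-monoʳ-≤ (2 * coreSize b) (≤-trans (*-monoʳ-≤ 3 (≤-trans δ≤θ θ≤Θ)) (Θ≤core 3 b {s≤s (s≤s (s≤s z≤n))})) ⟩
    2 * coreSize b + coreSize b ≡⟨ ring (coreSize b) ⟩
    3 * coreSize b ∎)
    where
    open ≤-Reasoning
    ring : ∀ x → 2 * x + x ≡ 3 * x
    ring = solve-∀

  light : Bool → ℕ → Fin n → Bool
  light b a u = coreIn b u ∧ (missW u ≤ᵇ a)

  -- The least `a` for which at least `τ` vertices of `coreIn b` miss at most `a` members of W.
  -- Leastness forces missing pairs, while the `τ` vertices supply a type.
  typical : ∀ b → ∃ λ a → a ≤ k × (τ ≤ᵇ count (light b a)) ≡ true × (∀ a' → a' < a → (τ ≤ᵇ count (light b a')) ≡ false)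
  typical b = least-true (λ a → τ ≤ᵇ count (light b a)) k
    (≤ᵇ-complete (≤-trans (τ≤core b) (count-mono (coreIn b) (light b k) (λ u e → ∧-intro e (≤ᵇ-complete (missW≤k u))))))

  a : Bool → ℕ
  a b = proj₁ (typical b)

  a≤k : ∀ b → a b ≤ k
  a≤k b = proj₁ (proj₂ (typical b))

  light-or-missing : ∀ (c : Bool) r m a' → (c ≡ true → m ≤ r) → ⟦ c ⟧ * suc a' ≤ r + ⟦ c ∧ (m ≤ᵇ a') ⟧ * suc a'
  light-or-missing false r m a' _ = z≤n
  light-or-missing true  r m a' le with m ≤ᵇ a' in em
  ... | true  = m≤n+m _ r
  ... | false = ≤-trans (≤-reflexive (+-identityʳ (suc a'))) (≤-trans (≤ᵇ-false em) (≤-trans (le refl) (m≤m+n r 0)))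

  -- Fewer than `τ` core vertices miss fewer than `a` members, so all others contribute at least `a`
  -- pairs each to `Q b`.
  missing-mass : ∀ b a → (∀ a' → a' < a → (τ ≤ᵇ count (light b a')) ≡ false) → a * coreSize b ≤ Q b + a * τ
  missing-mass b zero     below = z≤n
  missing-mass b (suc a') below = begin
    suc a' * coreSize b ≡⟨ trans (*-comm (suc a') (coreSize b)) (trans (cong (_* suc a') (count-sum (coreIn b))) (≡-sym (sum-*ʳ (suc a') (λ u → ⟦ coreIn b u ⟧)))) ⟩
    sumFin (λ u → ⟦ coreIn b u ⟧ * suc a') ≤⟨ sum-mono (λ u → light-or-missing (coreIn b u) (row u) (missW u) a' (λ e → count-mono (λ w → W w ∧ not (adj G w u)) (λ w → coreIn b u ∧ (W w ∧ not (adj G w u))) (λ w e' → ∧-intro e e'))) ⟩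
    sumFin (λ u → row u + ⟦ light b a' u ⟧ * suc a')
      ≡⟨ trans (sum-+ row (λ u → ⟦ light b a' u ⟧ * suc a'))
           (cong (Q b +_) (trans (sum-*ʳ (suc a') (λ u → ⟦ light b a' u ⟧)) (cong (_* suc a') (≡-sym (count-sum (light b a')))))) ⟩
    Q b + count (light b a') * suc a' ≤⟨ +-monoʳ-≤ (Q b) (*-monoˡ-≤ (suc a') (<⇒≤ (≤ᵇ-false {τ} {count (light b a')} (below a' ≤-refl)))) ⟩
    Q b + τ * suc a' ≡⟨ cong (Q b +_) (*-comm τ (suc a')) ⟩
    Q b + suc a' * τ ∎
    where
    open ≤-Reasoning
    row : Fin n → ℕ
    row u = count (λ w → coreIn b u ∧ (W w ∧ not (adj G w u)))

  -- The missing pairs forced on the two cores, about `a b * n / 2` for each, must fit into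
  -- `excess-W`. Exceeding `k` by one would cost `2 * n`, but `E₀` and the errors from `τ` and `δ`
  -- stay below `2 * n` together.
  a-sum : a true + a false + q' ≤ k
  a-sum = ≮⇒≥ λ lt → <-irrefl refl (begin-strict
    2 * k * n + E₀ + n <⟨ +-monoˡ-< n (+-monoʳ-< (2 * k * n) E₀<n) ⟩
    2 * k * n + n + n ≡⟨ r₁ k n ⟩
    2 * suc k * n ≤⟨ *-monoˡ-≤ n (*-monoʳ-≤ 2 lt) ⟩
    2 * (a true + a false + q') * n ≡⟨ r₂ (a true) (a false) q' n ⟩
    2 * (a true * n) + 2 * (a false * n) + 2 * q' * n ≤⟨ +-monoˡ-≤ (2 * q' * n) (+-mono-≤ (*-monoʳ-≤ 2 (side-mass true)) (*-monoʳ-≤ 2 (side-mass false))) ⟩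
    2 * (2 * Q true + a true * (2 * τ + 3 * δ)) + 2 * (2 * Q false + a false * (2 * τ + 3 * δ)) + 2 * q' * n ≡⟨ r₃ (Q true) (Q false) (a true) (a false) τ δ (2 * q' * n) ⟩
    4 * (Q true + Q false) + 2 * q' * n + (a true + a false) * (4 * τ + 6 * δ) ≤⟨ +-mono-≤ excess-W (≤-trans (*-monoˡ-≤ (4 * τ + 6 * δ) (≤-trans (+-mono-≤ (a≤k true) (a≤k false)) two)) τ-small) ⟩
    2 * k * n + E₀ + n ∎)
    where
    open ≤-Reasoning
    r₁ : ∀ k n → 2 * k * n + n + n ≡ 2 * suc k * n
    r₁ = solve-∀
    r₂ : ∀ a b q n → 2 * (a + b + q) * n ≡ 2 * (a * n) + 2 * (b * n) + 2 * q * n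
    r₂ = solve-∀
    r₃ : ∀ x y a b t d z → 2 * (2 * x + a * (2 * t + 3 * d)) + 2 * (2 * y + b * (2 * t + 3 * d)) + z ≡ 4 * (x + y) + z + (a + b) * (4 * t + 6 * d)
    r₃ = solve-∀
    r₄ : ∀ a c d → a * (2 * c + 3 * d) ≡ 2 * (a * c) + 3 * (a * d)
    r₄ = solve-∀
    r₅ : ∀ a q t d → 2 * (q + a * t) + 3 * (a * d) ≡ 2 * q + a * (2 * t + 3 * d)
    r₅ = solve-∀
    r₆ : ∀ k → k + k ≡ 2 * k
    r₆ = solve-∀
    two : k + k ≤ 2 * K
    two = ≤-trans (≤-reflexive (r₆ k)) (*-monoʳ-≤ 2 (<⇒≤ k<K))
    side-mass : ∀ b → a b * n ≤ 2 * Q b + a b * (2 * τ + 3 * δ)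
    side-mass b = begin
      a b * n ≤⟨ *-monoʳ-≤ (a b) (large b) ⟩
      a b * (2 * coreSize b + 3 * δ) ≡⟨ r₄ (a b) (coreSize b) δ ⟩
      2 * (a b * coreSize b) + 3 * (a b * δ) ≤⟨ +-monoˡ-≤ _ (*-monoʳ-≤ 2 (missing-mass b (a b) (proj₂ (proj₂ (proj₂ (typical b)))))) ⟩
      2 * (Q b + a b * τ) + 3 * (a b * δ) ≡⟨ r₅ (a b) (Q b) τ δ ⟩
      2 * Q b + a b * (2 * τ + 3 * δ) ∎

  -- The `τ` light vertices each see at least `k - a b` members of W. Pigeonholing over the subsets
  -- of W costs `2 ^ k` and leaves one set that is seen by many of them.
  type-of : ∀ b → Σ (Fin n → Bool) λ σ → (∀ w → σ w ≡ true → W w ≡ true) × count σ ≡ k ∸ a b ×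
    h + h * δ ≤ count (λ u → coreIn b u ∧ common (vertices n) σ (adj G) u)
  type-of b = proj₁ found , proj₁ (proj₂ found) , proj₁ (proj₂ (proj₂ found)) ,
    *-cancelˡ-≤ (2 ^ k) ⦃ >-nonZero (m^n>0 2 k) ⦄ (begin
      2 ^ k * (h + h * δ) ≤⟨ *-monoˡ-≤ (h + h * δ) (^-monoʳ-≤ 2 (<⇒≤ k<K)) ⟩
      2 ^ K * (h + h * δ) ≤⟨ τ-large ⟩
      τ ≤⟨ heavy ⟩
      Integral.measure (vertices n) (λ u → coreIn b u ∧ (k ∸ a b ≤ᵇ multiplicity (vertices n) W (adj G) u)) ≤⟨ proj₂ (proj₂ (proj₂ found)) ⟩
      2 ^ k * Integral.measure (vertices n) (λ u → coreIn b u ∧ common (vertices n) (proj₁ found) (adj G) u)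
        ≡⟨ cong (2 ^ k *_) (≡-sym (count-sum (λ u → coreIn b u ∧ common (vertices n) (proj₁ found) (adj G) u))) ⟩
      2 ^ k * count (λ u → coreIn b u ∧ common (vertices n) (proj₁ found) (adj G) u) ∎)
    where
    open ≤-Reasoning
    seen : ∀ u → missW u ≤ a b → k ∸ a b ≤ multiplicity (vertices n) W (adj G) u
    seen u le = ≤-trans (∸-monoʳ-≤ k le) (≤-trans (∸-monoˡ-≤ (missW u) (≤-reflexive (count-split W (λ w → adj G w u))))
      (≤-reflexive (m+n∸n≡m (multiplicity (vertices n) W (adj G) u) (missW u))))
    heavy : τ ≤ Integral.measure (vertices n) (λ u → coreIn b u ∧ (k ∸ a b ≤ᵇ multiplicity (vertices n) W (adj G) u))
    heavy = ≤-trans (≤ᵇ-sound (proj₁ (proj₂ (proj₂ (typical b))))) (≤-trans (≤-reflexive (count-sum (light b (a b))))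
      (Integral.measure-mono (vertices n) (λ u e → ∧-intro (coreIn b u ∧ˡ e) (≤ᵇ-complete (seen u (≤ᵇ-sound (coreIn b u ∧ʳ e)))))))
    found : Σ (Fin n → Bool) λ σ → (∀ w → σ w ≡ true → W w ≡ true) × count σ ≡ k ∸ a b ×
        Integral.measure (vertices n) (λ u → coreIn b u ∧ (k ∸ a b ≤ᵇ multiplicity (vertices n) W (adj G) u)) ≤
          2 ^ k * Integral.measure (vertices n) (λ u → coreIn b u ∧ common (vertices n) σ (adj G) u)
    found = common-members (vertices n) W (adj G) (k ∸ a b) (coreIn b) (≤-trans τ>0 heavy)

  σ : Bool → Fin n → Bool
  σ b = proj₁ (type-of b)

  σ⊆W : ∀ b w → σ b w ≡ true → W w ≡ true
  σ⊆W b = proj₁ (proj₂ (type-of b))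

  type-sizes : k + q' ≤ count (λ w → σ true w ∨ σ false w) + count (λ w → σ true w ∧ σ false w)
  type-sizes = ≤-trans (+-cancelʳ-≤ (a true + a false) _ _ (begin
    k + q' + (a true + a false) ≡⟨ r₁ k q' (a true + a false) ⟩
    k + (a true + a false + q') ≤⟨ +-monoʳ-≤ k a-sum ⟩
    k + k ≡⟨ cong₂ _+_ (≡-sym (m∸n+n≡m (a≤k true))) (≡-sym (m∸n+n≡m (a≤k false))) ⟩
    (k ∸ a true) + a true + ((k ∸ a false) + a false) ≡⟨ interchange (k ∸ a true) (a true) (k ∸ a false) (a false) ⟩
    (k ∸ a true) + (k ∸ a false) + (a true + a false) ∎))
    (≤-reflexive (trans (cong₂ _+_ (≡-sym (proj₁ (proj₂ (proj₂ (type-of true))))) (≡-sym (proj₁ (proj₂ (proj₂ (type-of false)))))) (≡-sym (count-∨∧ (σ true) (σ false)))))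
    where
    open ≤-Reasoning
    r₁ : ∀ k q s → k + q + s ≡ k + (s + q)
    r₁ = solve-∀

  W-exact : k ≡ q'
  W-exact = Selection.W-exact setting σ σ⊆W (λ b → proj₂ (proj₂ (proj₂ (type-of b)))) type-sizes

-- Exact structure

module Exact {h n} {H : Graph h} {G : Graph n} {q' δ θ : ℕ} (setting : Setting H G (suc q') δ θ)
  (W-exact : count (Parts.W setting) ≡ q') where
  open Setting setting
  open Cut cut
  open Parts setting
  open PartsBounds setting
  open Counting setting

  -- With `k = q'` the linear terms of `excess-W` cancel and `4 * Q b` is bounded by `E₀`; 33 is
  -- rounded up to 36 for division by four.
  Q-small : ∀ b → Q b ≤ 9 * Θ
  Q-small b = ≤-trans (one b) (*-cancelˡ-≤ 4 (≤-trans (+-cancelʳ-≤ (2 * q' * n) _ _ (≤-trans excess-W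
    (≤-reflexive (trans (cong (λ t → 2 * t * n + E₀) W-exact) (+-comm (2 * q' * n) E₀)))))
    (≤-trans E₀≤33Θ (≤-trans (*-monoˡ-≤ Θ {33} {36} (m≤m+n 33 3)) (≤-reflexive (ring Θ))))))
    where
    ring : ∀ x → 36 * x ≡ 4 * (9 * x)
    ring = solve-∀
    one : ∀ b → Q b ≤ Q true + Q false
    one true  = m≤m+n _ _
    one false = m≤n+m _ (Q true)

  full : Fin n → Bool
  full u = missW u ≤ᵇ 0

  full-adj : ∀ {u w} → full u ≡ true → W w ≡ true → adj G w u ≡ true
  full-adj {u} {w} e Ww with bool-cases (adj G w u)
  ... | inj₁ t = t
  ... | inj₂ f = ⊥-elim (<⇒≱ (∃⇒count>0 (λ w → W w ∧ not (adj G w u)) (∧-intro Ww (cong not f))) (≤ᵇ-sound e))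

  fullIn : Bool → Fin n → Bool
  fullIn b u = coreIn b u ∧ full u

  -- Each core vertex that is not full contributes at least one pair to `Q b`.
  full-many : ∀ b → coreSize b ≤ count (fullIn b) + 9 * Θ
  full-many b = begin
    coreSize b ≡⟨ count-split (coreIn b) full ⟩
    count (fullIn b) + count (λ u → coreIn b u ∧ not (full u)) ≡⟨ cong (count (fullIn b) +_) (count-sum (λ u → coreIn b u ∧ not (full u))) ⟩
    count (fullIn b) + sumFin (λ u → ⟦ coreIn b u ∧ not (full u) ⟧) ≤⟨ +-monoʳ-≤ (count (fullIn b)) (sum-mono (λ u → pt (coreIn b u) (missW u) _
       (λ e → count-mono (λ w → W w ∧ not (adj G w u)) (λ w → coreIn b u ∧ (W w ∧ not (adj G w u))) (λ w e' → ∧-intro e e')))) ⟩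
    count (fullIn b) + Q b ≤⟨ +-monoʳ-≤ (count (fullIn b)) (Q-small b) ⟩
    count (fullIn b) + 9 * Θ ∎
    where
    open ≤-Reasoning
    pt : ∀ c m r → (c ≡ true → m ≤ r) → ⟦ c ∧ not (m ≤ᵇ 0) ⟧ ≤ r
    pt false m       r _  = z≤n
    pt true  zero    r _  = z≤n
    pt true  (suc m) r le = ≤-trans (s≤s z≤n) (le refl)

  part≢W : ∀ b {z w} → inPart b z ≡ true → W w ≡ true → z ≢ w
  part≢W b e e' refl = cls≢S b (trans (≡-sym (==-sound e)) (==-sound e'))

  -- With `h` neighbours in its own part, `v` could carry `s`, and W has exactly room for the other
  -- S-vertices. The X-neighbours of `s` go to these neighbours, other X-vertices to full core
  -- vertices of part `b`, and Y to full neighbours of `v` in the opposite core. The neighbours of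
  -- `v` may lie outside the core, so they are only known to miss at most `ν`.
  inDegree<h : ∀ b v → inPart b v ≡ true → inDegree b v < h
  inDegree<h b v bv = ≰⇒> λ large-degree → free (embed-colouring H G col proper place cand P ν inj (big large-degree) fresh edge miss-small P-edge P-big)
    where
    open SpecialColouring special
    others : Fin h → Bool
    others x = (col x == S) ∧ not (x == s)
    f : Σ (Fin h → Fin n) λ f → (∀ x → others x ≡ true → W (f x) ≡ true) × (∀ x y → others x ≡ true → others y ≡ true → f x ≡ f y → x ≡ y)
    f = partial-injection others W v₀ (≤-trans (special-others special) (≤-reflexive (≡-sym W-exact)))
    place : Fin h → Fin n
    place x = if x == s then v else proj₁ f x
    data Placed (x : Fin h) : Set where
      isSpecial : x ≡ s → place x ≡ v → Placed x
      isOther   : x ≢ s → others x ≡ true → place x ≡ proj₁ f x → Placed x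
    placed : ∀ x → col x ≡ S → Placed x
    placed x cx with bool-cases (x == s)
    ... | inj₁ t = isSpecial (==-sound t) (cong (λ b → if b then v else proj₁ f x) t)
    ... | inj₂ t = isOther (==-false t) (∧-intro (==-complete cx) (cong not t)) (cong (λ b → if b then v else proj₁ f x) t)
    fW : ∀ {x} → others x ≡ true → W (proj₁ f x) ≡ true
    fW {x} = proj₁ (proj₂ f) x
    inj : ∀ x y → col x ≡ S → col y ≡ S → place x ≡ place y → x ≡ y
    inj x y cx cy e with placed x cx | placed y cy
    ... | isSpecial refl _ | isSpecial refl _ = refl
    ... | isSpecial _ u | isOther _ o t = ⊥-elim (part≢W b bv (fW o) (trans (≡-sym u) (trans e t)))
    ... | isOther _ o u | isSpecial _ t = ⊥-elim (part≢W b bv (fW o) (trans (≡-sym t) (trans (≡-sym e) u)))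
    ... | isOther _ o u | isOther _ o' t = proj₂ (proj₂ f) x y o o' (trans (≡-sym u) (trans e t))
    near generic P : Fin n → Bool
    near u    = adj G v u ∧ inPart b u
    generic u = fullIn b u ∧ not (u == v)
    P u       = fullIn (not b) u ∧ adj G v u
    cand : Fin h → Fin n → Bool
    cand x = if adj H s x then near else generic
    cand-cases : ∀ x z → cand x z ≡ true → (adj H s x ≡ true × near z ≡ true) ⊎ (adj H s x ≡ false × generic z ≡ true)
    cand-cases x z e with bool-cases (adj H s x)
    ... | inj₁ t = inj₁ (t , trans (cong (λ c → (if c then near else generic) z) (≡-sym t)) e)
    ... | inj₂ t = inj₂ (t , trans (cong (λ c → (if c then near else generic) z) (≡-sym t)) e)
    generic-core : ∀ z → generic z ≡ true → coreIn b z ≡ true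
    generic-core z e = coreIn b z ∧ˡ (fullIn b z ∧ˡ e)
    cand-part : ∀ x z → cand x z ≡ true → inPart b z ≡ true
    cand-part x z e with cand-cases x z e
    ... | inj₁ (_ , p) = adj G v z ∧ʳ p
    ... | inj₂ (_ , p) = ==-complete (core-part b z (generic-core z p))
    cand-≢v : ∀ x z → cand x z ≡ true → z ≢ v
    cand-≢v x z e with cand-cases x z e
    ... | inj₁ (_ , p) = λ q → adj⇒≢ G (adj G v z ∧ˡ p) (≡-sym q)
    ... | inj₂ (_ , p) = ==-false (not-elim (fullIn b z ∧ʳ p))
    generic-big : h ≤ count generic
    generic-big = +-cancelʳ-≤ (1 + 9 * Θ) _ _ (begin
      h + (1 + 9 * Θ) ≤⟨ +-mono-≤ h≤Θ (+-monoˡ-≤ (9 * Θ) (≤-trans θ>0 θ≤Θ)) ⟩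
      Θ + (Θ + 9 * Θ) ≡⟨ ring Θ ⟩
      11 * Θ ≤⟨ *-monoˡ-≤ Θ {11} {98} (m≤m+n 11 87) ⟩
      98 * Θ ≤⟨ core-large b ⟩
      coreSize b ≤⟨ full-many b ⟩
      count (fullIn b) + 9 * Θ ≤⟨ +-monoˡ-≤ (9 * Θ) (count-remove (fullIn b) v) ⟩
      suc (count generic) + 9 * Θ ≡⟨ ≡-sym (+-suc (count generic) (9 * Θ)) ⟩
      count generic + (1 + 9 * Θ) ∎)
      where
      open ≤-Reasoning
      ring : ∀ x → x + (x + 9 * x) ≡ 11 * x
      ring = solve-∀
    big : h ≤ inDegree b v → ∀ x → col x ≡ X → h ≤ count (cand x)
    big large-degree x _ with bool-cases (adj H s x)
    ... | inj₁ t = ≤-trans large-degree (≤-reflexive (cong (λ c → count (if c then near else generic)) (≡-sym t)))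
    ... | inj₂ t = ≤-trans generic-big (≤-reflexive (cong (λ c → count (if c then near else generic)) (≡-sym t)))
    fresh : ∀ x t z → col x ≡ X → col t ≡ S → cand x z ≡ true → z ≢ place t
    fresh x t z _ ct e q with placed t ct
    ... | isSpecial _ u = cand-≢v x z e (trans q u)
    ... | isOther _ o u = part≢W b (cand-part x z e) (fW o) (trans q u)
    edge : ∀ x t z → col x ≡ X → col t ≡ S → adj H t x ≡ true → cand x z ≡ true → adj G (place t) z ≡ true
    edge x t z cx ct tx e with cand-cases x z e | placed t ct
    ... | inj₁ (_ , p) | isSpecial _ u = trans (cong (λ w → adj G w z) u) (adj G v z ∧ˡ p)
    ... | inj₁ (sx , p) | isOther ne _ _ = ⊥-elim (ne (private-leaves x t cx ct sx tx))
    ... | inj₂ (nsx , p) | isSpecial refl _ = false≢true nsx tx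
    ... | inj₂ (_ , p) | isOther _ o u = trans (cong (λ w → adj G w z) u) (full-adj (coreIn b z ∧ʳ (fullIn b z ∧ˡ p)) (fW o))
    miss-small : ∀ x z → col x ≡ X → cand x z ≡ true → count (λ y → P y ∧ not (adj G z y)) ≤ ν
    miss-small x z _ e = ≤-trans (count-mono _ (λ y → coreIn (not b) y ∧ not (adj G z y)) (λ y e' → ∧-intro (coreIn (not b) y ∧ˡ (fullIn (not b) y ∧ˡ (P y ∧ˡ e'))) (P y ∧ʳ e')))
      (part-misses b z (==-sound (cand-part x z e)))
    P-edge : ∀ t z → col t ≡ S → P z ≡ true → adj G (place t) z ≡ true
    P-edge t z ct e with placed t ct
    ... | isSpecial _ u = trans (cong (λ w → adj G w z) u) (fullIn (not b) z ∧ʳ e)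
    ... | isOther _ o u = trans (cong (λ w → adj G w z) u) (full-adj (coreIn (not b) z ∧ʳ (fullIn (not b) z ∧ˡ e)) (fW o))
    P-big : h + h * ν ≤ count P
    P-big = +-cancelʳ-≤ (ν + 9 * Θ) _ _ (begin
      h + h * ν + (ν + 9 * Θ) ≤⟨ +-mono-≤ (+-mono-≤ h≤Θ (≤-trans (≤-reflexive (r₁ h θ)) (*-monoʳ-≤ 2 hθ≤Θ))) (+-monoˡ-≤ (9 * Θ) (*-monoʳ-≤ 2 θ≤Θ)) ⟩
      Θ + 2 * Θ + (2 * Θ + 9 * Θ) ≡⟨ r₂ Θ ⟩
      14 * Θ ≤⟨ *-monoˡ-≤ Θ {14} {98} (m≤m+n 14 84) ⟩
      98 * Θ ≤⟨ core-large (not b) ⟩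
      coreSize (not b) ≤⟨ full-many (not b) ⟩
      count (fullIn (not b)) + 9 * Θ ≡⟨ cong (_+ 9 * Θ) (count-split (fullIn (not b)) (adj G v)) ⟩
      count P + count (λ u → fullIn (not b) u ∧ not (adj G v u)) + 9 * Θ ≤⟨ +-monoˡ-≤ (9 * Θ) (+-monoʳ-≤ (count P) (≤-trans
        (count-mono _ (λ u → coreIn (not b) u ∧ not (adj G v u)) (λ u e → ∧-intro (coreIn (not b) u ∧ˡ (fullIn (not b) u ∧ˡ e)) (fullIn (not b) u ∧ʳ e)))
        (part-misses b v (==-sound bv)))) ⟩
      count P + ν + 9 * Θ ≡⟨ +-assoc (count P) ν (9 * Θ) ⟩
      count P + (ν + 9 * Θ) ∎)
      where
      open ≤-Reasoning
      r₁ : ∀ h θ → h * (2 * θ) ≡ 2 * (h * θ)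
      r₁ = solve-∀
      r₂ : ∀ x → x + 2 * x + (2 * x + 9 * x) ≡ 14 * x
      r₂ = solve-∀

  wrong : Fin n → Fin n → Bool
  wrong u v = adj G u v xor across part u v

  Inside≤9hh : Inside ≤ 9 * (h * h)
  Inside≤9hh = begin
    Inside ≤⟨ inside-bound h (λ b v e → <⇒≤ (inDegree<h b v e)) ⟩
    k * k + 8 * h * h ≤⟨ +-monoˡ-≤ (8 * h * h) (*-mono-≤ k≤h k≤h) ⟩
    h * h + 8 * h * h ≡⟨ ring h ⟩
    9 * (h * h) ∎
    where
    open ≤-Reasoning
    k≤h : k ≤ h
    k≤h = ≤-trans (≤-reflexive W-exact) q'≤h
    ring : ∀ h → h * h + 8 * h * h ≡ 9 * (h * h)
    ring = solve-∀

  -- The comparison graph keeps `k = q'` and splits `s₁ + s₂` into halves. Its squares are no larger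
  -- than those of the actual parts, so they drop out of `missing-bound`.
  Missing≤Inside : Missing ≤ Inside
  Missing≤Inside = +-cancelʳ-≤ (k * k + (s₁ * s₁ + s₂ * s₂)) _ _ (≤-trans (missing-bound (Halving.f halves) (Halving.c halves)
      (trans (+-assoc q' _ _) (trans (cong (q' +_) (Halving.total halves)) (trans (cong (_+ (s₁ + s₂)) (≡-sym W-exact)) (trans (+-comm k (s₁ + s₂)) parts-total)))))
    (+-monoʳ-≤ Inside (+-mono-≤ (≤-reflexive (cong (λ t → t * t) (≡-sym W-exact))) (Halving.optimal halves s₁ s₂ refl))))
    where
    halves : Halving (s₁ + s₂)
    halves = halving (s₁ + s₂)

  wrong-few : pairCount wrong ≤ 18 * (h * h)
  wrong-few = begin
    pairCount wrong ≡⟨ trans (≡-sym (+-identityʳ _)) (cong (pairCount wrong +_) (≡-sym (trans (sum-cong {n} (λ u → count-false n)) (sum-zero n)))) ⟩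
    pairCount wrong + pairCount {n} (λ _ _ → false) ≡⟨ pairCount-exchange wrong (λ _ _ → false) (λ u v → across part u v ∧ not (adj G u v)) (λ u v → adj G u v ∧ not (across part u v))
      (λ u v → pt (adj G u v) (across part u v)) ⟩
    Missing + Inside ≤⟨ +-mono-≤ (≤-trans Missing≤Inside Inside≤9hh) Inside≤9hh ⟩
    9 * (h * h) + 9 * (h * h) ≡⟨ ring (h * h) ⟩
    18 * (h * h) ∎
    where
    open ≤-Reasoning
    ring : ∀ x → 9 * x + 9 * x ≡ 18 * x
    ring = solve-∀
    pt : ∀ a b → ⟦ a xor b ⟧ + 0 ≡ ⟦ b ∧ not a ⟧ + ⟦ a ∧ not b ⟧
    pt true  true  = refl
    pt true  false = refl
    pt false true  = refl
    pt false false = refl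

  clean : Bool → Fin n → Bool
  clean b v = inPart b v ∧ (count (wrong v) ≤ᵇ 0)

  -- Each exception starts at least one wrong pair, and `wrong-few` bounds these. This is the
  -- constant of the theorem.
  clean-exceptions : ∀ b → count (λ v → inPart b v ∧ not (clean b v)) ≤ 18 * (h * h)
  clean-exceptions b = ≤-trans (≤-trans (≤-reflexive (≡-sym (*-identityʳ _))) (markov (λ v → inPart b v ∧ not (clean b v)) (λ v → count (wrong v)) 1
    (λ v e → positive (inPart b v) (count (wrong v)) e))) wrong-few
    where
    positive : ∀ c m → c ∧ not (c ∧ (m ≤ᵇ 0)) ≡ true → 1 ≤ m
    positive true (suc m) _ = s≤s z≤n

  clean-adj : ∀ b v w → clean b v ≡ true → adj G v w ≡ not (inPart b w)
  clean-adj b v w e = trans (agree (adj G v w) (across part v w) (≢true (λ q → <⇒≱ (∃⇒count>0 (wrong v) {w} q) (≤ᵇ-sound (inPart b v ∧ʳ e)))))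
    (cong not (trans (cong (_== part w) (==-sound (inPart b v ∧ˡ e))) (==-sym (cls b) (part w))))
    where
    agree : ∀ a b → a xor b ≡ false → a ≡ b
    agree true  true  _ = refl
    agree false false _ = refl

  partSize : Bool → ℕ
  partSize b = count (inPart b)

  clean-many : ∀ b → 2 + h + h * 0 ≤ count (clean b)
  clean-many b = +-cancelʳ-≤ (18 * (h * h)) _ _ (begin
    2 + h + h * 0 + 18 * (h * h) ≡⟨ cong (_+ 18 * (h * h)) (trans (cong (2 + h +_) (*-zeroʳ h)) (+-identityʳ _)) ⟩
    2 + h + 18 * (h * h) ≤⟨ +-mono-≤ (+-mono-≤ 2≤2Θ h≤Θ) (*-monoʳ-≤ 18 (m≤m*n (h * h) θ ⦃ >-nonZero θ>0 ⦄)) ⟩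
    2 * Θ + Θ + 18 * Θ ≡⟨ ring Θ ⟩
    21 * Θ ≤⟨ *-monoˡ-≤ Θ {21} {98} (m≤m+n 21 77) ⟩
    98 * Θ ≤⟨ core-large b ⟩
    coreSize b ≤⟨ count-mono (coreIn b) (inPart b) (λ v e → ==-complete (core-part b v e)) ⟩
    partSize b ≡⟨ count-split (inPart b) (clean b) ⟩
    count (λ v → inPart b v ∧ clean b v) + count (λ v → inPart b v ∧ not (clean b v)) ≤⟨ +-mono-≤ (count-mono _ (clean b) (λ v e → inPart b v ∧ʳ e)) (clean-exceptions b) ⟩
    count (clean b) + 18 * (h * h) ∎)
    where
    open ≤-Reasoning
    ring : ∀ x → 2 * x + x + 18 * x ≡ 21 * x
    ring = solve-∀
    2≤2Θ : 2 ≤ 2 * Θ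
    2≤2Θ = *-monoʳ-≤ 2 (≤-trans θ>0 θ≤Θ)

  -- A clean `v` in part `b` has degree `n - partSize b`. Moving it across gives it everything
  -- outside the other part, except itself, as neighbourhood; this keeps the graph `H`-free because
  -- all those vertices see every clean vertex of the other part. Extremality says that the move
  -- gains nothing.
  balance : ∀ b → partSize b ≤ suc (partSize (not b))
  balance b = +-cancelʳ-≤ (count outside) _ _ (begin
    partSize b + count outside ≤⟨ +-monoʳ-≤ (partSize b) (count-remove outside v) ⟩
    partSize b + suc (count (λ u → outside u ∧ not (u == v))) ≤⟨ +-monoʳ-≤ (partSize b) (s≤s (neighbourhood≤degree {H = H} {G = G} ex v outside (clean (not b)) 0 none (clean-many (not b)))) ⟩
    partSize b + suc (deg G v) ≡⟨ cong (λ t → partSize b + suc t) (count-cong (adj G v) (λ w → not (inPart b w)) (λ w → clean-adj b v w v-clean)) ⟩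
    partSize b + suc (count (λ w → not (inPart b w))) ≡⟨ trans (+-suc (partSize b) _) (cong suc (count-not (inPart b))) ⟩
    suc n ≡⟨ cong suc (≡-sym (count-not (inPart (not b)))) ⟩
    suc (partSize (not b)) + count outside ∎)
    where
    open ≤-Reasoning
    outside : Fin n → Bool
    outside u = not (inPart (not b) u)
    some : ∃ λ v → clean b v ≡ true
    some = count>0⇒∃ (clean b) (≤-trans (s≤s z≤n) (clean-many b))
    v : Fin n
    v = proj₁ some
    v-clean : clean b v ≡ true
    v-clean = proj₂ some
    none : ∀ u → outside u ≡ true → count (λ z → clean (not b) z ∧ not (adj G u z)) ≤ 0
    none u o = ≤-trans (count-mono _ (λ _ → false) (λ z e → ⊥-elim (false≢true (not-elim (clean (not b) z ∧ʳ e))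
      (adj-sym G (trans (clean-adj (not b) z u (clean (not b) z ∧ˡ e)) o))))) (≤-reflexive (count-false n))

-- Choice of constants and conclusion.

FullStructure : ∀ {h n} → Graph h → Graph n → ℕ → Set
FullStructure H G q' = Σ ℕ λ δ → Σ ℕ λ θ → Σ (Setting H G (suc q') δ θ) λ setting → count (Parts.W setting) ≡ q'

-- Comparison with the balanced complete bipartite graph, seen as tripartite with an empty first
-- part.
dense-enough : ∀ {h n q'} {H : Graph h} {G : Graph n} → IsEx n H G → ((col : Fin h → Fin 3) → Proper H col → suc q' ≤ size col S) →
  n * n ≤ 2 * degreeSum G + 1
dense-enough {n = n} {H = H} {G} ex least = +-cancelʳ-≤ (n * n) _ _ (begin
  n * n + n * n ≤⟨ +-mono-≤ lower lower ⟩
  degreeSum G + sq + (degreeSum G + sq) ≡⟨ r₁ (degreeSum G) sq ⟩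
  2 * degreeSum G + 2 * sq ≤⟨ +-monoʳ-≤ (2 * degreeSum G) balanced ⟩
  2 * degreeSum G + (n * n + 1) ≡⟨ r₂ (2 * degreeSum G) (n * n) ⟩
  2 * degreeSum G + 1 + n * n ∎)
  where
  open ≤-Reasoning
  open Halving (halving n)
  sq : ℕ
  sq = f * f + c * c
  lower : n * n ≤ degreeSum G + sq
  lower = degreeSum-lower {H = H} {G = G} ex least 0 f c total (s≤s z≤n)
  r₁ : ∀ d s → d + s + (d + s) ≡ 2 * d + 2 * s
  r₁ = solve-∀
  r₂ : ∀ d x → d + (x + 1) ≡ d + 1 + x
  r₂ = solve-∀

-- After doubling, one `n` pays for the constant term and the other for the multiple of `δ`.
room : ∀ {L n δ} c → 2 * c ≤ L → L ≤ n → L * δ ≤ n → c * suc δ ≤ n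
room {L} {n} {δ} c c≤L L≤n Lδ≤n = *-cancelˡ-≤ 2 (begin
  2 * (c * suc δ) ≡⟨ r₁ c δ ⟩
  2 * c + 2 * c * δ ≤⟨ +-mono-≤ (≤-trans c≤L L≤n) (≤-trans (*-monoˡ-≤ δ c≤L) Lδ≤n) ⟩
  n + n ≡⟨ r₂ n ⟩
  2 * n ∎)
  where
  open ≤-Reasoning
  r₁ : ∀ c δ → 2 * (c * suc δ) ≡ 2 * c + 2 * c * δ
  r₁ = solve-∀
  r₂ : ∀ n → n + n ≡ 2 * n
  r₂ = solve-∀

-- `m` is dictated by `θ-small` for `θ = n / m`. `K` and `K₁` feed the two rounds of `W-bounded`,
-- and `C₀`, `C₁` are their density losses. `M = 16 * K` makes `τ = n / M` cost at most half of the
-- room in `τ-small`, and `B` ensures that pools survive pigeonholing. `L` dominates everything, so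
-- that `δ = n / L` is negligible against `θ` and `τ`.
module Constants (h m K₁ K C₀ C₁ M B L : ℕ) (h>0 : 0 < h) (eK₁ : K₁ ≡ suc (2 * m * h)) (eK : K ≡ suc (2 * m * K₁))
  (eC₀ : C₀ ≡ 2 * m * 2 ^ K) (eC₁ : C₁ ≡ 2 * m * 2 ^ K₁) (eM : M ≡ 16 * K) (eB : B ≡ M * 2 ^ K * h)
  (em : m ≡ 200 * (h * h)) (eL : L ≡ 2 * (B + C₀ * h + C₁ * h + m) + 24 * K) where

  m>0 : 0 < m
  m>0 = ≤-trans (*-mono-≤ {1} {200} (s≤s z≤n) (*-mono-≤ h>0 h>0)) (≤-reflexive (≡-sym em))

  K>0 : 0 < K
  K>0 = ≤-trans (s≤s z≤n) (≤-reflexive (≡-sym eK))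

  M>0 : 0 < M
  M>0 = ≤-trans (*-mono-≤ {1} {16} (s≤s z≤n) K>0) (≤-reflexive (≡-sym eM))

  24K≤L : 24 * K ≤ L
  24K≤L = ≤-trans (m≤n+m (24 * K) (2 * (B + C₀ * h + C₁ * h + m))) (≤-reflexive (≡-sym eL))

  L>0 : 0 < L
  L>0 = ≤-trans (*-mono-≤ {1} {24} (s≤s z≤n) K>0) 24K≤L

  summand : ∀ {x} → x ≤ B + C₀ * h + C₁ * h + m → 2 * x ≤ L
  summand le = ≤-trans (*-monoʳ-≤ 2 le) (≤-trans (m≤m+n (2 * (B + C₀ * h + C₁ * h + m)) (24 * K)) (≤-reflexive (≡-sym eL)))

  structure : ∀ n → L + m * (4 * (h * h) + 4) ≤ n → ∀ q' (H : Graph h) (G : Graph n) → IsEx n H G →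
    SpecialColouring H (suc q') → MatchingColouring H → ((col : Fin h → Fin 3) → Proper H col → suc q' ≤ size col S) →
    Stable G L → FullStructure H G q'
  structure n n≥ q' H G ex special matching least stable = δ , θ , setting , W-exact
    where
    instance
      m≢0 : NonZero m
      m≢0 = >-nonZero m>0
      M≢0 : NonZero M
      M≢0 = >-nonZero M>0
      L≢0 : NonZero L
      L≢0 = >-nonZero L>0
    δ θ τ : ℕ
    δ = n / L
    θ = n / m
    τ = n / M
    L≤n : L ≤ n
    L≤n = ≤-trans (m≤m+n L _) n≥
    Lδ≤n : L * δ ≤ n
    Lδ≤n = quotient-≤ n L
    roomy : ∀ c → c ≤ B + C₀ * h + C₁ * h + m → c * suc δ ≤ n
    roomy c le = room c (summand le) L≤n Lδ≤n
    spread : ∀ x → x * (h + h * δ) ≡ x * h * suc δ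
    spread x = r x h δ
      where r : ∀ x h δ → x * (h + h * δ) ≡ x * h * suc δ
            r = solve-∀
    setting : Setting H G (suc q') δ θ
    setting = record
      { ex = ex ; special = special ; matching = matching ; least-S = least ; cut = stable⇒cut L stable ; h>0 = h>0
      ; δ<θ = ≤-quotient m (roomy m (m≤n+m m _))
      ; θ-large = ≤-quotient m (≤-trans (m≤n+m _ L) n≥)
      ; θ-small = ≤-trans (≤-reflexive (trans (≡-sym (*-assoc 200 (h * h) θ)) (cong (_* θ) (≡-sym em)))) (quotient-≤ n m) }
    W<K : count (Parts.W setting) < K
    W<K = PartsBounds.W-bounded setting m K₁ K C₀ C₁ (quotient-< n m ≤-refl) eK₁ eK eC₀ eC₁
      (≤-trans (≤-reflexive (spread C₀)) (roomy (C₀ * h) (≤-trans (m≤n+m (C₀ * h) B) (≤-trans (m≤m+n _ (C₁ * h)) (m≤m+n _ m)))))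
      (≤-trans (≤-reflexive (spread C₁)) (roomy (C₁ * h) (≤-trans (m≤n+m (C₁ * h) (B + C₀ * h)) (m≤m+n _ m))))
    τ-small : 2 * K * (4 * τ + 6 * δ) ≤ n
    τ-small = *-cancelˡ-≤ 2 (begin
      2 * (2 * K * (4 * τ + 6 * δ)) ≡⟨ r₁ K τ δ ⟩
      16 * K * τ + 24 * K * δ ≤⟨ +-mono-≤ (≤-trans (≤-reflexive (cong (_* τ) (≡-sym eM))) (quotient-≤ n M)) (≤-trans (*-monoˡ-≤ δ 24K≤L) Lδ≤n) ⟩
      n + n ≡⟨ r₂ n ⟩
      2 * n ∎)
      where
      open ≤-Reasoning
      r₁ : ∀ K τ δ → 2 * (2 * K * (4 * τ + 6 * δ)) ≡ 16 * K * τ + 24 * K * δ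
      r₁ = solve-∀
      r₂ : ∀ n → n + n ≡ 2 * n
      r₂ = solve-∀
    τ-large : 2 ^ K * (h + h * δ) ≤ τ
    τ-large = ≤-quotient M (≤-trans (≤-reflexive (trans (≡-sym (*-assoc M (2 ^ K) _)) (trans (spread (M * 2 ^ K)) (cong (_* suc δ) (≡-sym eB)))))
      (roomy B (≤-trans (m≤m+n B (C₀ * h)) (≤-trans (m≤m+n _ (C₁ * h)) (m≤m+n _ m)))))
    W-exact : count (Parts.W setting) ≡ q'
    W-exact = Types.W-exact setting τ K W<K τ-small τ-large

eventual-structure : ∀ h → 0 < h → Σ ℕ λ n₀ → ∀ n → n₀ ≤ n → ∀ q' (H : Graph h) (G : Graph n) → IsEx n H G →
  SpecialColouring H (suc q') → MatchingColouring H → ((col : Fin h → Fin 3) → Proper H col → suc q' ≤ size col S) → FullStructure H G q'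
eventual-structure h h>0 = from _ _ _ _ _ _ _ _ refl refl refl refl refl refl refl refl
  where
  from : ∀ m K₁ K C₀ C₁ M B L → m ≡ 200 * (h * h) → K₁ ≡ suc (2 * m * h) → K ≡ suc (2 * m * K₁) →
    C₀ ≡ 2 * m * 2 ^ K → C₁ ≡ 2 * m * 2 ^ K₁ → M ≡ 16 * K → B ≡ M * 2 ^ K * h → L ≡ 2 * (B + C₀ * h + C₁ * h + m) + 24 * K →
    Σ ℕ λ n₀ → ∀ n → n₀ ≤ n → ∀ q' (H : Graph h) (G : Graph n) → IsEx n H G →
      SpecialColouring H (suc q') → MatchingColouring H → ((col : Fin h → Fin 3) → Proper H col → suc q' ≤ size col S) → FullStructure H G q'
  from m K₁ K C₀ C₁ M B L em eK₁ eK eC₀ eC₁ eM eB eL = with-stability (stability h L h>0 L>0)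
    where
    open Constants h m K₁ K C₀ C₁ M B L h>0 eK₁ eK eC₀ eC₁ eM eB em eL
    with-stability : (Σ ℕ λ n₀ → ∀ n → n₀ ≤ n → (H : Graph h) (col : Fin h → Fin 3) → Proper H col →
      (G : Graph n) → Free H G → n * n ≤ 2 * degreeSum G + 1 → Stable G L) →
      Σ ℕ λ n₀ → ∀ n → n₀ ≤ n → ∀ q' (H : Graph h) (G : Graph n) → IsEx n H G →
        SpecialColouring H (suc q') → MatchingColouring H → ((col : Fin h → Fin 3) → Proper H col → suc q' ≤ size col S) → FullStructure H G q'
    with-stability (n₁ , stable) = n₁ + (L + m * (4 * (h * h) + 4)) , λ n n≥ q' H G ex special matching least →
      structure n (≤-trans (m≤n+m _ n₁) n≥) q' H G ex special matching least
        (stable n (≤-trans (m≤m+n n₁ _) n≥) H (SpecialColouring.col special) (SpecialColouring.proper special) G (proj₁ ex)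
          (dense-enough {H = H} {G = G} ex least))

near-half : ∀ {s t} → s ≤ suc t → t ≤ suc s → s ≡ (s + t) / 2 ⊎ s ≡ suc (s + t) / 2
near-half {s} {t} u l with <-cmp s t
... | tri≈ _ refl _ = inj₁ (≡-sym (trans (cong (_/ 2) (r s)) (m*n/n≡m s 2)))
  where r : ∀ s → s + s ≡ s * 2
        r = solve-∀
... | tri< lt _ _ with ≤-antisym l lt
...   | refl = inj₁ (≡-sym (trans (cong (_/ 2) (r s)) (trans (+-distrib-/ 1 (s * 2) (≤-reflexive (cong (λ x → suc (suc x)) (m*n%n≡0 s 2)))) (m*n/n≡m s 2))))
  where r : ∀ s → s + suc s ≡ 1 + s * 2
        r = solve-∀
near-half {s} {t} u l | tri> _ _ gt with ≤-antisym u gt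
... | refl = inj₂ (≡-sym (trans (cong (_/ 2) (r t)) (m*n/n≡m (suc t) 2)))
  where r : ∀ t → suc (suc t + t) ≡ suc t * 2
        r = solve-∀

-- With `q = suc q'`, `n + 1 - q` is the number `s + t` of vertices outside W. The two quotients are
-- therefore the floor and the ceiling of its half.
half-of-rest : ∀ s t q' n → s + t + q' ≡ n → s ≤ suc t → t ≤ suc s → s ≡ (n + 1 ∸ suc q') / 2 ⊎ s ≡ (n + 2 ∸ suc q') / 2
half-of-rest s t q' n refl u l with near-half u l
... | inj₁ e = inj₁ (trans e (cong (_/ 2) (trans (≡-sym (m+n∸n≡m (s + t) (suc q'))) (cong (_∸ suc q') (r₁ (s + t) q')))))
  where r₁ : ∀ s q → s + suc q ≡ s + q + 1
        r₁ = solve-∀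
... | inj₂ e = inj₂ (trans e (cong (_/ 2) (trans (≡-sym (m+n∸n≡m (suc (s + t)) (suc q'))) (cong (_∸ suc q') (r₂ (s + t) q')))))
  where r₂ : ∀ s q → suc s + suc q ≡ s + q + 2
        r₂ = solve-∀

Conclusion : ∀ {n} → ℕ → ℕ → Graph n → Set
Conclusion {n} h q G = Σ (Fin n → Fin 3) λ part →
  count (λ v → ⌊ part v ≟ zero ⌋) ≡ q ∸ 1 ×
  (∀ (i : Fin 2) →
  (count (λ v → ⌊ part v ≟ suc i ⌋) ≡ (n + 1 ∸ q) / 2 ⊎
  count (λ v → ⌊ part v ≟ suc i ⌋) ≡ (n + 2 ∸ q) / 2) ×
  Σ (Fin n → Bool) λ S' →
  (∀ v → S' v ≡ true → part v ≡ suc i) ×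
  count (λ v → ⌊ part v ≟ suc i ⌋ ∧ not (S' v)) ≤ 18 * (h * h) ×
  (∀ v → S' v ≡ true → ∀ w → (adj G v w ≡ true) ⇔ (part w ≢ suc i)))
conclude : ∀ {h n q'} {H : Graph h} {G : Graph n} → FullStructure H G q' → Conclusion h (suc q') G
conclude {h} {n} {q'} {H} {G} (δ , θ , setting , W-exact) = part , W-exact , λ { zero → side-of-cut true ; (suc zero) → side-of-cut false }
  where
  open Parts setting
  open Exact setting W-exact
  open Counting setting using (parts-total; s₁; s₂)
  remaining : ∀ b → partSize b + partSize (not b) + q' ≡ n
  remaining true  = trans (cong (s₁ + s₂ +_) (≡-sym W-exact)) parts-total
  remaining false = trans (cong (_+ q') (+-comm s₂ s₁)) (remaining true)
  sizes : ∀ b → partSize b ≡ (n + 1 ∸ suc q') / 2 ⊎ partSize b ≡ (n + 2 ∸ suc q') / 2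
  sizes b = half-of-rest (partSize b) (partSize (not b)) q' n (remaining b) (balance b) (≤-trans (balance (not b)) (s≤s (≤-reflexive (cong partSize (not-involutive b)))))
  side-of-cut : ∀ b → (partSize b ≡ (n + 1 ∸ suc q') / 2 ⊎ partSize b ≡ (n + 2 ∸ suc q') / 2) ×
    Σ (Fin n → Bool) λ S' → (∀ v → S' v ≡ true → part v ≡ cls b) ×
      count (λ v → inPart b v ∧ not (S' v)) ≤ 18 * (h * h) ×
      (∀ v → S' v ≡ true → ∀ w → (adj G v w ≡ true) ⇔ (part w ≢ cls b))
  side-of-cut b = sizes b , clean b , (λ v e → ==-sound (inPart b v ∧ˡ e)) , clean-exceptions b ,
    λ v e w → mk⇔ (λ a → ==-false (not-elim (trans (≡-sym (clean-adj b v w e)) a)))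
                  (λ ne → trans (clean-adj b v w e) (cong not (≢⇒==-false ne)))
eventual-conclusion : ∀ {h} → 0 < h → ∀ {H : Graph h} q → IsQ H q → SpecialColouring H q → MatchingColouring H →
  ∃ λ (n₀ : ℕ) → ∀ (n : ℕ) → n₀ ≤ n → ∀ (G : Graph n) → IsEx n H G → Conclusion h q G
-- `q = 0` cannot occur, because the special colouring contains the S-vertex `s`.
eventual-conclusion h>0 zero isQ special _ = ⊥-elim (<⇒≱ (∃⇒count>0 (λ x → SpecialColouring.col special x == S) (==-complete (SpecialColouring.s-S special))) (SpecialColouring.small special))
eventual-conclusion {h} h>0 {H} (suc q') isQ special matching = with-bound (eventual-structure h h>0)
  where
  with-bound : (Σ ℕ λ n₀ → ∀ n → n₀ ≤ n → ∀ q' (H : Graph h) (G : Graph n) → IsEx n H G →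
    SpecialColouring H (suc q') → MatchingColouring H → ((col : Fin h → Fin 3) → Proper H col → suc q' ≤ size col S) → FullStructure H G q') →
    ∃ λ (n₀ : ℕ) → ∀ (n : ℕ) → n₀ ≤ n → ∀ (G : Graph n) → IsEx n H G → Conclusion h (suc q') G
  with-bound (n₀ , structure) = n₀ , λ n n≥ G ex → conclude {H = H} {G = G} (structure n n≥ q' H G ex special matching (q-minimal {H = H} isQ))

theorem2p5 : ∀ (h : ℕ) → ∃ λ (Mc : ℕ) →
    ∀ (k : ℕ) (F : Graph k) (side : Fin k → Bool) → BipartiteAB F side →
    ∀ (H : Graph h) (ob : OddBallooning F H) → Good F side ob →
    ¬ Bipartite H →
    ∀ (q : ℕ) → IsQ H q →
    ∃ λ (n₀ : ℕ) → ∀ (n : ℕ) → n₀ ≤ n →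
    ∀ (G : Graph n) → IsEx n H G →
    Σ (Fin n → Fin 3) λ part →
    count (λ v → ⌊ part v ≟ zero ⌋) ≡ q ∸ 1 ×
    (∀ (i : Fin 2) →
    (count (λ v → ⌊ part v ≟ suc i ⌋) ≡ (n + 1 ∸ q) / 2 ⊎
    count (λ v → ⌊ part v ≟ suc i ⌋) ≡ (n + 2 ∸ q) / 2) ×
    Σ (Fin n → Bool) λ S' →
    (∀ v → S' v ≡ true → part v ≡ suc i) ×
    count (λ v → ⌊ part v ≟ suc i ⌋ ∧ not (S' v)) ≤ Mc ×
    (∀ v → S' v ≡ true → ∀ w → (adj G v w ≡ true) ⇔ (part w ≢ suc i)))
-- A graph without vertices is bipartite, which the hypotheses exclude.
theorem2p5 zero = 0 , λ k F side bip H ob good nonbip → ⊥-elim (nonbip ((λ ()) , λ ()))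
theorem2p5 h@(suc _) = 18 * (h * h) , λ k F side bip H ob good nonbip q isQ →
  let col₀ , proper₀ , small₀ = q-attained {H = H} isQ
  in eventual-conclusion (s≤s z≤n) q isQ (specialColouring bip ob good col₀ proper₀ small₀ nonbip) (matchingColouring bip ob good)
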